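{- Let $k\ge \ell \ge 2$ be integers. Let $\varepsilon \in \left(0,\frac{1}{6k}\right)$ and let $G$ be a graph with $d=\mathrm{d}(G) \ge 1/\varepsilon$. Then $G$ contains at least one of the following: (i) a subgraph $H$ with $|V(H)|\le 3k^3d$ and $|E(H)|\ge \varepsilon^2d^2/2$, or (ii) an $(\ell+1)$-bounded minor $G'$ with $\mathrm{d}(G') \ge \frac{\ell}{2} (1-6k\varepsilon) d$, or (iii) a $k$-bounded minor $G'$ with $\mathrm{d}(G') \ge \frac{k}{8\ell} (1-2k\varepsilon) d$.
   Context: All graphs are finite and simple. $|V(G)|$, $|E(G)|$ are the numbers of vertices and edges, and $\mathrm{d}(G)=|E(G)|/|V(G)|$ is the density. A graph $H$ is a $k$-bounded minor of $G$ if there is a model of $H$ in $G$ (pairwise disjoint vertex sets inducing connected subgraphs, one per vertex of $H$, with adjacent branch sets for every edge of $H$) in which every branch set has at most $k$ vertices; i.e. $H$ is obtained from a subgraph of $G$ by contracting connected subgraphs on at most $k$ vertices.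
   Formalization: The parameter ε is taken to be a rational number in (0, 1/(6k)) instead of an arbitrary real number there; everything else is as stated. -}

module Defs where

open import Data.Nat using (ℕ; zero; suc; _+_; _<ᵇ_; _≤_)
open import Data.Fin using (Fin; toℕ)
import Data.Fin.Properties as FinP
open import Data.Bool using (Bool; true; false; if_then_else_; _∧_)
open import Data.Maybe using (Maybe; just; nothing)
import Data.Maybe.Properties as MaybeP
open import Data.Integer using (+_)
open import Data.Rational using (ℚ; _/_; 0ℚ)
open import Data.Product using (Σ; _×_; ∃; ∃-syntax)
open import Relation.Nullary using (does)
open import Relation.Binary.PropositionalEquality using (_≡_)
open import Function using (Injective)

record Graph : Set where
  field
    n      : ℕ
    adj    : Fin n → Fin n → Bool
    sym    : ∀ i j → adj i j ≡ adj j i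
    irrefl : ∀ i → adj i i ≡ false
open Graph public

count : {m : ℕ} → (Fin m → Bool) → ℕ
count {zero}  f = 0
count {suc m} f = (if f Fin.zero then 1 else 0) + count (λ x → f (Fin.suc x))

sumFin : {m : ℕ} → (Fin m → ℕ) → ℕ
sumFin {zero}  f = 0
sumFin {suc m} f = f Fin.zero + sumFin (λ x → f (Fin.suc x))

∣V∣ : Graph → ℕ
∣V∣ G = n G

∣E∣ : Graph → ℕ
∣E∣ G = sumFin (λ i → count (λ j → adj G i j ∧ (toℕ i <ᵇ toℕ j)))

frac : ℕ → ℕ → ℚ
frac a zero    = 0ℚ
frac a (suc b) = (+ a) / (suc b)

ℕtoℚ : ℕ → ℚ
ℕtoℚ a = frac a 1

-- density d(G) = |E(G)| / |V(G)|  (set to 0 for the empty graph)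
density : Graph → ℚ
density G = frac (∣E∣ G) (∣V∣ G)

-- H is a subgraph of G (up to isomorphism): an injective vertex map
-- sending edges to edges.
_⊆ᵍ_ : Graph → Graph → Set
H ⊆ᵍ G = Σ (Fin (n H) → Fin (n G)) λ f →
           Injective _≡_ _≡_ f ×
           (∀ i j → adj H i j ≡ true → adj G (f i) (f j) ≡ true)

data WalkIn (G : Graph) (P : Fin (n G) → Set) : Fin (n G) → Fin (n G) → Set where
  here : ∀ {x} → P x → WalkIn G P x x
  step : ∀ {x y z} → P x → adj G x y ≡ true → WalkIn G P y z → WalkIn G P x z

-- A model of H in G with branch sets of size at most k.
-- β x = just u means vertex x of G lies in the branch set of u;
-- disjointness of branch sets is automatic.
record BoundedModel (k : ℕ) (H G : Graph) : Set where
  field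
    β         : Fin (n G) → Maybe (Fin (n H))
    nonempty  : ∀ u → ∃[ x ] (β x ≡ just u)
    connected : ∀ u x y → β x ≡ just u → β y ≡ just u →
                WalkIn G (λ z → β z ≡ just u) x y
    small     : ∀ u → count (λ x → does (MaybeP.≡-dec FinP._≟_ (β x) (just u))) ≤ k
    edges     : ∀ u v → adj H u v ≡ true →
                ∃[ x ] ∃[ y ] (β x ≡ just u × β y ≡ just v × adj G x y ≡ true)

_≼[_]_ : Graph → ℕ → Graph → Set
H ≼[ k ] G = BoundedModel k H G

{-# OPTIONS --safe #-}
module Submission where

-- Pass to a subgraph F with minimum degree ≥ d and about d |V(F)| edges, and put e = ⌈ε d⌉. Partition V(F) into
-- connected parts of at most k vertices, starting from singletons, and repeatedly merge two adjacent parts of at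
-- most k/2 vertices ("small" parts). In the quotient a merge costs one edge plus one per common neighbour, so fewer
-- than e common neighbours means a loss of at most e ≤ 2 ε d edges; if a small part has e small neighbours, each
-- with at least e common neighbours, these span the dense subgraph of (i). A large part with two vertices that both
-- see many small parts is split between them and both halves grow again. Each step loses O(e) edges per small
-- part that disappears, so O(e |V(F)|) edges are lost in total.
--
-- When no step applies, few parts remain and the quotient is the minor of (iii), or there are many small parts. In
-- the latter case let A contain one vertex of each small part and B the vertices of degree > 4kd together with the
-- at most one rich vertex of each large part: after discarding a few vertices of A, almost all neighbours of A lie
-- in B and |A| > ℓ |B|. Either some a ∈ A has e mates (vertices sharing e neighbours with it), which gives (i), or
-- an alternating-path argument assigns to every vertex of some nonempty R ⊆ B exactly ℓ neighbours in A, pairwise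
-- not mates and with almost all their B-neighbours in R. Contracting these stars gives (ii).

-- The number of small parts serves as the potential. A split may raise it by two, but the two
-- halves together have at most `k` vertices, so at least one of them is small, and each small half
-- then absorbs small parts until two of them have disappeared. Hence a split also ends with fewer
-- small parts than before.
--
-- Vertices of degree above `4kd` have to stay alone. Inside a small part they could give it
-- arbitrarily many neighbouring parts, and the subgraph spanned around it could not be held to
-- `3k³d` vertices. That `F` has hardly more than `d |V(F)|` edges limits the number of these
-- vertices to `|V(F)| / k`, so all of them can be put into `B`.

module Combinatorics where

  open import Defs
  open import Data.Nat using (ℕ; zero; suc; _+_; _*_; _∸_; _≤_; _<_; _<ᵇ_; z≤n; s≤s; _≤?_; _<?_; >-nonZero)
  open import Data.Nat.Properties hiding (_≟_; _≤?_; _<?_; suc-injective)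
  open import Data.Nat.Tactic.RingSolver using (solve-∀)
  open import Data.Fin using (Fin; toℕ; fromℕ<; _≟_)
  open import Data.Fin.Properties using (toℕ-injective; any?; suc-injective)
  open import Data.Bool using (Bool; true; false; if_then_else_; _∧_; _∨_; not)
  open import Data.Bool.Properties using (∧-comm; ∨-comm) renaming (_≟_ to _≟ᵇ_)
  open import Data.Maybe using (Maybe; just; nothing)
  import Data.Maybe.Properties as MaybeP
  open import Data.Product using (Σ; _×_; _,_; proj₁; proj₂; ∃-syntax)
  open import Data.Sum using (_⊎_; inj₁; inj₂; [_,_]′; map₂)
  import Data.Sum as Sum
  open import Data.Empty using (⊥; ⊥-elim)
  open import Function using (_∘_)
  open import Relation.Nullary using (¬_; Dec; yes; no; does)
  open import Relation.Nullary.Decidable using (_×-dec_; _⊎-dec_; ¬?; decidable-stable)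
  open import Relation.Binary.PropositionalEquality renaming (sym to ≡-sym)

  -- Counting on finite sets

  private
    variable
      m k : ℕ

  ⟦_⟧ : Bool → ℕ
  ⟦ b ⟧ = if b then 1 else 0

  infix 5 _==_
  _==_ : Fin m → Fin m → Bool
  x == y = does (x ≟ y)

  does-true : ∀ {A : Set} (d : Dec A) → does d ≡ true → A
  does-true (yes a) _ = a

  true-does : ∀ {A : Set} (d : Dec A) → A → does d ≡ true
  true-does (yes _) _ = refl
  true-does (no ¬a) a = ⊥-elim (¬a a)

  false-does : ∀ {A : Set} (d : Dec A) → ¬ A → does d ≡ false
  false-does (yes a) ¬a = ⊥-elim (¬a a)
  false-does (no _) _ = refl

  ==⇒≡ : {x y : Fin m} → (x == y) ≡ true → x ≡ y
  ==⇒≡ {x = x} {y} = does-true (x ≟ y)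

  ≡⇒== : {x y : Fin m} → x ≡ y → (x == y) ≡ true
  ≡⇒== {x = x} {y} = true-does (x ≟ y)

  ≢⇒== : {x y : Fin m} → x ≢ y → (x == y) ≡ false
  ≢⇒== {x = x} {y} = false-does (x ≟ y)

  true≢false : ∀ {b} → b ≡ true → b ≡ false → ∀ {A : Set} → A
  true≢false refl ()

  ¬true⇒false : ∀ {b} → ¬ b ≡ true → b ≡ false
  ¬true⇒false {true} h = ⊥-elim (h refl)
  ¬true⇒false {false} _ = refl

  not-true : ∀ {b} → not b ≡ true → b ≡ false
  not-true {false} _ = refl

  ∧-intro : ∀ {a b} → a ≡ true → b ≡ true → a ∧ b ≡ true
  ∧-intro refl refl = refl

  ∧-elim : ∀ {a b} → a ∧ b ≡ true → a ≡ true × b ≡ true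
  ∧-elim {true} {true} _ = refl , refl

  ⟦⟧≤1 : ∀ b → ⟦ b ⟧ ≤ 1
  ⟦⟧≤1 true = ≤-refl
  ⟦⟧≤1 false = z≤n

  ⟦⟧-mono : ∀ {a b} → (a ≡ true → b ≡ true) → ⟦ a ⟧ ≤ ⟦ b ⟧
  ⟦⟧-mono {false} _ = z≤n
  ⟦⟧-mono {true} h rewrite h refl = ≤-refl

  ⟦⟧≤ : ∀ {a} {t : ℕ} → (a ≡ true → 1 ≤ t) → ⟦ a ⟧ ≤ t
  ⟦⟧≤ {false} _ = z≤n
  ⟦⟧≤ {true} h = h refl

  ⟦⟧*≤ : ∀ {a} {s t : ℕ} → (a ≡ true → s ≤ t) → ⟦ a ⟧ * s ≤ t
  ⟦⟧*≤ {false} _ = z≤n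
  ⟦⟧*≤ {true} {s} h = subst (_≤ _) (≡-sym (*-identityˡ s)) (h refl)

  ≤⟦⟧* : ∀ {a} {s t : ℕ} → a ≡ true → s ≤ t → s ≤ ⟦ a ⟧ * t
  ≤⟦⟧* {_} {s} {t} refl h = subst (s ≤_) (≡-sym (*-identityˡ t)) h

  ⟦true⟧* : ∀ {b} t → b ≡ true → ⟦ b ⟧ * t ≡ t
  ⟦true⟧* t refl = *-identityˡ t

  ⟦false⟧* : ∀ {b} t → b ≡ false → ⟦ b ⟧ * t ≡ 0
  ⟦false⟧* t refl = refl

  ⟦∧⟧ : ∀ a b → ⟦ a ∧ b ⟧ ≡ ⟦ a ⟧ * ⟦ b ⟧
  ⟦∧⟧ true b = ≡-sym (*-identityˡ ⟦ b ⟧)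
  ⟦∧⟧ false b = refl

  ⟦∨⟧≤ : ∀ a b → ⟦ a ∨ b ⟧ ≤ ⟦ a ⟧ + ⟦ b ⟧
  ⟦∨⟧≤ true b = m≤m+n 1 _
  ⟦∨⟧≤ false b = ≤-refl

  ∑ : (Fin m → ℕ) → ℕ
  ∑ = sumFin

  ∑-cong : {f g : Fin m → ℕ} → (∀ x → f x ≡ g x) → ∑ f ≡ ∑ g
  ∑-cong {zero} h = refl
  ∑-cong {suc m} h = cong₂ _+_ (h Fin.zero) (∑-cong (λ x → h (Fin.suc x)))

  ∑-mono : {f g : Fin m → ℕ} → (∀ x → f x ≤ g x) → ∑ f ≤ ∑ g
  ∑-mono {zero} h = z≤n
  ∑-mono {suc m} h = +-mono-≤ (h Fin.zero) (∑-mono (λ x → h (Fin.suc x)))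

  ∑-zero : ∀ m → ∑ {m} (λ _ → 0) ≡ 0
  ∑-zero zero = refl
  ∑-zero (suc m) = ∑-zero m

  ∑-+ : (f g : Fin m → ℕ) → ∑ (λ x → f x + g x) ≡ ∑ f + ∑ g
  ∑-+ {zero} f g = refl
  ∑-+ {suc m} f g =
    trans (cong (f Fin.zero + g Fin.zero +_) (∑-+ (λ x → f (Fin.suc x)) (λ x → g (Fin.suc x))))
          (shuffle (f Fin.zero) (g Fin.zero) _ _)
    where
    shuffle : ∀ a b c d → a + b + (c + d) ≡ a + c + (b + d)
    shuffle = solve-∀

  ∑-*ˡ : (c : ℕ) (f : Fin m → ℕ) → ∑ (λ x → c * f x) ≡ c * ∑ f
  ∑-*ˡ {zero} c f = ≡-sym (*-zeroʳ c)
  ∑-*ˡ {suc m} c f =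
    trans (cong (c * f Fin.zero +_) (∑-*ˡ c (λ x → f (Fin.suc x)))) (≡-sym (*-distribˡ-+ c _ _))

  ∑-*ʳ : (c : ℕ) (f : Fin m → ℕ) → ∑ (λ x → f x * c) ≡ ∑ f * c
  ∑-*ʳ c f = trans (∑-cong (λ x → *-comm (f x) c)) (trans (∑-*ˡ c f) (*-comm c (∑ f)))

  ∑-const : ∀ m c → ∑ {m} (λ _ → c) ≡ m * c
  ∑-const zero c = refl
  ∑-const (suc m) c = cong (c +_) (∑-const m c)

  ∑∑ : (Fin m → Fin k → ℕ) → ℕ
  ∑∑ f = ∑ (λ x → ∑ (f x))

  ∑∑-mono : {f g : Fin m → Fin k → ℕ} → (∀ x y → f x y ≤ g x y) → ∑∑ f ≤ ∑∑ g
  ∑∑-mono h = ∑-mono λ x → ∑-mono (h x)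

  ∑∑-+ : (f g : Fin m → Fin k → ℕ) → ∑∑ (λ x y → f x y + g x y) ≡ ∑∑ f + ∑∑ g
  ∑∑-+ f g = trans (∑-cong λ x → ∑-+ (f x) (g x)) (∑-+ (λ x → ∑ (f x)) (λ x → ∑ (g x)))

  ∑∑-+₃ : (f g h : Fin m → Fin k → ℕ) → ∑∑ (λ x y → f x y + (g x y + h x y)) ≡ ∑∑ f + (∑∑ g + ∑∑ h)
  ∑∑-+₃ f g h = trans (∑∑-+ f (λ x y → g x y + h x y)) (cong (∑∑ f +_) (∑∑-+ g h))

  ∑-swap : (f : Fin m → Fin k → ℕ) → ∑ (λ x → ∑ (f x)) ≡ ∑ (λ y → ∑ (λ x → f x y))
  ∑-swap {zero} {k} f = ≡-sym (∑-zero k)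
  ∑-swap {suc m} f =
    trans (cong (∑ (f Fin.zero) +_) (∑-swap (λ x → f (Fin.suc x))))
          (≡-sym (∑-+ (f Fin.zero) (λ y → ∑ (λ x → f (Fin.suc x) y))))

  ∑-point : (a : Fin m) (f : Fin m → ℕ) → ∑ (λ x → ⟦ a == x ⟧ * f x) ≡ f a
  ∑-point {suc m} Fin.zero f =
    trans (cong₂ _+_ (*-identityˡ _) (trans (∑-cong {f = λ x → ⟦ Fin.zero == Fin.suc x ⟧ * f (Fin.suc x)} (λ x → refl)) (∑-zero m))) (+-identityʳ _)
  ∑-point {suc m} (Fin.suc a) f =
    trans (∑-cong (λ x → cong (λ b → ⟦ b ⟧ * f (Fin.suc x)) (suc-== a x))) (∑-point a (λ x → f (Fin.suc x)))
    where
    suc-== : ∀ (a x : Fin m) → (Fin.suc a == Fin.suc x) ≡ (a == x)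
    suc-== a x with a ≟ x
    ... | yes _ = refl
    ... | no _ = refl

  ==-sym : (x y : Fin m) → (x == y) ≡ (y == x)
  ==-sym x y with x ≟ y
  ... | yes refl = ≡-sym (≡⇒== {x = x} refl)
  ... | no h = ≡-sym (≢⇒== (λ p → h (≡-sym p)))

  ∑-point′ : (a : Fin m) (f : Fin m → ℕ) → ∑ (λ x → ⟦ x == a ⟧ * f x) ≡ f a
  ∑-point′ a f = trans (∑-cong (λ x → cong (λ b → ⟦ b ⟧ * f x) (==-sym x a))) (∑-point a f)

  -- Every `x` lies in exactly one fibre, that of `r x`. With `r` sending a vertex to the label of
  -- its part, this converts sums over parts into sums over vertices and back.
  ∑-fibre : (r : Fin m → Fin k) (f : Fin k → Fin m → ℕ) →
            ∑ (λ c → ∑ (λ x → ⟦ r x == c ⟧ * f c x)) ≡ ∑ (λ x → f (r x) x)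
  ∑-fibre r f = trans (∑-swap (λ c x → ⟦ r x == c ⟧ * f c x)) (∑-cong (λ x → ∑-point (r x) (λ c → f c x)))

  term≤∑ : (f : Fin m → ℕ) (x : Fin m) → f x ≤ ∑ f
  term≤∑ f Fin.zero = m≤m+n _ _
  term≤∑ f (Fin.suc x) = ≤-trans (term≤∑ (λ y → f (Fin.suc y)) x) (m≤n+m _ _)

  ∑≤ : (f : Fin m → ℕ) (c : ℕ) → (∀ x → f x ≤ c) → ∑ f ≤ m * c
  ∑≤ {m} f c h = ≤-trans (∑-mono h) (≤-reflexive (∑-const m c))

  count≡∑ : (p : Fin m → Bool) → count p ≡ ∑ (λ x → ⟦ p x ⟧)
  count≡∑ {zero} p = refl
  count≡∑ {suc m} p = cong (⟦ p Fin.zero ⟧ +_) (count≡∑ (λ x → p (Fin.suc x)))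

  count-* : (p : Fin m → Bool) (t : ℕ) → count p * t ≡ ∑ (λ x → ⟦ p x ⟧ * t)
  count-* p t = trans (cong (_* t) (count≡∑ p)) (≡-sym (∑-*ʳ t (λ x → ⟦ p x ⟧)))

  count-cong : {p q : Fin m → Bool} → (∀ x → p x ≡ q x) → count p ≡ count q
  count-cong {zero} h = refl
  count-cong {suc m} h = cong₂ _+_ (cong ⟦_⟧ (h Fin.zero)) (count-cong (λ x → h (Fin.suc x)))

  count-mono : {p q : Fin m → Bool} → (∀ x → p x ≡ true → q x ≡ true) → count p ≤ count q
  count-mono {zero} h = z≤n
  count-mono {suc m} h = +-mono-≤ (⟦⟧-mono (h Fin.zero)) (count-mono (λ x → h (Fin.suc x)))

  count≤ : (p : Fin m → Bool) → count p ≤ m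
  count≤ {m} p = ≤-trans (≤-reflexive (count≡∑ p)) (≤-trans (∑≤ _ 1 (λ x → ⟦⟧≤1 (p x))) (≤-reflexive (*-identityʳ m)))

  any : (Fin m → Bool) → Bool
  any {zero} p = false
  any {suc m} p = p Fin.zero ∨ any (λ x → p (Fin.suc x))

  any-intro : (p : Fin m → Bool) (x : Fin m) → p x ≡ true → any p ≡ true
  any-intro p Fin.zero h rewrite h = refl
  any-intro p (Fin.suc x) h with p Fin.zero
  ... | true = refl
  ... | false = any-intro (λ y → p (Fin.suc y)) x h

  any-elim : (p : Fin m → Bool) → any p ≡ true → ∃[ x ] p x ≡ true
  any-elim {suc m} p h with p Fin.zero in eq
  ... | true = Fin.zero , eq
  ... | false with any-elim (λ y → p (Fin.suc y)) h
  ...   | x , q = Fin.suc x , q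

  ⟦any⟧≤ : (p : Fin m → Bool) → ⟦ any p ⟧ ≤ ∑ (λ x → ⟦ p x ⟧)
  ⟦any⟧≤ {zero} p = z≤n
  ⟦any⟧≤ {suc m} p = ≤-trans (⟦∨⟧≤ (p Fin.zero) _) (+-monoʳ-≤ ⟦ p Fin.zero ⟧ (⟦any⟧≤ (λ x → p (Fin.suc x))))

  ∑-unique : (p : Fin m → Bool) → (∀ x y → p x ≡ true → p y ≡ true → x ≡ y) →
             ∑ (λ x → ⟦ p x ⟧) ≤ ⟦ any p ⟧
  ∑-unique {m} p h with any p in eq
  ... | true with any-elim p eq
  ...   | a , pa = ≤-trans (∑-mono (λ x → ⟦⟧≤ (λ px → ≤⟦⟧* (≡⇒== (h a x pa px)) ≤-refl)))
                           (≤-reflexive (∑-point a (λ _ → 1)))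
  ∑-unique {m} p h | false =
    ≤-reflexive (trans (∑-cong (λ x → cong ⟦_⟧ (¬true⇒false λ px → true≢false (any-intro p x px) eq))) (∑-zero m))

  count-pos : (p : Fin m → Bool) → 1 ≤ count p → ∃[ x ] p x ≡ true
  count-pos {suc m} p h with p Fin.zero in eq
  ... | true = Fin.zero , eq
  ... | false with count-pos (λ y → p (Fin.suc y)) h
  ...   | x , q = Fin.suc x , q

  pos-count : (p : Fin m → Bool) (x : Fin m) → p x ≡ true → 1 ≤ count p
  pos-count p x h =
    ≤-trans (≤-reflexive (≡-sym (cong ⟦_⟧ h))) (≤-trans (term≤∑ (λ y → ⟦ p y ⟧) x) (≤-reflexive (≡-sym (count≡∑ p))))

  -- Trims a set to exactly `e` elements: a vertex may have far more than `e` mates, and using all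
  -- of them would make the dense subgraph too large.
  select : (p : Fin m → Bool) (e : ℕ) → e ≤ count p →
           ∃[ q ] (∀ x → q x ≡ true → p x ≡ true) × count q ≡ e
  select {zero} p zero z≤n = p , (λ _ h → h) , refl
  select {suc m} p zero _ = (λ _ → false) , (λ _ ()) , trans (count≡∑ {suc m} (λ _ → false)) (∑-zero m)
  select {suc m} p (suc e) h with p Fin.zero in eq
  select {suc m} p (suc e) (s≤s h) | true with select (λ y → p (Fin.suc y)) e h
  ... | q , q⊆p , c = q′ , sub , cong suc c
    where
    q′ : Fin (suc m) → Bool
    q′ Fin.zero = true
    q′ (Fin.suc x) = q x
    sub : ∀ x → q′ x ≡ true → p x ≡ true
    sub Fin.zero _ = eq
    sub (Fin.suc x) = q⊆p x
  select {suc m} p (suc e) h | false with select (λ y → p (Fin.suc y)) (suc e) h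
  ... | q , q⊆p , c = q′ , sub , c
    where
    q′ : Fin (suc m) → Bool
    q′ Fin.zero = false
    q′ (Fin.suc x) = q x
    sub : ∀ x → q′ x ≡ true → p x ≡ true
    sub (Fin.suc x) = q⊆p x

  -- The Boolean is an explicit argument because the type `Fin (count p)` depends on it: proofs
  -- about `enum` generalise over `b` together with the index and then split on `b`.
  enum-step : (b : Bool) {j m : ℕ} → (Fin j → Fin m) → Fin (⟦ b ⟧ + j) → Fin (suc m)
  enum-step true g Fin.zero = Fin.zero
  enum-step true g (Fin.suc i) = Fin.suc (g i)
  enum-step false g i = Fin.suc (g i)

  enum : (p : Fin m → Bool) → Fin (count p) → Fin m
  enum {suc m} p = enum-step (p Fin.zero) (enum (λ x → p (Fin.suc x)))

  enum-sat : (p : Fin m → Bool) (i : Fin (count p)) → p (enum p i) ≡ true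
  enum-sat {suc m} p i = go (p Fin.zero) refl i
    where
    go : ∀ b → p Fin.zero ≡ b → (i : Fin (⟦ b ⟧ + count (λ x → p (Fin.suc x)))) →
         p (enum-step b (enum (λ x → p (Fin.suc x))) i) ≡ true
    go true eq Fin.zero = eq
    go true eq (Fin.suc i) = enum-sat (λ x → p (Fin.suc x)) i
    go false eq i = enum-sat (λ x → p (Fin.suc x)) i

  enum-inj : (p : Fin m → Bool) {i j : Fin (count p)} → enum p i ≡ enum p j → i ≡ j
  enum-inj {suc m} p {i} {j} = go (p Fin.zero) i j
    where
    go : ∀ b → (i j : Fin (⟦ b ⟧ + count (λ x → p (Fin.suc x)))) →
         enum-step b (enum (λ x → p (Fin.suc x))) i ≡ enum-step b (enum (λ x → p (Fin.suc x))) j → i ≡ j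
    go true Fin.zero Fin.zero _ = refl
    go true (Fin.suc i) (Fin.suc j) h = cong Fin.suc (enum-inj (λ x → p (Fin.suc x)) (suc-injective h))
    go false i j h = enum-inj (λ x → p (Fin.suc x)) (suc-injective h)

  index : (p : Fin m → Bool) (x : Fin m) → p x ≡ true → ∃[ i ] enum p i ≡ x
  index {suc m} p x = go (p Fin.zero) refl x
    where
    go : ∀ b → p Fin.zero ≡ b → ∀ x → p x ≡ true → ∃[ i ] enum-step b (enum (λ x → p (Fin.suc x))) i ≡ x
    go true eq Fin.zero h = Fin.zero , refl
    go false eq Fin.zero h = true≢false h eq
    go b eq (Fin.suc x) h with index (λ y → p (Fin.suc y)) x h
    go true eq (Fin.suc x) h | i , q = Fin.suc i , cong Fin.suc q
    go false eq (Fin.suc x) h | i , q = i , cong Fin.suc q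

  ∑-enum : (p : Fin m → Bool) (f : Fin m → ℕ) → ∑ (λ i → f (enum p i)) ≡ ∑ (λ x → ⟦ p x ⟧ * f x)
  ∑-enum {zero} p f = refl
  ∑-enum {suc m} p f = go (p Fin.zero)
    where
    go : ∀ b → ∑ (λ i → f (enum-step b (enum (λ x → p (Fin.suc x))) i)) ≡
               ⟦ b ⟧ * f Fin.zero + ∑ (λ x → ⟦ p (Fin.suc x) ⟧ * f (Fin.suc x))
    go true = cong₂ _+_ (≡-sym (*-identityˡ _)) (∑-enum (λ x → p (Fin.suc x)) (λ x → f (Fin.suc x)))
    go false = ∑-enum (λ x → p (Fin.suc x)) (λ x → f (Fin.suc x))

  ∑-== : ∀ {m} (a : Fin m) → ∑ (λ x → ⟦ x == a ⟧) ≡ 1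
  ∑-== a = trans (∑-cong (λ x → ≡-sym (*-identityʳ ⟦ x == a ⟧))) (∑-point′ a (λ _ → 1))

  insert : ∀ {m} → Fin m → (Fin m → Bool) → Fin m → Bool
  insert y S x = S x ∨ (x == y)

  insert-elim : ∀ {m} {y x : Fin m} {S} {C : Set} → insert y S x ≡ true →
                (S x ≡ true → C) → (x ≡ y → C) → C
  insert-elim {y = y} {x} {S} h f g with S x
  ... | true = f refl
  ... | false = g (==⇒≡ h)

  insert-new : ∀ {m} (y : Fin m) S → insert y S y ≡ true
  insert-new y S with S y
  ... | true = refl
  ... | false = ≡⇒== {x = y} refl

  insert-old : ∀ {m} (y : Fin m) S {x} → S x ≡ true → insert y S x ≡ true
  insert-old y S h rewrite h = refl

  count-insert : ∀ {m} (y : Fin m) S → S y ≡ false → count (insert y S) ≡ suc (count S)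
  count-insert y S h =
    trans (count≡∑ (insert y S))
    (trans (∑-cong pointwise)
    (trans (∑-+ (λ x → ⟦ S x ⟧) (λ x → ⟦ x == y ⟧))
    (trans (cong₂ _+_ (≡-sym (count≡∑ S)) (∑-== y)) (+-comm _ 1))))
    where
    pointwise : ∀ x → ⟦ insert y S x ⟧ ≡ ⟦ S x ⟧ + ⟦ x == y ⟧
    pointwise x with S x in eq
    ... | false = refl
    ... | true rewrite ≢⇒== {x = x} {y} (λ p → true≢false eq (trans (cong S p) h)) = refl

  count-insert≤ : ∀ {m} (y : Fin m) S → count (insert y S) ≤ suc (count S)
  count-insert≤ y S with S y in eq
  ... | false = ≤-reflexive (count-insert y S eq)
  ... | true = ≤-trans (count-mono {p = insert y S} {q = S} λ x h → insert-elim {S = S} h (λ h′ → h′) λ { refl → eq }) (n≤1+n (count S))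

  -- Subgraphs, quotients and minors

  -- Ordered adjacent pairs, hence twice the number of edges. All edge counts use this form, which
  -- needs no order on the vertices.
  degSum : Graph → ℕ
  degSum G = ∑∑ (λ x y → ⟦ adj G x y ⟧)

  deg : (G : Graph) → Fin (n G) → ℕ
  deg G x = ∑ (λ y → ⟦ adj G x y ⟧)

  <ᵇ-trichotomy : ∀ a b → a ≢ b → ⟦ a <ᵇ b ⟧ + ⟦ b <ᵇ a ⟧ ≡ 1
  <ᵇ-trichotomy zero zero h = ⊥-elim (h refl)
  <ᵇ-trichotomy zero (suc b) h = refl
  <ᵇ-trichotomy (suc a) zero h = refl
  <ᵇ-trichotomy (suc a) (suc b) h = <ᵇ-trichotomy a b (h ∘ cong suc)

  degSum≡2E : ∀ G → degSum G ≡ ∣E∣ G + ∣E∣ G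
  degSum≡2E G =
    trans (∑-cong (λ x → trans (∑-cong (pointwise x)) (∑-+ (up x) (down x))))
    (trans (∑-+ (∑ ∘ up) (∑ ∘ down))
    (cong₂ _+_ ups (trans (∑-swap down)
      (trans (∑-cong (λ y → ∑-cong (λ x → cong (λ b → ⟦ b ∧ (toℕ y <ᵇ toℕ x) ⟧) (sym G x y)))) ups))))
    where
    up down : Fin (n G) → Fin (n G) → ℕ
    up x y = ⟦ adj G x y ∧ (toℕ x <ᵇ toℕ y) ⟧
    down x y = ⟦ adj G x y ∧ (toℕ y <ᵇ toℕ x) ⟧
    ups : ∑ (∑ ∘ up) ≡ ∣E∣ G
    ups = ∑-cong (λ x → ≡-sym (count≡∑ (λ y → adj G x y ∧ (toℕ x <ᵇ toℕ y))))
    pointwise : ∀ x y → ⟦ adj G x y ⟧ ≡ up x y + down x y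
    pointwise x y with adj G x y in eq
    ... | false = refl
    ... | true = ≡-sym (<ᵇ-trichotomy (toℕ x) (toℕ y) λ p →
                   true≢false eq (trans (cong (λ z → adj G z y) (toℕ-injective p)) (irrefl G y)))

  -- The relation is arbitrary so that induced subgraphs (`R` is adjacency) and quotients (`R` is
  -- adjacency of parts) share one edge count.
  restrict : ∀ {m} (p : Fin m → Bool) (R : Fin m → Fin m → Bool) →
             (∀ x y → R x y ≡ R y x) → (∀ x → R x x ≡ false) → Graph
  restrict p R R-sym R-irrefl = record
    { n = count p
    ; adj = λ i j → R (enum p i) (enum p j)
    ; sym = λ i j → R-sym (enum p i) (enum p j)
    ; irrefl = λ i → R-irrefl (enum p i) }

  degSum-restrict : ∀ {m} (p : Fin m → Bool) R (s : ∀ x y → R x y ≡ R y x) (i : ∀ x → R x x ≡ false) →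
                    degSum (restrict p R s i) ≡ ∑ (λ x → ∑ (λ y → ⟦ p x ∧ (p y ∧ R x y) ⟧))
  degSum-restrict p R s i =
    trans (∑-enum p (λ x → ∑ (λ j → ⟦ R x (enum p j) ⟧)))
    (∑-cong λ x → trans (cong (⟦ p x ⟧ *_) (∑-enum p (λ y → ⟦ R x y ⟧)))
    (trans (≡-sym (∑-*ˡ ⟦ p x ⟧ (λ y → ⟦ p y ⟧ * ⟦ R x y ⟧))) (∑-cong λ y → ≡-sym
      (trans (⟦∧⟧ (p x) (p y ∧ R x y)) (cong (⟦ p x ⟧ *_) (⟦∧⟧ (p y) (R x y)))))))

  induced : (G : Graph) → (Fin (n G) → Bool) → Graph
  induced G p = restrict p (adj G) (sym G) (irrefl G)

  induced⊆ : ∀ G p → induced G p ⊆ᵍ G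
  induced⊆ G p = enum p , enum-inj p , λ _ _ h → h

  ⊆ᵍ-refl : ∀ {G} → G ⊆ᵍ G
  ⊆ᵍ-refl = (λ x → x) , (λ h → h) , λ _ _ h → h

  ⊆ᵍ-trans : ∀ {F G H} → F ⊆ᵍ G → G ⊆ᵍ H → F ⊆ᵍ H
  ⊆ᵍ-trans (f , f-inj , f-adj) (g , g-inj , g-adj) =
    (g ∘ f) , (f-inj ∘ g-inj) , λ i j h → g-adj (f i) (f j) (f-adj i j h)

  module _ {G : Graph} where

    walk-map : ∀ {P Q : Fin (n G) → Set} {x y} → (∀ {z} → P z → Q z) → WalkIn G P x y → WalkIn G Q x y
    walk-map f (here p) = here (f p)
    walk-map f (step p a w) = step (f p) a (walk-map f w)

    walk-trans : ∀ {P : Fin (n G) → Set} {x y z} → WalkIn G P x y → WalkIn G P y z → WalkIn G P x z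
    walk-trans (here _) w = w
    walk-trans (step p a v) w = step p a (walk-trans v w)

    walk-rev : ∀ {P : Fin (n G) → Set} {x y} → WalkIn G P x y → WalkIn G P y x
    walk-rev w = go w (here (start w))
      where
      start : ∀ {P : Fin (n G) → Set} {x y} → WalkIn G P x y → P x
      start (here p) = p
      start (step p _ _) = p
      go : ∀ {P : Fin (n G) → Set} {x y z} → WalkIn G P x y → WalkIn G P x z → WalkIn G P y z
      go (here _) acc = acc
      go (step {x} {y} p a w) acc = go w (step (start w) (trans (sym G y x) a) acc)

  -- Grow S from t₁ inside P ∖ {t₂}; once no edge leads from S to the rest of P ∖ {t₂},
  -- a walk in P starting outside S cannot enter S before it visits t₂.
  module _ (G : Graph) (P : Fin (n G) → Bool) (t₁ t₂ : Fin (n G)) where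

    private
      V = Fin (n G)

    record Split : Set where
      field
        S : V → Bool
        S⊆P : ∀ x → S x ≡ true → P x ≡ true
        t₁∈S : S t₁ ≡ true
        t₂∉S : S t₂ ≡ false
        walk₁ : ∀ x → S x ≡ true → WalkIn G (λ z → S z ≡ true) x t₁
        walk₂ : ∀ x → P x ≡ true → S x ≡ false → WalkIn G (λ z → P z ≡ true × S z ≡ false) x t₂

    split : P t₁ ≡ true → t₁ ≢ t₂ →
            (∀ x → P x ≡ true → WalkIn G (λ z → P z ≡ true) x t₂) → Split
    split Pt₁ t₁≢t₂ walk =
      grow (n G) (λ x → x == t₁) (λ x h → subst (λ z → P z ≡ true) (≡-sym (==⇒≡ h)) Pt₁)
        (≡⇒== {x = t₁} refl) (≢⇒== (t₁≢t₂ ∘ ≡-sym))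
        (λ x h → subst (λ z → WalkIn G _ z t₁) (≡-sym (==⇒≡ h)) (here (≡⇒== {x = t₁} refl)))
        (m≤m+n _ _)
      where
      frontier : (V → Bool) → V → V → Bool
      frontier S x y = S x ∧ (adj G x y ∧ (P y ∧ (not (S y) ∧ not (y == t₂))))
      -- The fuel bounds the number of vertices outside `S`. Each extension adds one vertex, so
      -- running out of fuel would give `S` more than `n G` elements.
      grow : ∀ fuel (S : V → Bool) → (∀ x → S x ≡ true → P x ≡ true) → S t₁ ≡ true → S t₂ ≡ false →
             (∀ x → S x ≡ true → WalkIn G (λ z → S z ≡ true) x t₁) → n G ≤ fuel + count S → Split
      grow fuel S S⊆P t₁∈S t₂∉S walk₁ bound with any (λ x → any (frontier S x)) in eq
      ... | false = record { S = S ; S⊆P = S⊆P ; t₁∈S = t₁∈S ; t₂∉S = t₂∉S ; walk₁ = walk₁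
                           ; walk₂ = λ x Px Sx → stay Sx (walk x Px) }
        where
        stay : ∀ {x} → S x ≡ false → WalkIn G (λ z → P z ≡ true) x t₂ →
               WalkIn G (λ z → P z ≡ true × S z ≡ false) x t₂
        stay Sx (here p) = here (p , Sx)
        stay {x} Sx (step {y = y} p a w) with x ≟ t₂
        ... | yes refl = here (p , Sx)
        ... | no x≢t₂ = step (p , Sx) a (stay Sy w)
          where
          Sy : S y ≡ false
          Sy = ¬true⇒false λ Sy → true≢false
            (any-intro _ y (any-intro _ x (∧-intro Sy (∧-intro (trans (sym G y x) a)
              (∧-intro p (∧-intro (cong not Sx) (cong not (≢⇒== x≢t₂)))))))) eq
      ... | true with any-elim _ eq
      ...   | x , hx with any-elim _ hx
      ...     | y , h with ∧-elim {S x} h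
      ...       | Sx , h₁ with ∧-elim {adj G x y} h₁
      ...         | axy , h₂ with ∧-elim {P y} h₂
      ...           | Py , h₃ with ∧-elim {not (S y)} h₃
      ...             | Sy , y≢t₂ = extend fuel bound
        where
        S′ = insert y S
        size : count S′ ≡ suc (count S)
        size = count-insert y S (not-true Sy)
        lift : ∀ {z} → S z ≡ true → S′ z ≡ true
        lift = insert-old y S
        extend : ∀ fuel → n G ≤ fuel + count S → Split
        extend zero b = ⊥-elim (<-irrefl refl (≤-trans (≤-trans (s≤s b) (≤-reflexive (≡-sym size))) (count≤ S′)))
        extend (suc fuel) b = grow fuel S′
          (λ z h → insert-elim {S = S} h (S⊆P z) λ { refl → Py })
          (lift t₁∈S)
          (¬true⇒false λ h → insert-elim {S = S} h (λ h′ → true≢false h′ t₂∉S)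
             λ p → true≢false (≡⇒== {x = y} (≡-sym p)) (not-true y≢t₂))
          (λ z h → insert-elim {S = S} h (λ h′ → walk-map lift (walk₁ z h′))
             λ { refl → step (insert-new y S) (trans (sym G y x) axy) (walk-map lift (walk₁ x Sx)) })
          (≤-trans b (≤-reflexive (trans (≡-sym (+-suc fuel (count S))) (cong (fuel +_) (≡-sym size)))))

  -- The label of a part is itself a vertex of `G`. Quotients by different partitions thus have the
  -- same index type, and their adjacencies can be compared entry by entry without relabelling.
  module Quotient (G : Graph) (r : Fin (n G) → Fin (n G)) where

    private
      V = Fin (n G)

    link : V → V → V → V → Bool
    link u v x y = (r x == u) ∧ ((r y == v) ∧ adj G x y)

    padj : V → V → Bool
    padj u v = not (u == v) ∧ any (λ x → any (link u v x))

    padj-elim : ∀ {u v} → padj u v ≡ true → u ≢ v × ∃[ x ] ∃[ y ] (r x ≡ u × r y ≡ v × adj G x y ≡ true)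
    padj-elim {u} {v} h with ∧-elim {not (u == v)} h
    ... | u≢v , h₁ with any-elim (λ x → any (link u v x)) h₁
    ...   | x , h₂ with any-elim (link u v x) h₂
    ...     | y , h₃ with ∧-elim {r x == u} h₃
    ...       | rx , h₄ with ∧-elim {r y == v} h₄
    ...         | ry , a = (λ p → true≢false (≡⇒== p) (not-true u≢v)) , x , y , ==⇒≡ rx , ==⇒≡ ry , a

    padj-intro : ∀ {u v} x y → u ≢ v → r x ≡ u → r y ≡ v → adj G x y ≡ true → padj u v ≡ true
    padj-intro {u} {v} x y u≢v rx ry a =
      ∧-intro (cong not (≢⇒== u≢v))
        (any-intro (λ x → any (link u v x)) x
          (any-intro (link u v x) y (∧-intro (≡⇒== rx) (∧-intro (≡⇒== ry) a))))

    padj-flip : ∀ {u v} → padj u v ≡ true → padj v u ≡ true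
    padj-flip h with padj-elim h
    ... | u≢v , x , y , rx , ry , a = padj-intro y x (u≢v ∘ ≡-sym) ry rx (trans (sym G y x) a)

    padj-sym : ∀ u v → padj u v ≡ padj v u
    padj-sym u v with padj u v in eq | padj v u in eq′
    ... | true | true = refl
    ... | false | false = refl
    ... | true | false = true≢false (padj-flip {u} {v} eq) eq′
    ... | false | true = true≢false (padj-flip {v} {u} eq′) eq

    padj-irrefl : ∀ u → padj u u ≡ false
    padj-irrefl u = ¬true⇒false λ h → proj₁ (padj-elim {u} {u} h) refl

    padj≤∑ : ∀ u v → ⟦ padj u v ⟧ ≤ ∑ (λ x → ⟦ r x == u ⟧ * ∑ (λ y → ⟦ r y == v ⟧ * ⟦ adj G x y ⟧))
    padj≤∑ u v = ⟦⟧≤ bound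
      where
      bound : padj u v ≡ true → 1 ≤ ∑ (λ x → ⟦ r x == u ⟧ * ∑ (λ y → ⟦ r y == v ⟧ * ⟦ adj G x y ⟧))
      bound h with padj-elim h
      ... | _ , x , y , rx , ry , a =
        ≤-trans (≤⟦⟧* (≡⇒== rx)
          (≤-trans (≤⟦⟧* (≡⇒== ry) (≤-reflexive (≡-sym (cong ⟦_⟧ a))))
                   (term≤∑ (λ y → ⟦ r y == v ⟧ * ⟦ adj G x y ⟧) y)))
          (term≤∑ (λ x → ⟦ r x == u ⟧ * ∑ (λ y → ⟦ r y == v ⟧ * ⟦ adj G x y ⟧)) x)

    -- An adjacent pair of parts is witnessed by at least one adjacent pair of vertices, so any
    -- weight on pairs of parts can be pulled back along `r`. Suitable weights yield both the number
    -- of parts around `c` and the edges of the dense subgraph in `mergeable`.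
    ∑padj≤ : (F : V → V → ℕ) →
             ∑ (λ u → ∑ (λ v → F u v * ⟦ padj u v ⟧)) ≤ ∑ (λ x → ∑ (λ y → F (r x) (r y) * ⟦ adj G x y ⟧))
    ∑padj≤ F = begin
      ∑ (λ u → ∑ (λ v → F u v * ⟦ padj u v ⟧))
        ≤⟨ ∑-mono (λ u → ∑-mono λ v → *-monoʳ-≤ (F u v) (padj≤∑ u v)) ⟩
      ∑ (λ u → ∑ (λ v → F u v * ∑ (λ x → ⟦ r x == u ⟧ * near x v)))
        ≡⟨ ∑-cong (λ u → trans (∑-cong λ v → trans (≡-sym (∑-*ˡ (F u v) (λ x → ⟦ r x == u ⟧ * near x v)))
                                                   (∑-cong λ x → rearr (F u v) ⟦ r x == u ⟧ (near x v)))
                          (trans (∑-swap (λ v x → ⟦ r x == u ⟧ * (F u v * near x v)))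
                                 (∑-cong λ x → ∑-*ˡ ⟦ r x == u ⟧ (λ v → F u v * near x v)))) ⟩
      ∑ (λ u → ∑ (λ x → ⟦ r x == u ⟧ * ∑ (λ v → F u v * near x v)))
        ≡⟨ ∑-fibre r (λ u x → ∑ (λ v → F u v * near x v)) ⟩
      ∑ (λ x → ∑ (λ v → F (r x) v * near x v))
        ≡⟨ ∑-cong (λ x → trans (∑-cong λ v → trans (≡-sym (∑-*ˡ (F (r x) v) (λ y → ⟦ r y == v ⟧ * ⟦ adj G x y ⟧)))
                                                   (∑-cong λ y → rearr (F (r x) v) ⟦ r y == v ⟧ ⟦ adj G x y ⟧))
                               (∑-fibre r (λ v y → F (r x) v * ⟦ adj G x y ⟧))) ⟩
      ∑ (λ x → ∑ (λ y → F (r x) (r y) * ⟦ adj G x y ⟧)) ∎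
      where
      open ≤-Reasoning
      near : V → V → ℕ
      near x v = ∑ (λ y → ⟦ r y == v ⟧ * ⟦ adj G x y ⟧)
      rearr : ∀ a b c → a * (b * c) ≡ b * (a * c)
      rearr = solve-∀

    quotient : (V → Bool) → Graph
    quotient p = restrict p padj padj-sym padj-irrefl

    index? : (p : V → Bool) → V → Maybe (Fin (count p))
    index? p x with p x ≟ᵇ true
    ... | yes h = just (proj₁ (index p x h))
    ... | no _ = nothing

    index?-just : ∀ p x {u} → index? p x ≡ just u → x ≡ enum p u
    index?-just p x h with p x ≟ᵇ true
    index?-just p x refl | yes h = ≡-sym (proj₂ (index p x h))

    index?-enum : ∀ p u → index? p (enum p u) ≡ just u
    index?-enum p u with p (enum p u) ≟ᵇ true
    ... | yes h = cong just (enum-inj p (proj₂ (index p (enum p u) h)))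
    ... | no h = ⊥-elim (h (enum-sat p u))

    -- Vertices whose label is not in `p` belong to no branch set. The star minor relies on this: it
    -- keeps only the stars with centre in `R`.
    quotient-model : ∀ k p →
      (∀ u → p u ≡ true → r u ≡ u) →
      (∀ x → p (r x) ≡ true → WalkIn G (λ z → r z ≡ r x) x (r x)) →
      (∀ u → p u ≡ true → count (λ x → r x == u) ≤ k) →
      quotient p ≼[ k ] G
    quotient-model k p fixed walk size = record
      { β = λ x → index? p (r x)
      ; nonempty = λ u → enum p u , label (fixed _ (enum-sat p u))
      ; connected = λ u x y hx hy →
          let rx = index?-just p (r x) hx
              ry = index?-just p (r y) hy
              walk-to : ∀ z → r z ≡ enum p u → WalkIn G (λ w → index? p (r w) ≡ just u) z (enum p u)
              walk-to z rz = subst (WalkIn G _ z) rz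
                (walk-map (λ h → label (trans h rz)) (walk z (trans (cong p rz) (enum-sat p u))))
          in walk-trans (walk-to x rx) (walk-rev (walk-to y ry))
      ; small = λ u → ≤-trans
          (count-mono λ x h → ≡⇒== (index?-just p (r x) (does-true (MaybeP.≡-dec _≟_ _ _) h)))
          (size (enum p u) (enum-sat p u))
      ; edges = λ u v h → let _ , x , y , rx , ry , a = padj-elim h in x , y , label rx , label ry , a }
      where
      label : ∀ {x u} → r x ≡ enum p u → index? p (r x) ≡ just u
      label {u = u} h = trans (cong (index? p) h) (index?-enum p u)

  minor-of-subgraph : ∀ {k F G H} → F ≼[ k ] G → G ⊆ᵍ H → F ≼[ k ] H
  minor-of-subgraph {k} {F} {G} {H} M (f , f-inj , f-adj) = record
    { β = β′
    ; nonempty = λ u → let x , h = nonempty u in f x , trans (β′-f x) h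
    ; connected = λ u y z hy hz → connected′ u (β′-just hy) (β′-just hz)
    ; small = λ u → ≤-trans (small′ u) (small u)
    ; edges = λ u v h → let x , y , hx , hy , a = edges u v h in
        f x , f y , trans (β′-f x) hx , trans (β′-f y) hy , f-adj x y a }
    where
    open BoundedModel M
    preimage? : ∀ y → Dec (∃[ x ] f x ≡ y)
    preimage? y = any? (λ x → f x ≟ y)
    β′ : Fin (n H) → Maybe (Fin (n F))
    β′ y with preimage? y
    ... | yes (x , _) = β x
    ... | no _ = nothing
    β′-f : ∀ x → β′ (f x) ≡ β x
    β′-f x with preimage? (f x)
    ... | yes (x′ , h) = cong β (f-inj h)
    ... | no h = ⊥-elim (h (x , refl))
    β′-just : ∀ {y u} → β′ y ≡ just u → ∃[ x ] (f x ≡ y × β x ≡ just u)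
    β′-just {y} h with preimage? y
    ... | yes (x , p) = x , p , h
    push : ∀ {u x y} → WalkIn G (λ z → β z ≡ just u) x y → WalkIn H (λ z → β′ z ≡ just u) (f x) (f y)
    push (here p) = here (trans (β′-f _) p)
    push (step p a w) = step (trans (β′-f _) p) (f-adj _ _ a) (push w)
    connected′ : ∀ u {y z} → ∃[ x ] (f x ≡ y × β x ≡ just u) → ∃[ x ] (f x ≡ z × β x ≡ just u) →
                 WalkIn H (λ w → β′ w ≡ just u) y z
    connected′ u (x , refl , hx) (x′ , refl , hx′) = push (connected u x x′ hx hx′)
    small′ : ∀ u → count (λ y → does (MaybeP.≡-dec _≟_ (β′ y) (just u))) ≤
                   count (λ x → does (MaybeP.≡-dec _≟_ (β x) (just u)))
    small′ u = begin
      count (λ y → in-branch (β′ y))             ≡⟨ count≡∑ (λ y → in-branch (β′ y)) ⟩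
      ∑ (λ y → ⟦ in-branch (β′ y) ⟧)             ≤⟨ ∑-mono (λ y → ⟦⟧≤ (hit y)) ⟩
      ∑ (λ y → ∑ (λ x → ⟦ f x == y ⟧ * ⟦ in-branch (β x) ⟧)) ≡⟨ ∑-fibre f (λ _ x → ⟦ in-branch (β x) ⟧) ⟩
      ∑ (λ x → ⟦ in-branch (β x) ⟧)              ≡⟨ ≡-sym (count≡∑ (λ x → in-branch (β x))) ⟩
      count (λ x → in-branch (β x)) ∎
      where
      open ≤-Reasoning
      in-branch : Maybe (Fin (n F)) → Bool
      in-branch w = does (MaybeP.≡-dec _≟_ w (just u))
      hit : ∀ y → in-branch (β′ y) ≡ true → 1 ≤ ∑ (λ x → ⟦ f x == y ⟧ * ⟦ in-branch (β x) ⟧)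
      hit y h with β′-just {y} (does-true (MaybeP.≡-dec _≟_ _ _) h)
      ... | x , p , q = ≤-trans (≤⟦⟧* (≡⇒== p) (≤-reflexive (≡-sym (cong ⟦_⟧ (true-does (MaybeP.≡-dec _≟_ _ _) q)))))
                                (term≤∑ (λ x → ⟦ f x == y ⟧ * ⟦ in-branch (β x) ⟧) x)

  -- Passing to a core with large minimum degree and few surplus edges

  delete-vertex : (G : Graph) → Fin (n G) → Graph
  delete-vertex G v = induced G (λ x → not (x == v))

  n-delete-vertex : ∀ G v → suc (n (delete-vertex G v)) ≡ n G
  n-delete-vertex G v = trans (+-comm 1 _) (trans (cong₂ _+_ (count≡∑ (λ x → not (x == v))) (≡-sym (∑-== v)))
    (trans (≡-sym (∑-+ (λ x → ⟦ not (x == v) ⟧) (λ x → ⟦ x == v ⟧)))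
    (trans (∑-cong (λ x → complement (x == v))) (trans (∑-const (n G) 1) (*-identityʳ (n G))))))
    where
    complement : ∀ b → ⟦ not b ⟧ + ⟦ b ⟧ ≡ 1
    complement true = refl
    complement false = refl

  degSum-induced≤ : ∀ G p → degSum (induced G p) ≤ degSum G
  degSum-induced≤ G p = ≤-trans (≤-reflexive (degSum-restrict p (adj G) (sym G) (irrefl G)))
    (∑-mono λ x → ∑-mono λ y → ⟦⟧-mono λ h → proj₂ (∧-elim {p y} (proj₂ (∧-elim {p x} h))))

  degSum-delete-vertex : ∀ G v → degSum G ≤ degSum (delete-vertex G v) + (deg G v + deg G v)
  degSum-delete-vertex G v = begin
    degSum G
      ≤⟨ ∑∑-mono pointwise ⟩
    ∑∑ (λ x y → kept x y + (at-row x y + at-col x y))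
      ≡⟨ ∑∑-+₃ kept at-row at-col ⟩
    ∑∑ kept + (∑∑ at-row + ∑∑ at-col)
      ≡⟨ cong₂ _+_ (≡-sym (degSum-restrict (λ x → not (x == v)) (adj G) (sym G) (irrefl G))) (cong₂ _+_ rows cols) ⟩
    degSum (delete-vertex G v) + (deg G v + deg G v) ∎
    where
    open ≤-Reasoning
    kept at-row at-col : Fin (n G) → Fin (n G) → ℕ
    kept x y = ⟦ not (x == v) ∧ (not (y == v) ∧ adj G x y) ⟧
    at-row x y = ⟦ x == v ⟧ * ⟦ adj G x y ⟧
    at-col x y = ⟦ y == v ⟧ * ⟦ adj G x y ⟧
    pointwise : ∀ x y → ⟦ adj G x y ⟧ ≤ kept x y + (at-row x y + at-col x y)
    pointwise x y with x == v | y == v | adj G x y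
    ... | true | true | true = s≤s z≤n
    ... | true | false | true = s≤s z≤n
    ... | false | true | true = s≤s z≤n
    ... | false | false | true = s≤s z≤n
    ... | _ | _ | false = z≤n
    rows : ∑∑ at-row ≡ deg G v
    rows = trans (∑-cong (λ x → ∑-*ˡ ⟦ x == v ⟧ (λ y → ⟦ adj G x y ⟧))) (∑-point′ v (deg G))
    cols : ∑∑ at-col ≡ deg G v
    cols = trans (∑-cong (λ x → ∑-point′ v (λ y → ⟦ adj G x y ⟧))) (∑-cong (λ x → cong ⟦_⟧ (sym G x v)))

  module _ (G : Graph) (u v : Fin (n G)) where

    private
      V = Fin (n G)
      uv : V → V → Bool
      uv x y = (x == u) ∧ (y == v)

    delete-edge : Graph
    delete-edge = record
      { n = n G
      ; adj = λ x y → adj G x y ∧ not (uv x y ∨ uv y x)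
      ; sym = λ x y → cong₂ _∧_ (sym G x y) (cong not (∨-comm (uv x y) (uv y x)))
      ; irrefl = λ x → cong (_∧ not (uv x x ∨ uv x x)) (irrefl G x) }

    delete-edge⊆ : delete-edge ⊆ᵍ G
    delete-edge⊆ = (λ x → x) , (λ h → h) , λ x y h → proj₁ (∧-elim {adj G x y} h)

    private
      kept : V → V → ℕ
      kept x y = ⟦ adj delete-edge x y ⟧
      ∑uv : ∑∑ (λ x y → ⟦ uv x y ⟧) ≡ 1
      ∑uv = trans (∑-cong λ x → trans (∑-cong λ y → ⟦∧⟧ (x == u) (y == v))
              (trans (∑-*ˡ ⟦ x == u ⟧ (λ y → ⟦ y == v ⟧)) (cong (⟦ x == u ⟧ *_) (∑-== v))))
            (∑-point′ u (λ _ → 1))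

    degSum-delete-edge : degSum G ≤ degSum delete-edge + 2
    degSum-delete-edge = begin
      degSum G
        ≤⟨ ∑∑-mono pointwise ⟩
      ∑∑ (λ x y → kept x y + (⟦ uv x y ⟧ + ⟦ uv y x ⟧))
        ≡⟨ ∑∑-+₃ kept (λ x y → ⟦ uv x y ⟧) (λ x y → ⟦ uv y x ⟧) ⟩
      degSum delete-edge + (∑∑ (λ x y → ⟦ uv x y ⟧) + ∑∑ (λ x y → ⟦ uv y x ⟧))
        ≡⟨ cong (degSum delete-edge +_) (cong₂ _+_ ∑uv (trans (∑-swap (λ x y → ⟦ uv y x ⟧)) ∑uv)) ⟩
      degSum delete-edge + 2 ∎
      where
      open ≤-Reasoning
      pointwise : ∀ x y → ⟦ adj G x y ⟧ ≤ kept x y + (⟦ uv x y ⟧ + ⟦ uv y x ⟧)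
      pointwise x y with adj G x y | uv x y | uv y x
      ... | false | _ | _ = z≤n
      ... | true | true | _ = s≤s z≤n
      ... | true | false | true = s≤s z≤n
      ... | true | false | false = s≤s z≤n

    degSum-delete-edge< : adj G u v ≡ true → degSum delete-edge < degSum G
    degSum-delete-edge< a = begin
      suc (degSum delete-edge)
        ≡⟨ trans (+-comm 1 _) (cong (degSum delete-edge +_) (≡-sym ∑uv)) ⟩
      degSum delete-edge + ∑∑ (λ x y → ⟦ uv x y ⟧)
        ≡⟨ ≡-sym (∑∑-+ kept (λ x y → ⟦ uv x y ⟧)) ⟩
      ∑∑ (λ x y → kept x y + ⟦ uv x y ⟧)
        ≤⟨ ∑∑-mono pointwise ⟩
      degSum G ∎
      where
      open ≤-Reasoning
      pointwise : ∀ x y → kept x y + ⟦ uv x y ⟧ ≤ ⟦ adj G x y ⟧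
      pointwise x y with uv x y in eq
      ... | false = ≤-trans (≤-reflexive (+-identityʳ _)) (⟦⟧-mono (λ h → proj₁ (∧-elim {adj G x y} h)))
      ... | true with ∧-elim {x == u} eq
      ...   | hx , hy rewrite trans (cong₂ (adj G) (==⇒≡ {x = x} hx) (==⇒≡ {x = y} hy)) a = ≤-refl

  record Peeled (M N : ℕ) (G : Graph) : Set where
    field
      core : Graph
      core⊆ : core ⊆ᵍ G
      nonempty : 1 ≤ n core
      dense : M * n core ≤ degSum core * N
      tight : degSum core * N < M * n core + 2 * N
      min-degree : ∀ v → M ≤ 2 * (deg core v * N)

  -- A vertex of degree below `M / (2N)` carries less than its share of the degree sum, so deleting
  -- it keeps the ratio; an edge is deleted only when the surplus covers it. Either step lowers
  -- `n F + degSum F`.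
  peel : ∀ M N G → 1 ≤ N → 1 ≤ n G → M * n G ≤ degSum G * N → Peeled M N G
  peel M N G 1≤N 1≤n dense = go (suc (n G + degSum G)) G ≤-refl 1≤n dense (⊆ᵍ-refl {G})
    where
    go : ∀ fuel F → n F + degSum F < fuel → 1 ≤ n F → M * n F ≤ degSum F * N → F ⊆ᵍ G → Peeled M N G
    go (suc fuel) F (s≤s bound) 1≤n dense F⊆G with any? (λ v → 2 * (deg F v * N) <? M)
    ... | yes (v , low) = go fuel F′
        (≤-trans (+-mono-≤ (≤-reflexive (n-delete-vertex F v)) (degSum-induced≤ F _)) bound)
        nonempty (<⇒≤ strict) (⊆ᵍ-trans {F′} {F} {G} (induced⊆ F _) F⊆G)
      where
      F′ = delete-vertex F v
      strict : M * n F′ < degSum F′ * N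
      strict = +-cancelʳ-< M (M * n F′) (degSum F′ * N) (begin-strict
        M * n F′ + M             ≡⟨ rearr M (n F′) ⟩
        M * suc (n F′)           ≡⟨ cong (M *_) (n-delete-vertex F v) ⟩
        M * n F                  ≤⟨ dense ⟩
        degSum F * N             ≤⟨ *-monoˡ-≤ N (degSum-delete-vertex F v) ⟩
        (degSum F′ + (deg F v + deg F v)) * N ≡⟨ rearr′ (degSum F′) (deg F v) N ⟩
        degSum F′ * N + 2 * (deg F v * N) <⟨ +-monoʳ-< (degSum F′ * N) low ⟩
        degSum F′ * N + M ∎)
        where
        open ≤-Reasoning
        rearr : ∀ M x → M * x + M ≡ M * suc x
        rearr = solve-∀
        rearr′ : ∀ t d N → (t + (d + d)) * N ≡ t * N + 2 * (d * N)
        rearr′ = solve-∀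
      -- The inequality `strict` forbids the empty graph, whose degree sum is zero.
      nonempty : 1 ≤ n F′
      nonempty with n F′ in eq
      ... | suc _ = s≤s z≤n
      ... | zero = ⊥-elim (n≮0 (subst (M * n F′ <_) (trans (cong (_* N) (no-vertices F′ eq)) refl) strict))
        where
        no-vertices : ∀ H → n H ≡ 0 → degSum H ≡ 0
        no-vertices record { n = .0 } refl = refl
    ... | no ¬low with M * n F + 2 * N ≤? degSum F * N
    ...   | no ¬excess = record
            { core = F ; core⊆ = F⊆G ; nonempty = 1≤n ; dense = dense ; tight = ≰⇒> ¬excess
            ; min-degree = λ v → ≮⇒≥ (λ h → ¬low (v , h)) }
    ...   | yes excess with any (λ x → any (adj F x)) in eq
    ...     | false = ⊥-elim (n≮0 (≤-trans (*-mono-≤ {1} {2} (s≤s z≤n) 1≤N)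
                        (≤-trans (m≤n+m (2 * N) (M * n F)) (≤-trans excess (≤-reflexive (cong (_* N) no-edges))))))
      where
      no-edges : degSum F ≡ 0
      no-edges = trans (∑-cong λ x → trans (∑-cong λ y → cong ⟦_⟧ (¬true⇒false λ h →
        true≢false (any-intro _ x (any-intro (adj F x) y h)) eq)) (∑-zero (n F))) (∑-zero (n F))
    ...     | true with any-elim _ eq
    ...       | u , hu with any-elim (adj F u) hu
    ...         | v , a = go fuel F′
        (≤-trans (+-monoʳ-< (n F) (degSum-delete-edge< F u v a)) bound)
        1≤n
        (+-cancelʳ-≤ (2 * N) (M * n F) (degSum F′ * N) (≤-trans excess
          (≤-trans (*-monoˡ-≤ N (degSum-delete-edge F u v)) (≤-reflexive (*-distribʳ-+ N (degSum F′) 2)))))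
        (⊆ᵍ-trans {F′} {F} {G} (delete-edge⊆ F u v) F⊆G)
      where
      F′ = delete-edge F u v

  -- Contracting disjoint stars in a bipartite subgraph

  -- The vertex bound is doubled because the one that arises in `mergeable`, `k + k²Δ/2`, need not
  -- be an integer.
  DenseSubgraph : Graph → ℕ → ℕ → Set
  DenseSubgraph G v t = Σ Graph λ H → H ⊆ᵍ G × 2 * n H ≤ v × t ≤ degSum H

  StarMinor : Graph → ℕ → ℕ → ℕ → Set
  StarMinor G ℓ D e = Σ Graph λ G′ →
    G′ ≼[ ℓ + 1 ] G × 1 ≤ n G′ × n G′ * (ℓ * D) ≤ degSum G′ + n G′ * (ℓ * ℓ * e)

  update : ∀ {m} → (Fin m → Fin m) → Fin m → Fin m → Fin m → Fin m
  update f x b y = if y == x then b else f y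

  update-at : ∀ {m} (f : Fin m → Fin m) x b → update f x b x ≡ b
  update-at f x b rewrite ≡⇒== {x = x} refl = refl

  update-off : ∀ {m} (f : Fin m → Fin m) x b {y} → y ≢ x → update f x b y ≡ f y
  update-off f x b h rewrite ≢⇒== h = refl

  module Assignment
    (G : Graph) (A B : Fin (n G) → Bool)
    (disjoint : ∀ {x} → A x ≡ true → B x ≡ true → ⊥)
    (ℓ e D : ℕ) (1≤ℓ : 1 ≤ ℓ) (e≤D : e ≤ D)
    (degree-to-B : ∀ a → A a ≡ true → D ≤ ∑ (λ z → ⟦ B z ∧ adj G a z ⟧))
    (A-large : ℓ * count B < count A)
    where

    private
      V = Fin (n G)

    codeg : V → V → ℕ
    codeg x y = ∑ (λ z → ⟦ B z ∧ (adj G x z ∧ adj G y z) ⟧)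

    codeg-comm : ∀ x y → codeg x y ≡ codeg y x
    codeg-comm x y = ∑-cong (λ z → cong (λ b → ⟦ B z ∧ b ⟧) (∧-comm (adj G x z) (adj G y z)))

    mate : V → V → Bool
    mate a x = not (a == x) ∧ (A x ∧ does (e ≤? codeg a x))

    -- The subgraph consists of `e` mates of `a` and the `B`-neighbours of `a`; each mate is
    -- adjacent to `e` of the latter. Only the rows of the mates enter the count, so `e * e` is a
    -- bound for the degree sum, which is where the factor 1/2 in (i) comes from.
    mates-dense : ∀ a → e ≤ count (mate a) → DenseSubgraph G (2 * (deg G a + e)) (e * e)
    mates-dense a many with select (mate a) e many
    ... | q , q⊆mate , |q| = induced G p , induced⊆ G p , *-monoʳ-≤ 2 size , edges
      where
      open ≤-Reasoning
      p : V → Bool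
      p x = q x ∨ (B x ∧ adj G a x)
      p-left : ∀ x → q x ≡ true → p x ≡ true
      p-left x h rewrite h = refl
      p-right : ∀ x → B x ∧ adj G a x ≡ true → p x ≡ true
      p-right x h rewrite h with q x
      ... | true = refl
      ... | false = refl
      size : count p ≤ deg G a + e
      size = begin
        count p ≡⟨ count≡∑ p ⟩
        ∑ (λ x → ⟦ p x ⟧) ≤⟨ ∑-mono (λ x → ≤-trans (⟦∨⟧≤ (q x) (B x ∧ adj G a x)) (≤-trans (≤-reflexive (+-comm ⟦ q x ⟧ _))
                                 (+-monoˡ-≤ ⟦ q x ⟧ (⟦⟧-mono (λ h → proj₂ (∧-elim {B x} h)))))) ⟩
        ∑ (λ x → ⟦ adj G a x ⟧ + ⟦ q x ⟧) ≡⟨ ∑-+ (λ x → ⟦ adj G a x ⟧) (λ x → ⟦ q x ⟧) ⟩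
        deg G a + ∑ (λ x → ⟦ q x ⟧) ≡⟨ cong (deg G a +_) (trans (≡-sym (count≡∑ q)) |q|) ⟩
        deg G a + e ∎
      row : ∀ x → ⟦ q x ⟧ * e ≤ ∑ (λ y → ⟦ p x ∧ (p y ∧ adj G x y) ⟧)
      row x = ⟦⟧*≤ λ qx → ≤-trans
        (does-true (e ≤? codeg a x) (proj₂ (∧-elim {A x} (proj₂ (∧-elim {not (a == x)} (q⊆mate x qx))))))
        (∑-mono λ z → ⟦⟧-mono λ h → let Bz , h′ = ∧-elim {B z} h ; az , xz = ∧-elim {adj G a z} h′ in
          ∧-intro (p-left x qx) (∧-intro (p-right z (∧-intro Bz az)) xz))
      edges : e * e ≤ degSum (induced G p)
      edges = begin
        e * e ≡⟨ trans (cong (_* e) (≡-sym |q|)) (count-* q e) ⟩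
        ∑ (λ x → ⟦ q x ⟧ * e) ≤⟨ ∑-mono row ⟩
        ∑ (λ x → ∑ (λ y → ⟦ p x ∧ (p y ∧ adj G x y) ⟧)) ≡⟨ ≡-sym (degSum-restrict p (adj G) (sym G) (irrefl G)) ⟩
        degSum (induced G p) ∎

    leaf : (V → V) → V → V → Bool
    leaf f b x = A x ∧ (f x == b)

    α : (V → V) → ℕ
    α f = count (λ x → A x ∧ B (f x))

    -- A vertex x of A is unassigned when f x ≡ x, and belongs to the star centred at f x ∈ B otherwise.
    record Valid (f : V → V) : Set where
      field
        target : ∀ x → f x ≡ x ⊎ (A x ≡ true × B (f x) ≡ true × adj G x (f x) ≡ true)
        capacity : ∀ b → B b ≡ true → count (leaf f b) ≤ ℓ
        unmated : ∀ x y → A x ≡ true → A y ≡ true → f x ≡ f y → B (f x) ≡ true → x ≢ y → codeg x y < e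
    open Valid

    A∉B : ∀ {a b} → A a ≡ true → B b ≡ true → a ≢ b
    A∉B Aa Bb refl = disjoint Aa Bb

    B-fixed : ∀ {f} → Valid f → ∀ {b} → B b ≡ true → f b ≡ b
    B-fixed v {b} Bb with target v b
    ... | inj₁ h = h
    ... | inj₂ (Ab , _) = ⊥-elim (disjoint Ab Bb)

    valid-id : Valid (λ x → x)
    valid-id = record
      { target = λ _ → inj₁ refl
      ; capacity = λ b Bb → ≤-trans (≤-reflexive (trans (count≡∑ (leaf (λ x → x) b))
          (trans (∑-cong λ x → cong ⟦_⟧ (¬true⇒false λ h → let Ax , x=b = ∧-elim {A x} h in A∉B Ax Bb (==⇒≡ x=b)))
                 (∑-zero (n G))))) z≤n
      ; unmated = λ { x y _ _ x≡y _ x≢y → ⊥-elim (x≢y x≡y) } }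

    module _ {f : V → V} (v : Valid f) {x : V} (Ax : A x ≡ true) where

      private
        f₁ = update f x x

      unassign-elsewhere : ∀ {y b} → B b ≡ true → f₁ y ≡ b → y ≢ x × f y ≡ b
      unassign-elsewhere {y} Bb h with y ≟ x
      ... | yes refl = ⊥-elim (A∉B Ax Bb h)
      ... | no y≢x = y≢x , h

      unassign-valid : Valid f₁
      unassign-valid = record
        { target = target₁
        ; capacity = λ b Bb → ≤-trans
            (count-mono λ y h → let Ay , y=b = ∧-elim {A y} h in
              ∧-intro Ay (≡⇒== (proj₂ (unassign-elsewhere Bb (==⇒≡ y=b)))))
            (capacity v b Bb)
        ; unmated = λ y z Ay Az eq By y≢z →
            let y≢x , fy = unassign-elsewhere By refl
                z≢x , fz = unassign-elsewhere By (≡-sym eq)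
            in unmated v y z Ay Az (trans fy (≡-sym fz)) (trans (cong B fy) By) y≢z }
        where
        target₁ : ∀ y → f₁ y ≡ y ⊎ (A y ≡ true × B (f₁ y) ≡ true × adj G y (f₁ y) ≡ true)
        target₁ y with y ≟ x
        ... | yes refl = inj₁ refl
        ... | no y≢x = target v y

      unassign-α : α f ≤ suc (α f₁)
      unassign-α = ≤-trans (count-mono sub) (≤-reflexive (count-insert x (λ y → A y ∧ B (f₁ y)) lost))
        where
        lost : A x ∧ B (f₁ x) ≡ false
        lost = ¬true⇒false λ h → disjoint Ax (trans (cong B (≡-sym (update-at f x x))) (proj₂ (∧-elim {A x} h)))
        sub : ∀ y → A y ∧ B (f y) ≡ true → insert x (λ y → A y ∧ B (f₁ y)) y ≡ true
        sub y h = by-cases (y ≟ x)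
          where
          by-cases : Dec (y ≡ x) → insert x (λ y → A y ∧ B (f₁ y)) y ≡ true
          by-cases (yes refl) = insert-new x (λ y → A y ∧ B (f₁ y))
          by-cases (no y≢x) = insert-old x (λ y → A y ∧ B (f₁ y)) (trans (cong (λ w → A y ∧ B w) (update-off f x x y≢x)) h)

      unassign-leaves : ∀ {b} → B b ≡ true → f x ≡ b → count (leaf f₁ b) < count (leaf f b)
      unassign-leaves {b} Bb fx = ≤-trans (≤-reflexive (≡-sym (count-insert x (leaf f₁ b) gone))) (count-mono sub)
        where
        gone : leaf f₁ b x ≡ false
        gone = ¬true⇒false λ h → proj₁ (unassign-elsewhere Bb (==⇒≡ (proj₂ (∧-elim {A x} h)))) refl
        sub : ∀ y → insert x (leaf f₁ b) y ≡ true → leaf f b y ≡ true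
        sub y h = insert-elim {S = leaf f₁ b} h
          (λ h′ → let Ay , y=b = ∧-elim {A y} h′ in ∧-intro Ay (≡⇒== (proj₂ (unassign-elsewhere Bb (==⇒≡ y=b)))))
          λ { refl → ∧-intro Ax (≡⇒== fx) }

    module _ {f : V → V} (v : Valid f) {a b : V} (Aa : A a ≡ true) (fa : f a ≡ a) (Bb : B b ≡ true)
             (ab : adj G a b ≡ true) (room : count (leaf f b) < ℓ)
             (unblocked : ∀ x → A x ≡ true → f x ≡ b → codeg a x < e) where

      private
        f₂ = update f a b

      assign-valid : Valid f₂
      assign-valid = record { target = target₂ ; capacity = capacity₂ ; unmated = unmated₂ }
        where
        target₂ : ∀ y → f₂ y ≡ y ⊎ (A y ≡ true × B (f₂ y) ≡ true × adj G y (f₂ y) ≡ true)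
        target₂ y with y ≟ a
        ... | yes refl = inj₂ (Aa , Bb , ab)
        ... | no y≢a = target v y
        capacity₂ : ∀ c → B c ≡ true → count (leaf f₂ c) ≤ ℓ
        capacity₂ c Bc with b ≟ c
        ... | yes refl = ≤-trans (count-mono sub) (≤-trans (≤-reflexive (count-insert a (leaf f b) fresh)) room)
          where
          fresh : leaf f b a ≡ false
          fresh = ¬true⇒false λ h → A∉B Aa Bb (trans (≡-sym fa) (==⇒≡ (proj₂ (∧-elim {A a} h))))
          sub : ∀ y → leaf f₂ b y ≡ true → insert a (leaf f b) y ≡ true
          sub y h = by-cases (y ≟ a)
            where
            by-cases : Dec (y ≡ a) → insert a (leaf f b) y ≡ true
            by-cases (yes refl) = insert-new a (leaf f b)
            by-cases (no y≢a) = insert-old a (leaf f b) (trans (cong (λ w → A y ∧ (w == b)) (≡-sym (update-off f a b y≢a))) h)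
        ... | no b≢c = ≤-trans (count-mono sub) (capacity v c Bc)
          where
          sub : ∀ y → leaf f₂ c y ≡ true → leaf f c y ≡ true
          sub y h = by-cases (y ≟ a)
            where
            by-cases : Dec (y ≡ a) → leaf f c y ≡ true
            by-cases (yes refl) = ⊥-elim (b≢c (trans (≡-sym (update-at f a b)) (==⇒≡ (proj₂ (∧-elim {A y} h)))))
            by-cases (no y≢a) = trans (cong (λ w → A y ∧ (w == c)) (≡-sym (update-off f a b y≢a))) h
        unmated₂ : ∀ x y → A x ≡ true → A y ≡ true → f₂ x ≡ f₂ y → B (f₂ x) ≡ true → x ≢ y → codeg x y < e
        unmated₂ x y Ax Ay eq Bx x≢y with x ≟ a | y ≟ a
        ... | yes refl | yes refl = ⊥-elim (x≢y refl)
        ... | yes refl | no _ = unblocked y Ay (≡-sym eq)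
        ... | no _ | yes refl = subst (_< e) (codeg-comm y x) (unblocked x Ax eq)
        ... | no _ | no _ = unmated v x y Ax Ay eq Bx x≢y

      assign-α : α f < α f₂
      assign-α = ≤-trans (≤-reflexive (≡-sym (count-insert a (λ y → A y ∧ B (f y)) fresh))) (count-mono sub)
        where
        fresh : A a ∧ B (f a) ≡ false
        fresh = ¬true⇒false λ h → disjoint Aa (trans (cong B (≡-sym fa)) (proj₂ (∧-elim {A a} h)))
        sub : ∀ y → insert a (λ y → A y ∧ B (f y)) y ≡ true → A y ∧ B (f₂ y) ≡ true
        sub y h = by-cases (y ≟ a)
          where
          by-cases : Dec (y ≡ a) → A y ∧ B (f₂ y) ≡ true
          by-cases (yes refl) = ∧-intro Aa (trans (cong B (update-at f y b)) Bb)
          by-cases (no y≢a) = trans (cong (λ w → A y ∧ B w) (update-off f a b y≢a))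
            (insert-elim {S = λ y → A y ∧ B (f y)} h (λ h′ → h′) λ y≡a → ⊥-elim (y≢a y≡a))

    -- What a failed search leaves behind: all stars reached are full, and a leaf of such a star
    -- misses only those `B`-neighbours outside `R` that already hold a mate of it.
    record Closed (f : V → V) : Set where
      field
        R : V → Bool
        R⊆B : ∀ b → R b ≡ true → B b ≡ true
        inhabited : 1 ≤ count R
        full : ∀ b → R b ≡ true → ℓ ≤ count (leaf f b)
        expansion : ∀ x → A x ≡ true → R (f x) ≡ true → D < ∑ (λ z → ⟦ R z ∧ adj G x z ⟧) + e

    module _ (few-mates : ∀ a → A a ≡ true → count (mate a) < e) where

      -- R is the set of centres reachable from a₀ by alternating paths: any leaf of a star in R
      -- can be released in exchange for a₀ by an assignment that differs from f only on stars in R.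
      augment : ∀ {f} → Valid f → ∀ a₀ → A a₀ ≡ true → f a₀ ≡ a₀ →
                (∃[ f′ ] Valid f′ × α f < α f′) ⊎ Closed f
      augment {f} v a₀ Aa₀ fa₀ = grow (n G) (λ _ → false) (λ _ ()) (λ _ ())
          (λ { a Aa (inj₁ refl) → f , v , fa₀ , ≤-refl , λ _ _ _ _ → refl }) (m≤m+n (n G) _)
        where
        Source : (V → Bool) → V → Set
        Source R a = a ≡ a₀ ⊎ R (f a) ≡ true
        Release : (V → Bool) → V → Set
        Release R a = ∃[ f′ ] Valid f′ × f′ a ≡ a × α f ≤ α f′ ×
                              (∀ x b → B b ≡ true → R b ≡ false → (f′ x == b) ≡ (f x == b))
        outside : ∀ {R a b} → Source R a → A a ≡ true → B b ≡ true → R b ≡ false → f a ≢ b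
        outside (inj₁ refl) Aa Bb _ fa = A∉B Aa Bb (trans (≡-sym fa₀) fa)
        outside {R} (inj₂ Rfa) Aa Bb Rb fa = true≢false Rfa (trans (cong R fa) Rb)
        Free : (R : V → Bool) → V → V → Set
        Free R a b = A a ≡ true × Source R a × B b ≡ true × R b ≡ false × adj G a b ≡ true ×
                     ¬ (∃[ x ] (A x ≡ true × f x ≡ b × e ≤ codeg a x))
        free? : ∀ R → Dec (∃[ a ] ∃[ b ] Free R a b)
        free? R = any? λ a → any? λ b →
          (A a ≟ᵇ true) ×-dec (((a ≟ a₀) ⊎-dec (R (f a) ≟ᵇ true)) ×-dec ((B b ≟ᵇ true) ×-dec ((R b ≟ᵇ false) ×-dec
            ((adj G a b ≟ᵇ true) ×-dec ¬? (any? λ x → (A x ≟ᵇ true) ×-dec ((f x ≟ b) ×-dec (e ≤? codeg a x)))))))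
        grow : ∀ fuel R → (∀ b → R b ≡ true → B b ≡ true) → (∀ b → R b ≡ true → ℓ ≤ count (leaf f b)) →
               (∀ a → A a ≡ true → Source R a → Release R a) → n G ≤ fuel + count R →
               (∃[ f′ ] Valid f′ × α f < α f′) ⊎ Closed f
        grow fuel R R⊆B full release bound with free? R
        ... | no stuck = inj₂ record
                { R = R ; R⊆B = R⊆B ; inhabited = inhabited ; full = full
                ; expansion = λ x Ax Rfx → expand x Ax (inj₂ Rfx) }
          where
          open ≤-Reasoning
          missed : V → V → Bool
          missed x z = B z ∧ (not (R z) ∧ adj G x z)
          -- When no free pair remains, every missed neighbour `z` of `x` has a leaf that is a mate
          -- of `x`. Distinct `z` have distinct leaves, so fewer than `e` neighbours are missed.
          blocker : ∀ x → A x ≡ true → Source R x → ∀ z → missed x z ≡ true →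
                    1 ≤ ∑ (λ y → ⟦ f y == z ⟧ * ⟦ mate x y ⟧)
          blocker x Ax src z h with ∧-elim {B z} h
          ... | Bz , h₁ with ∧-elim {not (R z)} h₁
          ...   | Rz , xz with any? (λ y → (A y ≟ᵇ true) ×-dec ((f y ≟ z) ×-dec (e ≤? codeg x y)))
          ...     | no none = ⊥-elim (stuck (x , z , Ax , src , Bz , not-true Rz , xz , none))
          ...     | yes (y , Ay , fy , c) =
            ≤-trans (≤⟦⟧* (≡⇒== fy) (≤-reflexive (≡-sym (cong ⟦_⟧ (∧-intro {not (x == y)}
                      (cong not (≢⇒== λ x≡y → outside src Ax Bz (not-true Rz) (trans (cong f x≡y) fy)))
                      (∧-intro Ay (true-does (e ≤? codeg x y) c)))))))
                    (term≤∑ (λ y → ⟦ f y == z ⟧ * ⟦ mate x y ⟧) y)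
          expand : ∀ x → A x ≡ true → Source R x → D < ∑ (λ z → ⟦ R z ∧ adj G x z ⟧) + e
          expand x Ax src = begin-strict
            D ≤⟨ degree-to-B x Ax ⟩
            ∑ (λ z → ⟦ B z ∧ adj G x z ⟧) ≤⟨ ∑-mono pointwise ⟩
            ∑ (λ z → ⟦ R z ∧ adj G x z ⟧ + ⟦ missed x z ⟧) ≡⟨ ∑-+ (λ z → ⟦ R z ∧ adj G x z ⟧) (λ z → ⟦ missed x z ⟧) ⟩
            N + ∑ (λ z → ⟦ missed x z ⟧) ≤⟨ +-monoʳ-≤ N (∑-mono λ z → ⟦⟧≤ (blocker x Ax src z)) ⟩
            N + ∑∑ (λ z y → ⟦ f y == z ⟧ * ⟦ mate x y ⟧)
              ≡⟨ cong (N +_) (trans (∑-fibre f (λ _ y → ⟦ mate x y ⟧)) (≡-sym (count≡∑ (mate x)))) ⟩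
            N + count (mate x) <⟨ +-monoʳ-< N (few-mates x Ax) ⟩
            N + e ∎
            where
            N = ∑ (λ z → ⟦ R z ∧ adj G x z ⟧)
            pointwise : ∀ z → ⟦ B z ∧ adj G x z ⟧ ≤ ⟦ R z ∧ adj G x z ⟧ + ⟦ missed x z ⟧
            pointwise z with B z | R z | adj G x z
            ... | false | _ | _ = z≤n
            ... | true | true | true = s≤s z≤n
            ... | true | true | false = z≤n
            ... | true | false | true = s≤s z≤n
            ... | true | false | false = z≤n
          -- The vertex `a₀` also satisfies the expansion bound, and by `e ≤ D` it has a neighbour
          -- in `R`.
          inhabited : 1 ≤ count R
          inhabited with count-pos (λ z → R z ∧ adj G a₀ z)
                           (≤-trans (+-cancelʳ-≤ e 1 (∑ (λ z → ⟦ R z ∧ adj G a₀ z ⟧)) (≤-trans (s≤s e≤D) (expand a₀ Aa₀ (inj₁ refl))))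
                                    (≤-reflexive (≡-sym (count≡∑ (λ z → R z ∧ adj G a₀ z)))))
          ... | z , h = pos-count R z (proj₁ (∧-elim {R z} h))
        ... | yes (a , b , Aa , src , Bb , Rb , ab , none) with release a Aa src
        ...   | f′ , v′ , f′a , αf′ , agree with count (leaf f′ b) <? ℓ
        ...     | yes room = inj₁ (update f′ a b , assign-valid v′ Aa f′a Bb ab room unblocked′ ,
                                   ≤-<-trans αf′ (assign-α v′ Aa f′a Bb ab room unblocked′))
          where
          unblocked′ : ∀ x → A x ≡ true → f′ x ≡ b → codeg a x < e
          unblocked′ x Ax f′x = ≰⇒> λ c → none (x , Ax , ==⇒≡ (trans (≡-sym (agree x b Bb Rb)) (≡⇒== f′x)) , c)
        ...     | no ¬room = extend fuel bound
          where
          R′ = insert b R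
          size : count R′ ≡ suc (count R)
          size = count-insert b R Rb
          full-b : ℓ ≤ count (leaf f b)
          full-b = ≤-trans (≮⇒≥ ¬room) (≤-reflexive (count-cong λ x → cong (A x ∧_) (agree x b Bb Rb)))
          old-out : ∀ {c} → R′ c ≡ false → R c ≡ false
          old-out h = ¬true⇒false λ Rc → true≢false (insert-old b R Rc) h
          b-out : ∀ {c} → R′ c ≡ false → b ≢ c
          b-out h refl = true≢false (insert-new b R) h
          -- First `a` is released, then `x` leaves the full star at `b`, and `a` takes its place.
          -- The number of assigned vertices does not drop, and beyond `R` only the star at `b`
          -- changes.
          exchange : ∀ x → A x ≡ true → f x ≡ b → Release R′ x
          exchange x Ax fx =
            f₂ , v₂ , trans (update-off f₁ a b x≢a) (update-at f′ x x) ,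
            ≤-trans αf′ (≤-trans (unassign-α v′ Ax) (assign-α v₁ Aa f₁a Bb ab room₁ unblocked₁)) , agree₂
            where
            x≢a : x ≢ a
            x≢a x≡a = outside src Aa Bb Rb (trans (cong f (≡-sym x≡a)) fx)
            f₁ = update f′ x x
            v₁ : Valid f₁
            v₁ = unassign-valid v′ Ax
            f₁a : f₁ a ≡ a
            f₁a = trans (update-off f′ x x (x≢a ∘ ≡-sym)) f′a
            f′x : f′ x ≡ b
            f′x = ==⇒≡ (trans (agree x b Bb Rb) (≡⇒== fx))
            room₁ : count (leaf f₁ b) < ℓ
            room₁ = ≤-trans (unassign-leaves v′ Ax Bb f′x) (capacity v′ b Bb)
            unblocked₁ : ∀ y → A y ≡ true → f₁ y ≡ b → codeg a y < e
            unblocked₁ y Ay f₁y = ≰⇒> λ c → none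
              (y , Ay , ==⇒≡ (trans (≡-sym (agree y b Bb Rb)) (≡⇒== (proj₂ (unassign-elsewhere v′ Ax Bb f₁y)))) , c)
            f₂ = update f₁ a b
            v₂ : Valid f₂
            v₂ = assign-valid v₁ Aa f₁a Bb ab room₁ unblocked₁
            agree₂ : ∀ y c → B c ≡ true → R′ c ≡ false → (f₂ y == c) ≡ (f y == c)
            agree₂ y c Bc R′c = by-cases (y ≟ a) (y ≟ x)
              where
              by-cases : Dec (y ≡ a) → Dec (y ≡ x) → (f₂ y == c) ≡ (f y == c)
              by-cases (yes refl) _ = trans (≢⇒== (λ h → b-out R′c (trans (≡-sym (update-at f₁ y b)) h)))
                (trans (≡-sym (≢⇒== (λ h → A∉B Aa Bc (trans (≡-sym f′a) h)))) (agree y c Bc (old-out R′c)))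
              by-cases (no y≢a) (yes refl) = trans (≢⇒== (λ h → A∉B Ax Bc
                  (trans (≡-sym (trans (update-off f₁ a b y≢a) (update-at f′ y y))) h)))
                (≡-sym (≢⇒== (λ h → b-out R′c (trans (≡-sym fx) h))))
              by-cases (no y≢a) (no y≢x) = trans (cong (_== c) (trans (update-off f₁ a b y≢a) (update-off f′ x x y≢x)))
                (agree y c Bc (old-out R′c))
          release′ : ∀ x → A x ≡ true → Source R′ x → Release R′ x
          release′ x Ax src′ = by-source src′
            where
            keep : Source R x → Release R′ x
            keep s with release x Ax s
            ... | g , vg , gx , αg , ag = g , vg , gx , αg , λ y c Bc R′c → ag y c Bc (old-out R′c)
            by-source : Source R′ x → Release R′ x
            by-source (inj₁ h) = keep (inj₁ h)
            by-source (inj₂ h) = insert-elim {S = R} h (λ Rfx → keep (inj₂ Rfx)) (exchange x Ax)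
          extend : ∀ fuel → n G ≤ fuel + count R → (∃[ f′ ] Valid f′ × α f < α f′) ⊎ Closed f
          extend zero bd = ⊥-elim (<-irrefl refl (≤-trans (≤-trans (s≤s bd) (≤-reflexive (≡-sym size))) (count≤ R′)))
          extend (suc fuel) bd = grow fuel R′
            (λ c h → insert-elim {S = R} h (R⊆B c) λ { refl → Bb })
            (λ c h → insert-elim {S = R} h (full c) λ { refl → full-b })
            release′
            (≤-trans bd (≤-reflexive (trans (≡-sym (+-suc fuel (count R))) (cong (fuel +_) (≡-sym size)))))

      unassigned : ∀ {f} → Valid f → ∃[ a ] (A a ≡ true × f a ≡ a)
      unassigned {f} v with any? (λ a → (A a ≟ᵇ true) ×-dec (f a ≟ a))
      ... | yes h = h
      ... | no none = ⊥-elim (<-irrefl refl (≤-trans A-large (begin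
        count A                              ≡⟨ count≡∑ A ⟩
        ∑ (λ x → ⟦ A x ⟧)                    ≤⟨ ∑-mono (λ x → ⟦⟧≤ (assigned x)) ⟩
        ∑ (λ x → ⟦ B (f x) ⟧ * ⟦ A x ⟧)      ≡⟨ ≡-sym (∑-fibre f (λ b x → ⟦ B b ⟧ * ⟦ A x ⟧)) ⟩
        ∑ (λ b → ∑ (λ x → ⟦ f x == b ⟧ * (⟦ B b ⟧ * ⟦ A x ⟧))) ≤⟨ ∑-mono star ⟩
        ∑ (λ b → ℓ * ⟦ B b ⟧)                ≡⟨ ∑-*ˡ ℓ (λ b → ⟦ B b ⟧) ⟩
        ℓ * ∑ (λ b → ⟦ B b ⟧)                ≡⟨ cong (ℓ *_) (≡-sym (count≡∑ B)) ⟩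
        ℓ * count B ∎)))
        where
        open ≤-Reasoning
        assigned : ∀ x → A x ≡ true → 1 ≤ ⟦ B (f x) ⟧ * ⟦ A x ⟧
        assigned x Ax with target v x
        ... | inj₁ h = ⊥-elim (none (x , Ax , h))
        ... | inj₂ (_ , Bfx , _) = ≤⟦⟧* Bfx (≤-reflexive (≡-sym (cong ⟦_⟧ Ax)))
        star : ∀ b → ∑ (λ x → ⟦ f x == b ⟧ * (⟦ B b ⟧ * ⟦ A x ⟧)) ≤ ℓ * ⟦ B b ⟧
        star b = begin
          ∑ (λ x → ⟦ f x == b ⟧ * (⟦ B b ⟧ * ⟦ A x ⟧))
            ≡⟨ ∑-cong (λ x → trans (rearr ⟦ f x == b ⟧ ⟦ B b ⟧ ⟦ A x ⟧) (cong (⟦ B b ⟧ *_) (≡-sym (⟦∧⟧ (A x) (f x == b))))) ⟩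
          ∑ (λ x → ⟦ B b ⟧ * ⟦ leaf f b x ⟧)  ≡⟨ ∑-*ˡ ⟦ B b ⟧ (λ x → ⟦ leaf f b x ⟧) ⟩
          ⟦ B b ⟧ * ∑ (λ x → ⟦ leaf f b x ⟧)  ≤⟨ bounded ⟩
          ℓ * ⟦ B b ⟧ ∎
          where
          rearr : ∀ p q r → p * (q * r) ≡ q * (r * p)
          rearr = solve-∀
          bounded : ⟦ B b ⟧ * ∑ (λ x → ⟦ leaf f b x ⟧) ≤ ℓ * ⟦ B b ⟧
          bounded with B b in Bb
          ... | false = z≤n
          ... | true = ≤-trans (≤-reflexive (trans (*-identityˡ _) (≡-sym (count≡∑ (leaf f b)))))
                               (≤-trans (capacity v b Bb) (≤-reflexive (≡-sym (*-identityʳ ℓ))))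

      closed-assignment : ∃[ f ] Valid f × Closed f
      closed-assignment = go (n G) (λ x → x) valid-id (m≤m+n (n G) _)
        where
        go : ∀ fuel f → Valid f → n G ≤ fuel + α f → ∃[ f ] Valid f × Closed f
        go fuel f v bound with unassigned v
        ... | a , Aa , fa with augment v a Aa fa
        ...   | inj₂ c = f , v , c
        ...   | inj₁ (f′ , v′ , more) with fuel
        ...     | zero = ⊥-elim (<-irrefl refl (≤-trans (≤-trans (s≤s bound) more) (count≤ (λ x → A x ∧ B (f′ x)))))
        ...     | suc fuel′ = go fuel′ f′ v′ (≤-trans bound (≤-trans (≤-reflexive (≡-sym (+-suc fuel′ (α f)))) (+-monoʳ-≤ fuel′ more)))

      star-minor : StarMinor G ℓ D e
      star-minor with closed-assignment
      ... | f , v , closed = quotient R ,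
          quotient-model (ℓ + 1) R (λ u Ru → B-fixed v (R⊆B u Ru)) walk size , inhabited , edges
        where
        open Closed closed
        open Quotient G f
        walk : ∀ x → R (f x) ≡ true → WalkIn G (λ z → f z ≡ f x) x (f x)
        walk x Rfx with target v x
        ... | inj₁ h = subst (WalkIn G (λ z → f z ≡ f x) x) (≡-sym h) (here refl)
        ... | inj₂ (_ , Bfx , a) = step refl a (here (B-fixed v Bfx))
        size : ∀ u → R u ≡ true → count (λ x → f x == u) ≤ ℓ + 1
        size u Ru = ≤-trans (count-mono sub)
          (≤-trans (≤-reflexive (trans (count-insert u (leaf f u) u∉) (+-comm 1 _))) (+-monoˡ-≤ 1 (capacity v u (R⊆B u Ru))))
          where
          u∉ : leaf f u u ≡ false
          u∉ = ¬true⇒false λ h → disjoint (proj₁ (∧-elim {A u} h)) (R⊆B u Ru)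
          sub : ∀ x → (f x == u) ≡ true → insert u (leaf f u) x ≡ true
          sub x h with target v x
          ... | inj₁ fx = subst (λ z → insert u (leaf f u) z ≡ true) (trans (≡-sym (==⇒≡ h)) fx) (insert-new u (leaf f u))
          ... | inj₂ (Ax , _) = insert-old u (leaf f u) (∧-intro Ax h)
        -- Each of the `ℓ` leaves sees more than `D - e` centres in `R`, and two leaves share fewer
        -- than `e` of them since they are not mates. Inclusion-exclusion cut off after pairs leaves
        -- about `ℓ * D - ℓ * ℓ * e` distinct centres, each adjacent to this star in the quotient.
        row : ∀ b → R b ≡ true → ℓ * D ≤ ∑ (λ z → ⟦ R z ∧ padj b z ⟧) + ℓ * ℓ * e
        row b Rb = conclude
          where
          open ≤-Reasoning
          L : V → Bool
          L = leaf f b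
          N : V → ℕ
          N x = ∑ (λ z → ⟦ R z ∧ adj G x z ⟧)
          inc : V → V → ℕ
          inc x z = ⟦ L x ⟧ * ⟦ R z ∧ adj G x z ⟧
          c : V → ℕ
          c z = ∑ (λ x → inc x z)
          g : V → Bool
          g z = any (λ x → L x ∧ (R z ∧ adj G x z))
          per-L : ∀ t → ∑ (λ x → ⟦ L x ⟧ * t) ≡ ℓ * t
          per-L t = trans (≡-sym (count-* L t)) (cong (_* t) (≤-antisym (capacity v b (R⊆B b Rb)) (full b Rb)))
          S : ℕ
          S = ∑ (λ x → ⟦ L x ⟧ * N x)
          ∑c≡S : ∑ c ≡ S
          ∑c≡S = trans (∑-swap (λ z x → inc x z)) (∑-cong λ x → ∑-*ˡ ⟦ L x ⟧ (λ z → ⟦ R z ∧ adj G x z ⟧))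
          -- 2 c ≤ [c > 0] + c² bounds the union of the leaves' neighbourhoods from below in terms of pairwise intersections.
          double≤1+square : ∀ t → 2 * suc t ≤ 1 + suc t * suc t
          double≤1+square t = ≤-trans (m≤m+n (2 * suc t) (t * t)) (≤-reflexive (identity t))
            where
            identity : ∀ t → 2 * suc t + t * t ≡ 1 + suc t * suc t
            identity = solve-∀
          double : ∀ z → 2 * c z ≤ ⟦ g z ⟧ + c z * c z
          double z with c z in eq
          ... | zero = z≤n
          ... | suc t = ≤-trans (double≤1+square t) (+-monoˡ-≤ (suc t * suc t) hit)
            where
            hit : 1 ≤ ⟦ g z ⟧
            hit with g z in none
            ... | true = ≤-refl
            ... | false = ⊥-elim (0≢1+n (trans (≡-sym (trans (∑-cong (λ x → trans (≡-sym (⟦∧⟧ (L x) (R z ∧ adj G x z)))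
                  (cong ⟦_⟧ (¬true⇒false λ h → true≢false (any-intro (λ x → L x ∧ (R z ∧ adj G x z)) x h) none))))
                  (∑-zero (n G)))) eq))
          pair : V → V → ℕ
          pair x y = ∑ (λ z → inc x z * inc y z)
          ∑c²≡ : ∑ (λ z → c z * c z) ≡ ∑ (λ x → ∑ (pair x))
          ∑c²≡ = trans (∑-cong λ z → trans (≡-sym (∑-*ʳ (c z) (λ x → inc x z))) (∑-cong λ x → ≡-sym (∑-*ˡ (inc x z) (λ y → inc y z))))
            (trans (∑-swap (λ z x → ∑ (λ y → inc x z * inc y z))) (∑-cong λ x → ∑-swap (λ z y → inc x z * inc y z)))
          inc-elim : ∀ x y z → inc x z * inc y z ≤ ⟦ B z ∧ (adj G x z ∧ adj G y z) ⟧
          inc-elim x y z with R z in Rz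
          ... | false rewrite *-zeroʳ ⟦ L x ⟧ = z≤n
          ... | true rewrite R⊆B z Rz with L x | L y | adj G x z | adj G y z
          ...   | false | _ | _ | _ = z≤n
          ...   | true | _ | false | _ = z≤n
          ...   | true | false | true | _ = z≤n
          ...   | true | true | true | false = z≤n
          ...   | true | true | true | true = ≤-refl
          inc-diag : ∀ x z → inc x z * inc x z ≤ ⟦ R z ∧ adj G x z ⟧
          inc-diag x z with L x | R z ∧ adj G x z
          ... | false | _ = z≤n
          ... | true | true = ≤-refl
          ... | true | false = z≤n
          off-leaf : ∀ x y → L y ≡ false → pair x y ≤ 0
          off-leaf x y Ly = ≤-reflexive (trans (∑-cong λ z → trans (cong (λ w → inc x z * (⟦ w ⟧ * ⟦ R z ∧ adj G y z ⟧)) Ly) (*-zeroʳ (inc x z))) (∑-zero (n G)))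
          -- The diagonal pair is charged `N x` instead of `e`. The `e` left over at each leaf
          -- balances the term `ℓ * e` of `many`, so that the final error is `ℓ * ℓ * e` and no
          -- more.
          pointwise : ∀ x → L x ≡ true → ∀ y → pair x y + ⟦ y == x ⟧ * e ≤ ⟦ L y ⟧ * e + ⟦ y == x ⟧ * N x
          pointwise x Lx y = by-cases (y ≟ x)
            where
            by-cases : Dec (y ≡ x) → pair x y + ⟦ y == x ⟧ * e ≤ ⟦ L y ⟧ * e + ⟦ y == x ⟧ * N x
            by-cases (yes refl) = ≤-trans (≤-reflexive (+-comm (pair x x) _))
              (+-mono-≤ (*-monoˡ-≤ e (⟦⟧-mono {x == x} {L x} (λ _ → Lx)))
                        (≤⟦⟧* (≡⇒== {x = x} refl) (∑-mono (inc-diag x))))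
            by-cases (no y≢x) rewrite ≢⇒== y≢x = by-leaf (L y) refl
              where
              by-leaf : ∀ w → L y ≡ w → pair x y + 0 ≤ ⟦ w ⟧ * e + 0
              by-leaf false Ly = +-monoˡ-≤ 0 (off-leaf x y Ly)
              by-leaf true Ly = +-monoˡ-≤ 0 (≤-trans (∑-mono (inc-elim x y)) (≤-trans (<⇒≤ close) (≤-reflexive (≡-sym (*-identityˡ e)))))
                where
                Ax,fx = ∧-elim {A x} Lx
                Ay,fy = ∧-elim {A y} Ly
                close : codeg x y < e
                close = unmated v x y (proj₁ Ax,fx) (proj₁ Ay,fy)
                  (trans (==⇒≡ (proj₂ Ax,fx)) (≡-sym (==⇒≡ (proj₂ Ay,fy))))
                  (trans (cong B (==⇒≡ (proj₂ Ax,fx))) (R⊆B b Rb)) (y≢x ∘ ≡-sym)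
          per-leaf : ∀ x → L x ≡ true → ∑ (pair x) + e ≤ ℓ * e + N x
          per-leaf x Lx = begin
            ∑ (pair x) + e ≡⟨ cong (∑ (pair x) +_) (≡-sym (∑-point′ x (λ _ → e))) ⟩
            ∑ (pair x) + ∑ (λ y → ⟦ y == x ⟧ * e) ≡⟨ ≡-sym (∑-+ (pair x) (λ y → ⟦ y == x ⟧ * e)) ⟩
            ∑ (λ y → pair x y + ⟦ y == x ⟧ * e) ≤⟨ ∑-mono (pointwise x Lx) ⟩
            ∑ (λ y → ⟦ L y ⟧ * e + ⟦ y == x ⟧ * N x) ≡⟨ ∑-+ (λ y → ⟦ L y ⟧ * e) (λ y → ⟦ y == x ⟧ * N x) ⟩
            ∑ (λ y → ⟦ L y ⟧ * e) + ∑ (λ y → ⟦ y == x ⟧ * N x)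
              ≡⟨ cong₂ _+_ (per-L e) (∑-point′ x (λ _ → N x)) ⟩
            ℓ * e + N x ∎
          non-leaf : ∀ x → L x ≡ false → ∑ (pair x) ≡ 0
          non-leaf x Lx = trans (∑-cong λ y → trans (∑-cong λ z → cong (λ w → ⟦ w ⟧ * ⟦ R z ∧ adj G x z ⟧ * inc y z) Lx) (∑-zero (n G))) (∑-zero (n G))
          squares : ∑ (λ z → c z * c z) + ℓ * e ≤ ℓ * (ℓ * e) + S
          squares = begin
            ∑ (λ z → c z * c z) + ℓ * e
              ≡⟨ cong₂ _+_ ∑c²≡ (≡-sym (per-L e)) ⟩
            ∑ (λ x → ∑ (pair x)) + ∑ (λ x → ⟦ L x ⟧ * e)
              ≡⟨ ≡-sym (∑-+ (λ x → ∑ (pair x)) (λ x → ⟦ L x ⟧ * e)) ⟩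
            ∑ (λ x → ∑ (pair x) + ⟦ L x ⟧ * e) ≤⟨ ∑-mono each ⟩
            ∑ (λ x → ⟦ L x ⟧ * (ℓ * e) + ⟦ L x ⟧ * N x) ≡⟨ ∑-+ (λ x → ⟦ L x ⟧ * (ℓ * e)) (λ x → ⟦ L x ⟧ * N x) ⟩
            ∑ (λ x → ⟦ L x ⟧ * (ℓ * e)) + S ≡⟨ cong (_+ S) (per-L (ℓ * e)) ⟩
            ℓ * (ℓ * e) + S ∎
            where
            each : ∀ x → ∑ (pair x) + ⟦ L x ⟧ * e ≤ ⟦ L x ⟧ * (ℓ * e) + ⟦ L x ⟧ * N x
            each x = by-leaf (L x) refl
              where
              by-leaf : ∀ w → L x ≡ w → ∑ (pair x) + ⟦ w ⟧ * e ≤ ⟦ w ⟧ * (ℓ * e) + ⟦ w ⟧ * N x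
              by-leaf false Lx = ≤-reflexive (cong (_+ 0) (non-leaf x Lx))
              by-leaf true Lx = ≤-trans (≤-reflexive (cong (∑ (pair x) +_) (*-identityˡ e)))
                (≤-trans (per-leaf x Lx) (≤-reflexive (≡-sym (cong₂ _+_ (*-identityˡ (ℓ * e)) (*-identityˡ (N x))))))
          -- Strictness in `expansion` gains `ℓ` here. In `conclude` it pays for `b` itself, which
          -- may be among the centres seen by its leaves but is not a neighbour of its own star.
          many : ℓ * suc D ≤ S + ℓ * e
          many = begin
            ℓ * suc D ≡⟨ ≡-sym (per-L (suc D)) ⟩
            ∑ (λ x → ⟦ L x ⟧ * suc D) ≤⟨ ∑-mono each ⟩
            ∑ (λ x → ⟦ L x ⟧ * N x + ⟦ L x ⟧ * e) ≡⟨ ∑-+ (λ x → ⟦ L x ⟧ * N x) (λ x → ⟦ L x ⟧ * e) ⟩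
            S + ∑ (λ x → ⟦ L x ⟧ * e) ≡⟨ cong (S +_) (per-L e) ⟩
            S + ℓ * e ∎
            where
            each : ∀ x → ⟦ L x ⟧ * suc D ≤ ⟦ L x ⟧ * N x + ⟦ L x ⟧ * e
            each x = ≤-trans (by-leaf (L x) refl) (≤-reflexive (*-distribˡ-+ ⟦ L x ⟧ (N x) e))
              where
              by-leaf : ∀ w → L x ≡ w → ⟦ w ⟧ * suc D ≤ ⟦ w ⟧ * (N x + e)
              by-leaf false _ = z≤n
              by-leaf true Lx = let Ax , fx = ∧-elim {A x} Lx in
                *-monoʳ-≤ 1 (expansion x Ax (trans (cong R (==⇒≡ fx)) Rb))
          Q = ∑ (λ z → ⟦ R z ∧ padj b z ⟧)
          reached : ∑ (λ z → ⟦ g z ⟧) ≤ Q + 1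
          reached = begin
            ∑ (λ z → ⟦ g z ⟧) ≤⟨ ∑-mono each ⟩
            ∑ (λ z → ⟦ R z ∧ padj b z ⟧ + ⟦ z == b ⟧) ≡⟨ ∑-+ (λ z → ⟦ R z ∧ padj b z ⟧) (λ z → ⟦ z == b ⟧) ⟩
            Q + ∑ (λ z → ⟦ z == b ⟧) ≡⟨ cong (Q +_) (∑-== b) ⟩
            Q + 1 ∎
            where
            each : ∀ z → ⟦ g z ⟧ ≤ ⟦ R z ∧ padj b z ⟧ + ⟦ z == b ⟧
            each z with z ≟ b
            ... | yes refl = ≤-trans (⟦⟧≤1 (g z)) (m≤n+m 1 _)
            ... | no z≢b = ≤-trans (⟦⟧-mono linked) (m≤m+n _ 0)
              where
              linked : g z ≡ true → R z ∧ padj b z ≡ true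
              linked h with any-elim (λ x → L x ∧ (R z ∧ adj G x z)) h
              ... | x , h₁ with ∧-elim {L x} h₁
              ...   | Lx , h₂ with ∧-elim {R z} h₂
              ...     | Rz , xz = ∧-intro Rz (padj-intro x z (z≢b ∘ ≡-sym) (==⇒≡ (proj₂ (∧-elim {A x} Lx))) (B-fixed v (R⊆B z Rz)) xz)
          conclude : ℓ * D ≤ Q + ℓ * ℓ * e
          conclude = +-cancelʳ-≤ (ℓ + S + S + ℓ * e) (ℓ * D) (Q + ℓ * ℓ * e) (begin
            ℓ * D + (ℓ + S + S + ℓ * e)  ≡⟨ e₁ ℓ D S e ⟩
            ℓ * suc D + 2 * S + ℓ * e     ≤⟨ +-monoˡ-≤ (ℓ * e) (+-mono-≤ many doubled) ⟩
            S + ℓ * e + (Q + 1 + X) + ℓ * e ≡⟨ e₂ S (ℓ * e) Q X ⟩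
            Q + (X + ℓ * e) + S + (1 + ℓ * e) ≤⟨ +-mono-≤ (+-monoˡ-≤ S (+-monoʳ-≤ Q squares)) (+-monoˡ-≤ (ℓ * e) 1≤ℓ) ⟩
            Q + (ℓ * (ℓ * e) + S) + S + (ℓ + ℓ * e) ≡⟨ e₃ Q ℓ e S ⟩
            Q + ℓ * ℓ * e + (ℓ + S + S + ℓ * e) ∎)
            where
            X = ∑ (λ z → c z * c z)
            e₁ : ∀ ℓ D S e → ℓ * D + (ℓ + S + S + ℓ * e) ≡ ℓ * suc D + 2 * S + ℓ * e
            e₁ = solve-∀
            e₂ : ∀ S w Q X → S + w + (Q + 1 + X) + w ≡ Q + (X + w) + S + (1 + w)
            e₂ = solve-∀
            e₃ : ∀ Q ℓ e S → Q + (ℓ * (ℓ * e) + S) + S + (ℓ + ℓ * e) ≡ Q + ℓ * ℓ * e + (ℓ + S + S + ℓ * e)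
            e₃ = solve-∀
            doubled : 2 * S ≤ Q + 1 + X
            doubled = begin
              2 * S ≡⟨ trans (cong (2 *_) (≡-sym ∑c≡S)) (≡-sym (∑-*ˡ 2 c)) ⟩
              ∑ (λ z → 2 * c z) ≤⟨ ∑-mono double ⟩
              ∑ (λ z → ⟦ g z ⟧ + c z * c z) ≡⟨ ∑-+ (λ z → ⟦ g z ⟧) (λ z → c z * c z) ⟩
              ∑ (λ z → ⟦ g z ⟧) + X ≤⟨ +-monoˡ-≤ X reached ⟩
              Q + 1 + X ∎
        edges : count R * (ℓ * D) ≤ degSum (quotient R) + count R * (ℓ * ℓ * e)
        edges = begin
          count R * (ℓ * D) ≡⟨ count-* R (ℓ * D) ⟩
          ∑ (λ b → ⟦ R b ⟧ * (ℓ * D)) ≤⟨ ∑-mono each ⟩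
          ∑ (λ b → ∑ (λ z → ⟦ R b ∧ (R z ∧ padj b z) ⟧) + ⟦ R b ⟧ * (ℓ * ℓ * e))
            ≡⟨ ∑-+ (λ b → ∑ (λ z → ⟦ R b ∧ (R z ∧ padj b z) ⟧)) (λ b → ⟦ R b ⟧ * (ℓ * ℓ * e)) ⟩
          ∑ (λ b → ∑ (λ z → ⟦ R b ∧ (R z ∧ padj b z) ⟧)) + ∑ (λ b → ⟦ R b ⟧ * (ℓ * ℓ * e))
            ≡⟨ cong₂ _+_ (≡-sym (degSum-restrict R padj padj-sym padj-irrefl)) (≡-sym (count-* R (ℓ * ℓ * e))) ⟩
          degSum (quotient R) + count R * (ℓ * ℓ * e) ∎
          where
          open ≤-Reasoning
          each : ∀ b → ⟦ R b ⟧ * (ℓ * D) ≤ ∑ (λ z → ⟦ R b ∧ (R z ∧ padj b z) ⟧) + ⟦ R b ⟧ * (ℓ * ℓ * e)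
          each b = by-cases (R b) refl
            where
            by-cases : ∀ w → R b ≡ w → ⟦ w ⟧ * (ℓ * D) ≤ ∑ (λ z → ⟦ w ∧ (R z ∧ padj b z) ⟧) + ⟦ w ⟧ * (ℓ * ℓ * e)
            by-cases false _ = z≤n
            by-cases true Rb = ≤-trans (≤-reflexive (*-identityˡ (ℓ * D)))
              (≤-trans (row b Rb) (≤-reflexive (cong (∑ (λ z → ⟦ R z ∧ padj b z ⟧) +_) (≡-sym (*-identityˡ (ℓ * ℓ * e))))))

    dense-or-star-minor : ∀ Δ → (∀ a → A a ≡ true → deg G a ≤ Δ) →
      DenseSubgraph G (2 * (Δ + e)) (e * e) ⊎ StarMinor G ℓ D e
    dense-or-star-minor Δ low with any? (λ a → (A a ≟ᵇ true) ×-dec (e ≤? count (mate a)))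
    ... | yes (a , Aa , many) = let H , H⊆G , size , edges = mates-dense a many in
            inj₁ (H , H⊆G , ≤-trans size (*-monoʳ-≤ 2 (+-monoˡ-≤ e (low a Aa))) , edges)
    ... | no none = inj₂ (star-minor λ a Aa → ≰⇒> λ h → none (a , Aa , h))

  -- Partitions into small connected parts

  module Contraction (G : Graph) (k e Δ : ℕ) where

    private
      V = Fin (n G)

    big : V → Bool
    big x = does (suc Δ ≤? deg G x)

    not-big : ∀ {x} → big x ≡ false → deg G x ≤ Δ
    not-big {x} h = ≮⇒≥ λ lt → true≢false (true-does (suc Δ ≤? deg G x) lt) h

    -- `big-alone` ensures that a small part contains only vertices of degree at most `Δ`, so at
    -- most `kΔ/2` parts are adjacent to it.
    record Partition : Set where
      field
        r : V → V
        idem : ∀ x → r (r x) ≡ r x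
        conn : ∀ x → WalkIn G (λ z → r z ≡ r x) x (r x)
        size≤k : ∀ c → count (λ y → r y == c) ≤ k
        big-alone : ∀ x y → big x ≡ true → r y ≡ r x → y ≡ x

    module Parts (P : Partition) where
      open Partition P public
      open Quotient G r public

      size : V → ℕ
      size c = count (λ y → r y == c)

      -- Half of `k` is the threshold because the union of two small parts must again have at most
      -- `k` vertices. A big singleton does not count as small, hence is never merged.
      small : V → Bool
      small c = (r c == c) ∧ (not (big c) ∧ does (2 * size c ≤? k))

      #small : ℕ
      #small = count small

      total : ℕ
      total = ∑∑ (λ u v → ⟦ padj u v ⟧)

      touches : V → V → Bool
      touches t c = any (λ y → (r y == c) ∧ adj G t y)

      richness : V → ℕ
      richness t = count (λ c → small c ∧ touches t c)

      common : V → V → ℕ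
      common u v = ∑ (λ z → ⟦ padj u z ∧ padj v z ⟧)

      small-fixed : ∀ {c} → small c ≡ true → r c ≡ c
      small-fixed {c} h = ==⇒≡ (proj₁ (∧-elim {r c == c} h))

      small-not-big : ∀ {c} → small c ≡ true → big c ≡ false
      small-not-big {c} h = not-true (proj₁ (∧-elim {not (big c)} (proj₂ (∧-elim {r c == c} h))))

      small-size : ∀ {c} → small c ≡ true → 2 * size c ≤ k
      small-size {c} h = does-true (2 * size c ≤? k) (proj₂ (∧-elim {not (big c)} (proj₂ (∧-elim {r c == c} h))))

      small-intro : ∀ {c} → r c ≡ c → big c ≡ false → 2 * size c ≤ k → small c ≡ true
      small-intro {c} h₁ h₂ h₃ = ∧-intro (≡⇒== h₁) (∧-intro (cong not h₂) (true-does (2 * size c ≤? k) h₃))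

      touches-elim : ∀ {t c} → touches t c ≡ true → ∃[ y ] (r y ≡ c × adj G t y ≡ true)
      touches-elim {t} {c} h with any-elim (λ y → (r y == c) ∧ adj G t y) h
      ... | y , h′ = let ry , a = ∧-elim {r y == c} h′ in y , ==⇒≡ ry , a

      touches-intro : ∀ {t c} y → r y ≡ c → adj G t y ≡ true → touches t c ≡ true
      touches-intro {t} {c} y ry a = any-intro (λ y → (r y == c) ∧ adj G t y) y (∧-intro (≡⇒== ry) a)

      members-not-big : ∀ {c x} → small c ≡ true → r x ≡ c → big x ≡ false
      members-not-big {c} {x} sc rx = ¬true⇒false λ bx →
        true≢false (trans (cong big (big-alone x c bx (trans (small-fixed sc) (≡-sym rx)))) bx) (small-not-big sc)

    discrete : 1 ≤ k → Partition
    discrete 1≤k = record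
      { r = λ x → x ; idem = λ _ → refl ; conn = λ x → here refl
      ; size≤k = λ c → ≤-trans (≤-reflexive (trans (count≡∑ (λ y → y == c)) (∑-== c))) 1≤k
      ; big-alone = λ _ _ _ h → h }

    -- If every candidate in W shares e neighbours with c, the parts around c span a small dense subgraph.
    mergeable : (P : Partition) → let open Parts P in
      ∀ c (W : V → Bool) → small c ≡ true → (∀ w → W w ≡ true → padj c w ≡ true) → e ≤ count W →
      DenseSubgraph G (2 * k + k * k * Δ) (e * e) ⊎ (∃[ w ] (W w ≡ true × common c w < e))
    mergeable P c W sc W⊆ many with any? (λ w → (W w ≟ᵇ true) ×-dec (suc (Parts.common P c w) ≤? e))
    ... | yes h = inj₂ h
    ... | no none = inj₁ (induced G p , induced⊆ G p , vertices , edges)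
      where
      open Parts P
      open ≤-Reasoning
      p : V → Bool
      p y = (r y == c) ∨ padj c (r y)
      p-right : ∀ y → padj c (r y) ≡ true → p y ≡ true
      p-right y h rewrite h with r y == c
      ... | true = refl
      ... | false = refl
      neighbours : ∑ (λ z → ⟦ padj c z ⟧) ≤ size c * Δ
      neighbours = begin
        ∑ (λ z → ⟦ padj c z ⟧)
          ≡⟨ ≡-sym (∑-point′ c (λ u → ∑ (λ z → ⟦ padj u z ⟧))) ⟩
        ∑ (λ u → ⟦ u == c ⟧ * ∑ (λ z → ⟦ padj u z ⟧))
          ≡⟨ ∑-cong (λ u → ≡-sym (∑-*ˡ ⟦ u == c ⟧ (λ z → ⟦ padj u z ⟧))) ⟩
        ∑ (λ u → ∑ (λ z → ⟦ u == c ⟧ * ⟦ padj u z ⟧))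
          ≤⟨ ∑padj≤ (λ u _ → ⟦ u == c ⟧) ⟩
        ∑ (λ x → ∑ (λ y → ⟦ r x == c ⟧ * ⟦ adj G x y ⟧))
          ≡⟨ ∑-cong (λ x → ∑-*ˡ ⟦ r x == c ⟧ (λ y → ⟦ adj G x y ⟧)) ⟩
        ∑ (λ x → ⟦ r x == c ⟧ * deg G x)
          ≤⟨ ∑-mono (λ x → ⟦⟧*≤ {r x == c} λ h → ≤⟦⟧* h (not-big (members-not-big sc (==⇒≡ h)))) ⟩
        ∑ (λ x → ⟦ r x == c ⟧ * Δ)
          ≡⟨ ≡-sym (count-* (λ x → r x == c) Δ) ⟩
        size c * Δ ∎
      -- There are at most `k` vertices in the part of `c` and at most `k` in each of at most
      -- `size c * Δ` neighbouring parts. Doubling allows `2 * size c ≤ k` to be used without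
      -- halving `k`.
      vertices : 2 * count p ≤ 2 * k + k * k * Δ
      vertices = begin
        2 * count p
          ≡⟨ cong (2 *_) (count≡∑ p) ⟩
        2 * ∑ (λ y → ⟦ p y ⟧)
          ≤⟨ *-monoʳ-≤ 2 (∑-mono λ y → ⟦∨⟧≤ (r y == c) (padj c (r y))) ⟩
        2 * ∑ (λ y → ⟦ r y == c ⟧ + ⟦ padj c (r y) ⟧)
          ≡⟨ cong (2 *_) (trans (∑-+ (λ y → ⟦ r y == c ⟧) (λ y → ⟦ padj c (r y) ⟧))
               (cong₂ _+_ (≡-sym (count≡∑ (λ y → r y == c))) (≡-sym (∑-fibre r (λ z _ → ⟦ padj c z ⟧))))) ⟩
        2 * (size c + ∑ (λ z → ∑ (λ y → ⟦ r y == z ⟧ * ⟦ padj c z ⟧)))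
          ≤⟨ *-monoʳ-≤ 2 (+-mono-≤ (size≤k c) (∑-mono λ z → ≤-trans
               (≤-reflexive (≡-sym (count-* (λ y → r y == z) ⟦ padj c z ⟧)))
               (*-monoˡ-≤ ⟦ padj c z ⟧ (size≤k z)))) ⟩
        2 * (k + ∑ (λ z → k * ⟦ padj c z ⟧))
          ≡⟨ cong (λ t → 2 * (k + t)) (∑-*ˡ k (λ z → ⟦ padj c z ⟧)) ⟩
        2 * (k + k * ∑ (λ z → ⟦ padj c z ⟧))
          ≤⟨ *-monoʳ-≤ 2 (+-monoʳ-≤ k (*-monoʳ-≤ k neighbours)) ⟩
        2 * (k + k * (size c * Δ))
          ≡⟨ rearr k (size c) Δ ⟩
        2 * k + k * (2 * size c) * Δ
          ≤⟨ +-monoʳ-≤ (2 * k) (*-monoˡ-≤ Δ (*-monoʳ-≤ k (small-size sc))) ⟩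
        2 * k + k * k * Δ ∎
        where
        rearr : ∀ k s Δ → 2 * (k + k * (s * Δ)) ≡ 2 * k + k * (2 * s) * Δ
        rearr = solve-∀
      edges : e * e ≤ degSum (induced G p)
      edges = begin
        e * e ≤⟨ *-monoˡ-≤ e many ⟩
        count W * e ≡⟨ count-* W e ⟩
        ∑ (λ w → ⟦ W w ⟧ * e) ≤⟨ ∑-mono (λ w → ⟦⟧*≤ {W w} λ Ww → ≤⟦⟧* Ww (≮⇒≥ λ lt → none (w , Ww , lt))) ⟩
        ∑ (λ w → ⟦ W w ⟧ * common c w)
          ≡⟨ ∑-cong (λ w → trans (≡-sym (∑-*ˡ ⟦ W w ⟧ (λ z → ⟦ padj c z ∧ padj w z ⟧)))
               (∑-cong λ z → trans (cong (⟦ W w ⟧ *_) (⟦∧⟧ (padj c z) (padj w z))) (≡-sym (*-assoc ⟦ W w ⟧ ⟦ padj c z ⟧ ⟦ padj w z ⟧)))) ⟩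
        ∑ (λ w → ∑ (λ z → ⟦ W w ⟧ * ⟦ padj c z ⟧ * ⟦ padj w z ⟧))
          ≤⟨ ∑padj≤ (λ w z → ⟦ W w ⟧ * ⟦ padj c z ⟧) ⟩
        ∑ (λ x → ∑ (λ y → ⟦ W (r x) ⟧ * ⟦ padj c (r y) ⟧ * ⟦ adj G x y ⟧))
          ≤⟨ ∑-mono (λ x → ∑-mono λ y → pointwise x y) ⟩
        ∑ (λ x → ∑ (λ y → ⟦ p x ∧ (p y ∧ adj G x y) ⟧))
          ≡⟨ ≡-sym (degSum-restrict p (adj G) (sym G) (irrefl G)) ⟩
        degSum (induced G p) ∎
        where
        pointwise : ∀ x y → ⟦ W (r x) ⟧ * ⟦ padj c (r y) ⟧ * ⟦ adj G x y ⟧ ≤ ⟦ p x ∧ (p y ∧ adj G x y) ⟧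
        pointwise x y = ≤-trans
          (≤-reflexive (trans (*-assoc ⟦ W (r x) ⟧ ⟦ padj c (r y) ⟧ ⟦ adj G x y ⟧)
            (≡-sym (trans (⟦∧⟧ (W (r x)) (padj c (r y) ∧ adj G x y)) (cong (⟦ W (r x) ⟧ *_) (⟦∧⟧ (padj c (r y)) (adj G x y)))))))
          (⟦⟧-mono λ h → let Wx , h′ = ∧-elim {W (r x)} h ; cy , a = ∧-elim {padj c (r y)} h′ in
            ∧-intro (p-right x (W⊆ (r x) Wx)) (∧-intro (p-right y cy) a))

    -- Merging two adjacent small parts

    module Merge (P : Partition) (c c′ : V) (sc : Parts.small P c ≡ true) (sc′ : Parts.small P c′ ≡ true)
                 (cc′ : Parts.padj P c c′ ≡ true) (few : Parts.common P c c′ < e) where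
      open Parts P

      c≢c′ : c ≢ c′
      c≢c′ = proj₁ (padj-elim cc′)

      r′ : V → V
      r′ x = if r x == c′ then c else r x

      moved : ∀ {x} → r x ≡ c′ → r′ x ≡ c
      moved h rewrite ≡⇒== h = refl

      kept : ∀ {x} → r x ≢ c′ → r′ x ≡ r x
      kept h rewrite ≢⇒== h = refl

      r′-other : ∀ {u} → u ≢ c → u ≢ c′ → ∀ y → (r′ y == u) ≡ (r y == u)
      r′-other {u} u≢c u≢c′ y = by-cases (r y ≟ c′)
        where
        by-cases : Dec (r y ≡ c′) → (r′ y == u) ≡ (r y == u)
        by-cases (yes h) = trans (≢⇒== (λ p → u≢c (trans (≡-sym p) (moved h)))) (≡-sym (≢⇒== (λ p → u≢c′ (trans (≡-sym p) h))))
        by-cases (no h) = cong (_== u) (kept h)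

      merged : Partition
      merged = record { r = r′ ; idem = idem′ ; conn = conn′ ; size≤k = size′ ; big-alone = alone′ }
        where
        rc : r c ≡ c
        rc = small-fixed sc
        idem′ : ∀ x → r′ (r′ x) ≡ r′ x
        idem′ x = by-cases (r x ≟ c′)
          where
          by-cases : Dec (r x ≡ c′) → r′ (r′ x) ≡ r′ x
          by-cases (yes h) = trans (cong r′ (moved h)) (trans (kept (c≢c′ ∘ trans (≡-sym rc))) (trans rc (≡-sym (moved h))))
          by-cases (no h) = trans (cong r′ (kept h)) (trans (kept (h ∘ trans (≡-sym (idem x)))) (trans (idem x) (≡-sym (kept h))))
        conn′ : ∀ x → WalkIn G (λ z → r′ z ≡ r′ x) x (r′ x)
        conn′ x = by-cases (r x ≟ c′)
          where
          by-cases : Dec (r x ≡ c′) → WalkIn G (λ z → r′ z ≡ r′ x) x (r′ x)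
          by-cases (no h) = subst (λ w → WalkIn G (λ z → r′ z ≡ w) x w) (≡-sym (kept h))
            (walk-map (λ {z} q → trans (kept (λ q′ → h (trans (≡-sym q) q′))) q) (conn x))
          by-cases (yes h) with padj-elim cc′
          ... | _ , a , b , ra , rb , ab = subst (λ w → WalkIn G (λ z → r′ z ≡ w) x w) (≡-sym (moved h))
                (walk-trans (x→c′ x h) (walk-trans (walk-rev (x→c′ b rb)) (step (moved rb) (trans (sym G b a) ab) a→c)))
            where
            x→c′ : ∀ y → r y ≡ c′ → WalkIn G (λ z → r′ z ≡ c) y c′
            x→c′ y q = subst (WalkIn G (λ z → r′ z ≡ c) y) q (walk-map (λ q′ → moved (trans q′ q)) (conn y))
            a→c : WalkIn G (λ z → r′ z ≡ c) a c
            a→c = subst (WalkIn G (λ z → r′ z ≡ c) a) ra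
              (walk-map (λ q → trans (kept (λ q′ → c≢c′ (trans (≡-sym (trans q ra)) q′))) (trans q ra)) (conn a))
        size′ : ∀ u → count (λ y → r′ y == u) ≤ k
        size′ u = by-cases (u ≟ c) (u ≟ c′)
          where
          open ≤-Reasoning
          by-cases : Dec (u ≡ c) → Dec (u ≡ c′) → count (λ y → r′ y == u) ≤ k
          by-cases (no h) (no h′) = ≤-trans (≤-reflexive (count-cong (r′-other h h′))) (size≤k u)
          by-cases (no h) (yes refl) = ≤-trans (count-mono λ y q → ⊥-elim (none y q)) (size≤k u)
            where
            none : ∀ y → (r′ y == u) ≡ true → ⊥
            none y q with r y ≟ u
            ... | yes p = h (≡-sym (==⇒≡ {x = c} q))
            ... | no p = p (==⇒≡ {x = r y} q)
          by-cases (yes refl) _ = *-cancelˡ-≤ 2 (begin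
            2 * count (λ y → r′ y == u) ≡⟨ cong (2 *_) (count≡∑ (λ y → r′ y == u)) ⟩
            2 * ∑ (λ y → ⟦ r′ y == u ⟧) ≤⟨ *-monoʳ-≤ 2 (∑-mono pointwise) ⟩
            2 * ∑ (λ y → ⟦ r y == u ⟧ + ⟦ r y == c′ ⟧)
              ≡⟨ cong (2 *_) (trans (∑-+ (λ y → ⟦ r y == u ⟧) (λ y → ⟦ r y == c′ ⟧))
                   (cong₂ _+_ (≡-sym (count≡∑ (λ y → r y == u))) (≡-sym (count≡∑ (λ y → r y == c′))))) ⟩
            2 * (size u + size c′) ≡⟨ *-distribˡ-+ 2 (size u) (size c′) ⟩
            2 * size u + 2 * size c′ ≤⟨ +-mono-≤ (small-size sc) (small-size sc′) ⟩
            k + k ≡⟨ cong (k +_) (≡-sym (+-identityʳ k)) ⟩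
            2 * k ∎)
            where
            pointwise : ∀ y → ⟦ r′ y == u ⟧ ≤ ⟦ r y == u ⟧ + ⟦ r y == c′ ⟧
            pointwise y with r y ≟ c′
            ... | yes h = ≤-trans (⟦⟧≤1 _) (m≤n+m 1 _)
            ... | no h = m≤m+n _ 0
        alone′ : ∀ x y → big x ≡ true → r′ y ≡ r′ x → y ≡ x
        alone′ x y bx = by-cases (r y ≟ c′)
          where
          x∉c′ : r x ≢ c′
          x∉c′ h = true≢false bx (members-not-big sc′ h)
          x∉c : r x ≢ c
          x∉c h = true≢false bx (members-not-big sc h)
          by-cases : Dec (r y ≡ c′) → r′ y ≡ r′ x → y ≡ x
          by-cases (yes h) q = ⊥-elim (x∉c (trans (≡-sym (kept x∉c′)) (trans (≡-sym q) (moved h))))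
          by-cases (no h) q = big-alone x y bx (trans (≡-sym (kept h)) (trans q (kept x∉c′)))

      open Parts merged using () renaming (padj to padj′; padj-intro to padj-intro′; padj-sym to padj-sym′; total to total′;
        small to small′; #small to #small′; richness to richness′; touches-intro to touches-intro′;
        small-fixed to small-fixed′)

      -- Strictness of `few` makes room for the edge between `c` and `c′`; the factor 2 is due to
      -- ordered pairs. Subtraction is avoided by adding to `total` what row and column `c` gain,
      -- and to `total′` what row and column `c′` lose.
      total-merged : total ≤ total′ + 2 * e
      total-merged = +-cancelʳ-≤ (2 * Γ) total (total′ + 2 * e) (begin
        total + 2 * Γ
          ≡⟨ cong (total +_) (trans (cong (Γ +_) (+-identityʳ Γ)) (cong₂ _+_ (≡-sym (rows c g)) (≡-sym (cols c g)))) ⟩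
        total + (∑∑ (λ u v → ⟦ u == c ⟧ * ⟦ g v ⟧) + ∑∑ (λ u v → ⟦ v == c ⟧ * ⟦ g u ⟧))
          ≡⟨ ≡-sym (∑∑-+₃ (λ u v → ⟦ padj u v ⟧) (λ u v → ⟦ u == c ⟧ * ⟦ g v ⟧) (λ u v → ⟦ v == c ⟧ * ⟦ g u ⟧)) ⟩
        ∑∑ (λ u v → ⟦ padj u v ⟧ + (⟦ u == c ⟧ * ⟦ g v ⟧ + ⟦ v == c ⟧ * ⟦ g u ⟧))
          ≤⟨ ∑∑-mono pointwise ⟩
        ∑∑ (λ u v → ⟦ padj′ u v ⟧ + (⟦ u == c′ ⟧ * ⟦ padj c′ v ⟧ + ⟦ v == c′ ⟧ * ⟦ padj c′ u ⟧))
          ≡⟨ ∑∑-+₃ (λ u v → ⟦ padj′ u v ⟧) (λ u v → ⟦ u == c′ ⟧ * ⟦ padj c′ v ⟧) (λ u v → ⟦ v == c′ ⟧ * ⟦ padj c′ u ⟧) ⟩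
        total′ + (∑∑ (λ u v → ⟦ u == c′ ⟧ * ⟦ padj c′ v ⟧) + ∑∑ (λ u v → ⟦ v == c′ ⟧ * ⟦ padj c′ u ⟧))
          ≡⟨ cong (total′ +_) (cong₂ _+_ (rows c′ (padj c′)) (cols c′ (padj c′))) ⟩
        total′ + (K + K)
          ≤⟨ +-monoʳ-≤ total′ (+-mono-≤ K≤ K≤) ⟩
        total′ + (e + Γ + (e + Γ))
          ≡⟨ rearr total′ e Γ ⟩
        total′ + 2 * e + 2 * Γ ∎)
        where
        open ≤-Reasoning
        -- The neighbours of c′ that become new neighbours of c; the other edges at c′ are lost.
        g : V → Bool
        g v = padj c′ v ∧ (not (padj c v) ∧ not (v == c))
        Γ K : ℕ
        Γ = ∑ (λ v → ⟦ g v ⟧)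
        K = ∑ (λ v → ⟦ padj c′ v ⟧)
        rearr : ∀ t e g → t + (e + g + (e + g)) ≡ t + 2 * e + 2 * g
        rearr = solve-∀
        rows : ∀ a (f : V → Bool) → ∑∑ (λ u v → ⟦ u == a ⟧ * ⟦ f v ⟧) ≡ ∑ (λ v → ⟦ f v ⟧)
        rows a f = trans (∑-cong λ u → ∑-*ˡ ⟦ u == a ⟧ (λ v → ⟦ f v ⟧)) (∑-point′ a (λ _ → ∑ (λ v → ⟦ f v ⟧)))
        cols : ∀ a (f : V → Bool) → ∑∑ (λ u v → ⟦ v == a ⟧ * ⟦ f u ⟧) ≡ ∑ (λ v → ⟦ f v ⟧)
        cols a f = ∑-cong λ u → ∑-point′ a (λ _ → ⟦ f u ⟧)
        K≤ : K ≤ e + Γ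
        K≤ = begin
          K ≤⟨ ∑-mono each ⟩
          ∑ (λ v → ⟦ v == c ⟧ + ⟦ padj c v ∧ padj c′ v ⟧ + ⟦ g v ⟧)
            ≡⟨ trans (∑-+ (λ v → ⟦ v == c ⟧ + ⟦ padj c v ∧ padj c′ v ⟧) (λ v → ⟦ g v ⟧))
                     (cong (_+ Γ) (trans (∑-+ (λ v → ⟦ v == c ⟧) (λ v → ⟦ padj c v ∧ padj c′ v ⟧)) (cong (_+ common c c′) (∑-== c)))) ⟩
          1 + common c c′ + Γ ≤⟨ +-monoˡ-≤ Γ few ⟩
          e + Γ ∎
          where
          each : ∀ v → ⟦ padj c′ v ⟧ ≤ ⟦ v == c ⟧ + ⟦ padj c v ∧ padj c′ v ⟧ + ⟦ g v ⟧
          each v with padj c′ v | padj c v | v == c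
          ... | false | _ | _ = z≤n
          ... | true | _ | true = s≤s z≤n
          ... | true | true | false = s≤s z≤n
          ... | true | false | false = s≤s z≤n
        gc′ : g c′ ≡ false
        gc′ = cong (_∧ (not (padj c c′) ∧ not (c′ == c))) (padj-irrefl c′)
        gc : g c ≡ false
        gc = ¬true⇒false λ h → true≢false (≡⇒== {x = c} refl)
          (not-true (proj₂ (∧-elim {not (padj c c)} (proj₂ (∧-elim {padj c′ c} h)))))
        persist : ∀ u v → u ≢ c′ → v ≢ c′ → padj u v ≡ true → padj′ u v ≡ true
        persist u v u≢ v≢ h with padj-elim h
        ... | u≢v , x , y , rx , ry , a = padj-intro′ x y u≢v
                (trans (kept (u≢ ∘ trans (≡-sym rx))) rx) (trans (kept (v≢ ∘ trans (≡-sym ry))) ry) a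
        gain : ∀ v → v ≢ c → v ≢ c′ → padj c′ v ≡ true → padj′ c v ≡ true
        gain v v≢c v≢c′ h with padj-elim h
        ... | _ , x , y , rx , ry , a = padj-intro′ x y (v≢c ∘ ≡-sym) (moved rx) (trans (kept (v≢c′ ∘ trans (≡-sym ry))) ry) a
        at-c : ∀ v → v ≢ c → v ≢ c′ → ⟦ padj c v ⟧ + ⟦ g v ⟧ ≤ ⟦ padj′ c v ⟧
        at-c v v≢c v≢c′ with padj c v in cv | padj c′ v in c′v
        ... | true | w rewrite persist c v c≢c′ v≢c′ cv with w
        ...   | true = ≤-refl
        ...   | false = ≤-refl
        at-c v v≢c v≢c′ | false | true rewrite gain v v≢c v≢c′ c′v = ⟦⟧≤1 (not (v == c))
        at-c v v≢c v≢c′ | false | false = z≤n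
        pointwise : ∀ u v → ⟦ padj u v ⟧ + (⟦ u == c ⟧ * ⟦ g v ⟧ + ⟦ v == c ⟧ * ⟦ g u ⟧) ≤
                            ⟦ padj′ u v ⟧ + (⟦ u == c′ ⟧ * ⟦ padj c′ v ⟧ + ⟦ v == c′ ⟧ * ⟦ padj c′ u ⟧)
        pointwise u v = by-cases (u ≟ c′) (v ≟ c′) (u ≟ c) (v ≟ c)
          where
          Goal = ⟦ padj u v ⟧ + (⟦ u == c ⟧ * ⟦ g v ⟧ + ⟦ v == c ⟧ * ⟦ g u ⟧) ≤
                 ⟦ padj′ u v ⟧ + (⟦ u == c′ ⟧ * ⟦ padj c′ v ⟧ + ⟦ v == c′ ⟧ * ⟦ padj c′ u ⟧)
          by-cases : Dec (u ≡ c′) → Dec (v ≡ c′) → Dec (u ≡ c) → Dec (v ≡ c) → Goal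
          by-cases (yes refl) _ _ _ = ≤-trans
            (≤-reflexive (trans (cong (⟦ padj u v ⟧ +_) (cong₂ _+_ (⟦false⟧* ⟦ g v ⟧ (≢⇒== (c≢c′ ∘ ≡-sym)))
                                                                  (trans (cong (λ w → ⟦ v == c ⟧ * ⟦ w ⟧) gc′) (*-zeroʳ ⟦ v == c ⟧))))
                         (trans (+-identityʳ _) (≡-sym (⟦true⟧* ⟦ padj u v ⟧ (≡⇒== {x = u} refl))))))
            (≤-trans (m≤m+n _ _) (m≤n+m _ ⟦ padj′ u v ⟧))
          by-cases (no _) (yes refl) _ _ = ≤-trans
            (≤-reflexive (trans (cong (⟦ padj u v ⟧ +_) (cong₂ _+_ (trans (cong (λ w → ⟦ u == c ⟧ * ⟦ w ⟧) gc′) (*-zeroʳ ⟦ u == c ⟧))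
                                                                  (⟦false⟧* ⟦ g u ⟧ (≢⇒== (c≢c′ ∘ ≡-sym)))))
                         (trans (+-identityʳ _) (trans (cong ⟦_⟧ (padj-sym u v)) (≡-sym (⟦true⟧* ⟦ padj v u ⟧ (≡⇒== {x = v} refl)))))))
            (≤-trans (m≤n+m _ _) (m≤n+m _ ⟦ padj′ u v ⟧))
          by-cases (no _) (no _) (yes refl) (yes refl) = ≤-trans (≤-reflexive (cong₂ _+_ (cong ⟦_⟧ (padj-irrefl u)) (cong₂ _+_ no-gain no-gain))) z≤n
            where
            no-gain : ⟦ u == u ⟧ * ⟦ g u ⟧ ≡ 0
            no-gain = trans (cong (λ w → ⟦ u == u ⟧ * ⟦ w ⟧) gc) (*-zeroʳ ⟦ u == u ⟧)
          by-cases (no u≢) (no v≢) (yes refl) (no v≢c) = ≤-trans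
            (≤-reflexive (cong (⟦ padj u v ⟧ +_) (trans (cong₂ _+_ (⟦true⟧* ⟦ g v ⟧ (≡⇒== {x = u} refl)) (⟦false⟧* ⟦ g u ⟧ (≢⇒== v≢c))) (+-identityʳ _))))
            (≤-trans (at-c v v≢c v≢) (m≤m+n _ _))
          by-cases (no u≢) (no v≢) (no u≢c) (yes refl) = ≤-trans
            (≤-reflexive (cong₂ _+_ (cong ⟦_⟧ (padj-sym u v)) (cong₂ _+_ (⟦false⟧* ⟦ g v ⟧ (≢⇒== u≢c)) (⟦true⟧* ⟦ g u ⟧ (≡⇒== {x = v} refl)))))
            (≤-trans (at-c u u≢c u≢) (≤-trans (≤-reflexive (cong ⟦_⟧ (padj-sym′ v u))) (m≤m+n _ _)))
          by-cases (no u≢) (no v≢) (no u≢c) (no v≢c) = ≤-trans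
            (≤-reflexive (trans (cong (⟦ padj u v ⟧ +_) (cong₂ _+_ (⟦false⟧* ⟦ g v ⟧ (≢⇒== u≢c)) (⟦false⟧* ⟦ g u ⟧ (≢⇒== v≢c)))) (+-identityʳ _)))
            (≤-trans (⟦⟧-mono (persist u v u≢ v≢)) (m≤m+n _ _))

      small-other : ∀ {u} → u ≢ c → u ≢ c′ → small′ u ≡ small u
      small-other {u} u≢c u≢c′ = cong₂ (λ a t → a ∧ (not (big u) ∧ does (2 * t ≤? k)))
        (r′-other u≢c u≢c′ u) (count-cong (r′-other u≢c u≢c′))

      small-c′ : small′ c′ ≡ false
      small-c′ = ¬true⇒false λ h → c≢c′ (trans (≡-sym (moved (small-fixed sc′))) (small-fixed′ h))

      small-mono : ∀ u → small′ u ≡ true → small u ≡ true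
      small-mono u h = by-cases (u ≟ c) (u ≟ c′)
        where
        by-cases : Dec (u ≡ c) → Dec (u ≡ c′) → small u ≡ true
        by-cases (yes refl) _ = sc
        by-cases (no _) (yes refl) = sc′
        by-cases (no u≢c) (no u≢c′) = trans (≡-sym (small-other u≢c u≢c′)) h

      #small-merged : suc #small′ ≤ #small
      #small-merged = ≤-trans (≤-reflexive (≡-sym (count-insert c′ small′ small-c′)))
        (count-mono {q = small} λ u h → insert-elim {S = small′} h (small-mono u) λ { refl → sc′ })

      #small-merged-large : small′ c ≡ false → 2 + #small′ ≤ #small
      #small-merged-large h =
        ≤-trans (≤-reflexive (≡-sym (trans (count-insert c (insert c′ small′) c∉) (cong suc (count-insert c′ small′ small-c′)))))
        (count-mono {q = small} λ u h₁ → insert-elim {S = insert c′ small′} h₁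
          (λ h₂ → insert-elim {S = small′} h₂ (small-mono u) λ { refl → sc′ }) λ { refl → sc })
        where
        c∉ : insert c′ small′ c ≡ false
        c∉ = ¬true⇒false λ q → insert-elim {S = small′} q (λ q′ → true≢false q′ h) c≢c′

      -- Only `c` and `c′` can disappear from the small parts that `t` sees, whence the 2.
      richness-merged : ∀ t → richness t ≤ 2 + richness′ t
      richness-merged t = ≤-trans (count-mono sub)
        (≤-trans (count-insert≤ c (insert c′ rich′)) (s≤s (count-insert≤ c′ rich′)))
        where
        rich′ : V → Bool
        rich′ u = small′ u ∧ Parts.touches merged t u
        sub : ∀ u → small u ∧ touches t u ≡ true → insert c (insert c′ rich′) u ≡ true
        sub u h = by-cases (u ≟ c) (u ≟ c′)
          where
          by-cases : Dec (u ≡ c) → Dec (u ≡ c′) → insert c (insert c′ rich′) u ≡ true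
          by-cases (yes refl) _ = insert-new c (insert c′ rich′)
          by-cases (no _) (yes refl) = insert-old c (insert c′ rich′) (insert-new c′ rich′)
          by-cases (no u≢c) (no u≢c′) = insert-old c (insert c′ rich′) (insert-old c′ rich′
            (let su , tu = ∧-elim {small u} h ; y , ry , a = touches-elim tu in
             ∧-intro (trans (small-other u≢c u≢c′) su) (touches-intro′ y (trans (kept (u≢c′ ∘ trans (≡-sym ry))) ry) a)))

    -- The outcome of at most i merges into the part of t that leave the part of t′ alone and remove q small parts.
    record Absorbed (P : Partition) (t t′ : V) (i q : ℕ) : Set where
      open Parts P
      field
        P′ : Partition
      open Parts P′ using () renaming (r to r′; total to total′; small to small′; #small to #small′; richness to richness′)
      field
        total-loss : total ≤ total′ + i * (2 * e)
        fewer-small : q + #small′ ≤ #small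
        fixed-t : r′ t ≡ r t
        fixed-t′ : r′ t′ ≡ r t′
        small-t′ : small′ (r t′) ≡ small (r t′)
        richness-loss : ∀ x → richness x ≤ i * 2 + richness′ x

    Dense : Set
    Dense = DenseSubgraph G (2 * k + k * k * Δ) (e * e)

    -- The small parts seen by `t` may include its own part and that of `t′`. Neither is to be
    -- absorbed, so `e + 2` are required to keep `e` candidates for `mergeable`.
    absorb₁ : ∀ P t t′ → let open Parts P in small (r t) ≡ true → r t ≢ r t′ → e + 2 ≤ richness t →
      Dense ⊎ ((Σ (Absorbed P t t′ 1 1) λ a → Parts.small (Absorbed.P′ a) (r t) ≡ true) ⊎ Absorbed P t t′ 1 2)
    absorb₁ P t t′ st t≢t′ rich with mergeable P (Parts.r P t) W st W⊆ many
      where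
      open Parts P
      W : V → Bool
      W w = (small w ∧ touches t w) ∧ (not (w == r t) ∧ not (w == r t′))
      W⊆ : ∀ w → W w ≡ true → padj (r t) w ≡ true
      W⊆ w h with ∧-elim {small w ∧ touches t w} h
      ... | h₁ , h₂ with touches-elim {t} {w} (proj₂ (∧-elim {small w} h₁)) | ∧-elim {not (w == r t)} h₂
      ...   | y , ry , a | w≢ , _ = padj-intro t y (λ p → true≢false (≡⇒== (≡-sym p)) (not-true w≢)) refl ry a
      many : e ≤ count W
      many = +-cancelʳ-≤ 2 e (count W) (≤-trans rich (≤-trans (count-mono sub)
        (≤-trans (count-insert≤ (r t) (insert (r t′) W)) (≤-trans (s≤s (count-insert≤ (r t′) W)) (≤-reflexive (+-comm 2 (count W)))))))
        where
        sub : ∀ u → small u ∧ touches t u ≡ true → insert (r t) (insert (r t′) W) u ≡ true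
        sub u h = by-cases (u ≟ r t) (u ≟ r t′)
          where
          by-cases : Dec (u ≡ r t) → Dec (u ≡ r t′) → insert (r t) (insert (r t′) W) u ≡ true
          by-cases (yes refl) _ = insert-new (r t) (insert (r t′) W)
          by-cases (no _) (yes refl) = insert-old (r t) (insert (r t′) W) (insert-new (r t′) W)
          by-cases (no h₁) (no h₂) = insert-old (r t) (insert (r t′) W) (insert-old (r t′) W
            (∧-intro h (∧-intro (cong not (≢⇒== h₁)) (cong not (≢⇒== h₂)))))
    ... | inj₁ dense = inj₁ dense
    ... | inj₂ (w , Ww , few) = inj₂ (by-size (Parts.small merged (r t)) refl)
      where
      open Parts P
      sw,tw : small w ≡ true × touches t w ≡ true
      sw,tw = ∧-elim {small w} (proj₁ (∧-elim {small w ∧ touches t w} Ww))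
      w≢ : not (w == r t) ≡ true × not (w == r t′) ≡ true
      w≢ = ∧-elim {not (w == r t)} (proj₂ (∧-elim {small w ∧ touches t w} Ww))
      w≢t : r t ≢ w
      w≢t p = true≢false (≡⇒== (≡-sym p)) (not-true (proj₁ w≢))
      w≢t′ : r t′ ≢ w
      w≢t′ p = true≢false (≡⇒== (≡-sym p)) (not-true (proj₂ w≢))
      adjacent : padj (r t) w ≡ true
      adjacent = let y , ry , a = touches-elim {t} {w} (proj₂ sw,tw) in padj-intro t y w≢t refl ry a
      open Merge P (r t) w st (proj₁ sw,tw) adjacent few
      absorbed : ∀ q → q + Parts.#small merged ≤ #small → Absorbed P t t′ 1 q
      absorbed q fewer = record
        { P′ = merged
        ; total-loss = ≤-trans total-merged (≤-reflexive (cong (Parts.total merged +_) (≡-sym (*-identityˡ (2 * e)))))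
        ; fewer-small = fewer
        ; fixed-t = kept w≢t
        ; fixed-t′ = kept w≢t′
        ; small-t′ = small-other (t≢t′ ∘ ≡-sym) w≢t′
        ; richness-loss = richness-merged }
      by-size : ∀ b → Parts.small merged (r t) ≡ b →
                (Σ (Absorbed P t t′ 1 1) λ a → Parts.small (Absorbed.P′ a) (r t) ≡ true) ⊎ Absorbed P t t′ 1 2
      by-size true h = inj₁ (absorbed 1 #small-merged , h)
      by-size false h = inj₂ (absorbed 2 (#small-merged-large h))

    -- Two small parts disappear in any case: at once if the first merge makes the part of `t`
    -- large, otherwise by a second merge. The requirement rises by 2 because the first merge may
    -- cost that much richness.
    absorb₂ : ∀ P t t′ → let open Parts P in small (r t) ≡ true → r t ≢ r t′ → e + 4 ≤ richness t →
      Dense ⊎ Absorbed P t t′ 2 2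
    absorb₂ P t t′ st t≢t′ rich with absorb₁ P t t′ st t≢t′ (≤-trans (+-monoʳ-≤ e (s≤s (s≤s z≤n))) rich)
    ... | inj₁ dense = inj₁ dense
    ... | inj₂ (inj₂ a) = inj₂ record
        { P′ = P′ ; fewer-small = fewer-small ; fixed-t = fixed-t ; fixed-t′ = fixed-t′ ; small-t′ = small-t′
        ; total-loss = ≤-trans total-loss (+-monoʳ-≤ (Parts.total P′) (*-monoˡ-≤ (2 * e) {1} {2} (s≤s z≤n)))
        ; richness-loss = λ x → ≤-trans (richness-loss x) (+-monoˡ-≤ (Parts.richness P′ x) (s≤s (s≤s z≤n))) }
      where open Absorbed a
    ... | inj₂ (inj₁ (a , st₁)) = again
      where
      open Absorbed a
      open Parts P′ using () renaming (r to r₁; small to small₁; total to total₁; richness to richness₁; #small to #small₁)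
      again : Dense ⊎ Absorbed P t t′ 2 2
      again with absorb₁ P′ t t′ (trans (cong small₁ fixed-t) st₁)
                   (λ h → t≢t′ (trans (≡-sym fixed-t) (trans h fixed-t′)))
                   (+-cancelˡ-≤ 2 (e + 2) (richness₁ t) (≤-trans (≤-reflexive (rearr e)) (≤-trans rich (richness-loss t))))
        where
        rearr : ∀ e → 2 + (e + 2) ≡ e + 4
        rearr = solve-∀
      ... | inj₁ dense = inj₁ dense
      ... | inj₂ more = inj₂ (compose (weaken more))
        where
        weaken : (Σ (Absorbed P′ t t′ 1 1) λ a → Parts.small (Absorbed.P′ a) (r₁ t) ≡ true) ⊎ Absorbed P′ t t′ 1 2 →
                 Absorbed P′ t t′ 1 1
        weaken (inj₁ (b , _)) = b
        weaken (inj₂ b) = record { Absorbed b ; fewer-small = ≤-trans (n≤1+n _) (Absorbed.fewer-small b) }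
        compose : Absorbed P′ t t′ 1 1 → Absorbed P t t′ 2 2
        compose b = record
          { P′ = B.P′
          ; total-loss = ≤-trans total-loss (≤-trans (+-monoˡ-≤ (1 * (2 * e)) B.total-loss) (≤-reflexive (rearr (Parts.total B.P′) (2 * e))))
          ; fewer-small = ≤-trans (s≤s B.fewer-small) fewer-small
          ; fixed-t = trans B.fixed-t fixed-t
          ; fixed-t′ = trans B.fixed-t′ fixed-t′
          ; small-t′ = trans (cong (Parts.small B.P′) (≡-sym fixed-t′)) (trans B.small-t′ (trans (cong small₁ fixed-t′) small-t′))
          ; richness-loss = λ x → ≤-trans (richness-loss x) (+-monoʳ-≤ 2 (B.richness-loss x)) }
          where
          module B = Absorbed b
          rearr : ∀ t w → t + 1 * w + 1 * w ≡ t + 2 * w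
          rearr = solve-∀

    -- Splitting a large part between two of its vertices

    module SplitPart (P : Partition) (t₁ t₂ : V) (t₁≢t₂ : t₁ ≢ t₂) (same : Partition.r P t₁ ≡ Partition.r P t₂)
                     (large : Parts.small P (Partition.r P t₁) ≡ false) where
      open Parts P

      c : V
      c = r t₁

      in-c : V → Bool
      in-c x = r x == c

      halves : Split G in-c t₁ t₂
      halves = split G in-c t₁ t₂ (≡⇒== {x = c} refl) t₁≢t₂ λ x h →
        walk-trans (to-c x (==⇒≡ h)) (walk-rev (to-c t₂ (≡-sym same)))
        where
        to-c : ∀ x → r x ≡ c → WalkIn G (λ z → in-c z ≡ true) x c
        to-c x h = subst (WalkIn G _ x) h (walk-map (λ q → ≡⇒== (trans q h)) (conn x))
      open Split halves

      -- The halves are labelled by `t₁` and `t₂` rather than by the old label `c`, which may lie in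
      -- either half.
      r′ : V → V
      r′ x = if r x == c then (if S x then t₁ else t₂) else r x

      on-S : ∀ {x} → S x ≡ true → r′ x ≡ t₁
      on-S {x} h rewrite S⊆P x h | h = refl

      off-S : ∀ {x} → r x ≡ c → S x ≡ false → r′ x ≡ t₂
      off-S h h′ rewrite ≡⇒== h | h′ = refl

      kept : ∀ {x} → r x ≢ c → r′ x ≡ r x
      kept h rewrite ≢⇒== h = refl

      S⊆c : ∀ {x} → S x ≡ true → r x ≡ c
      S⊆c h = ==⇒≡ (S⊆P _ h)

      by-side : ∀ x {C : Set} → (S x ≡ true → C) → (r x ≡ c → S x ≡ false → C) → (r x ≢ c → C) → C
      by-side x {C} f g h = choose (S x) refl (r x ≟ c)
        where
        choose : ∀ b → S x ≡ b → Dec (r x ≡ c) → C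
        choose true Sx _ = f Sx
        choose false Sx (yes q) = g q Sx
        choose false Sx (no q) = h q

      r′-t₁ : r′ t₁ ≡ t₁
      r′-t₁ = on-S t₁∈S

      r′-t₂ : r′ t₂ ≡ t₂
      r′-t₂ = off-S (≡-sym same) t₂∉S

      r-r′ : ∀ x → r (r′ x) ≡ r x
      r-r′ x = by-side x
        (λ h → trans (cong r (on-S h)) (≡-sym (S⊆c h)))
        (λ h h′ → trans (cong r (off-S h h′)) (trans (≡-sym same) (≡-sym h)))
        (λ h → trans (cong r (kept h)) (idem x))

      refines : ∀ {x y} → r′ x ≡ r′ y → r x ≡ r y
      refines {x} {y} h = trans (≡-sym (r-r′ x)) (trans (cong r h) (r-r′ y))

      parted : Partition
      parted = record
        { r = r′
        ; idem = λ x → by-side x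
            (λ h → trans (cong r′ (on-S h)) (trans r′-t₁ (≡-sym (on-S h))))
            (λ h h′ → trans (cong r′ (off-S h h′)) (trans r′-t₂ (≡-sym (off-S h h′))))
            (λ h → trans (cong r′ (kept h)) (trans (kept (h ∘ trans (≡-sym (idem x)))) (trans (idem x) (≡-sym (kept h)))))
        ; conn = λ x → by-side x
            (λ h → relabel x (on-S h) (walk-map on-S (walk₁ x h)))
            (λ h h′ → relabel x (off-S h h′) (walk-map (λ q → off-S (==⇒≡ (proj₁ q)) (proj₂ q)) (walk₂ x (≡⇒== h) h′)))
            (λ h → relabel x (kept h) (walk-map (λ q → trans (kept (h ∘ trans (≡-sym q))) q) (conn x)))
        ; size≤k = λ u → ≤-trans
            (count-mono {q = λ y → r y == r u} λ y h → ≡⇒== (trans (≡-sym (r-r′ y)) (cong r (==⇒≡ h)))) (size≤k (r u))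
        ; big-alone = λ x y bx h → big-alone x y bx (refines h) }
        where
        relabel : ∀ x {w} → r′ x ≡ w → WalkIn G (λ z → r′ z ≡ w) x w → WalkIn G (λ z → r′ z ≡ r′ x) x (r′ x)
        relabel x refl w = w

      open Parts parted using () renaming (padj to padj′; padj-intro to padj-intro′; total to total′;
        small to small′; #small to #small′; richness to richness′; size to size′; touches-intro to touches-intro′;
        small-fixed to small-fixed′; small-intro to small-intro′; touches to touches′)

      -- Splitting loses no edges: an edge between two old parts also joins two new ones, and `r`
      -- sends the new labels back to the old, so different old pairs come from different new pairs.
      total-parted : total ≤ total′
      total-parted = begin
        ∑ (λ u → ∑ (λ v → ⟦ padj u v ⟧))
          ≤⟨ ∑-mono (λ u → ∑-mono λ v → ⟦⟧≤ (refine u v)) ⟩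
        ∑ (λ u → ∑ (λ v → ∑ (λ a → ⟦ r a == u ⟧ * ∑ (λ b → ⟦ r b == v ⟧ * ⟦ padj′ a b ⟧))))
          ≡⟨ ∑-cong (λ u → trans (∑-swap (λ v a → ⟦ r a == u ⟧ * ∑ (λ b → ⟦ r b == v ⟧ * ⟦ padj′ a b ⟧)))
               (∑-cong λ a → trans (∑-*ˡ ⟦ r a == u ⟧ (λ v → ∑ (λ b → ⟦ r b == v ⟧ * ⟦ padj′ a b ⟧)))
                 (cong (⟦ r a == u ⟧ *_) (∑-fibre r (λ _ b → ⟦ padj′ a b ⟧))))) ⟩
        ∑ (λ u → ∑ (λ a → ⟦ r a == u ⟧ * ∑ (λ b → ⟦ padj′ a b ⟧)))
          ≡⟨ ∑-fibre r (λ _ a → ∑ (λ b → ⟦ padj′ a b ⟧)) ⟩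
        total′ ∎
        where
        open ≤-Reasoning
        refine : ∀ u v → padj u v ≡ true → 1 ≤ ∑ (λ a → ⟦ r a == u ⟧ * ∑ (λ b → ⟦ r b == v ⟧ * ⟦ padj′ a b ⟧))
        refine u v h with padj-elim h
        ... | u≢v , x , y , rx , ry , a = ≤-trans
          (≤⟦⟧* (≡⇒== (trans (r-r′ x) rx)) (≤-trans
            (≤⟦⟧* (≡⇒== (trans (r-r′ y) ry)) (≤-reflexive (≡-sym (cong ⟦_⟧ (padj-intro′ x y
              (λ q → u≢v (trans (≡-sym rx) (trans (refines {x} {y} q) ry))) refl refl a)))))
            (term≤∑ (λ b → ⟦ r b == v ⟧ * ⟦ padj′ (r′ x) b ⟧) (r′ y))))
          (term≤∑ (λ a → ⟦ r a == u ⟧ * ∑ (λ b → ⟦ r b == v ⟧ * ⟦ padj′ a b ⟧)) (r′ x))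

      small-elsewhere : ∀ {u} → r u ≢ c → small′ u ≡ small u
      small-elsewhere {u} h = by-fixed (r u ≟ u)
        where
        r′u : r′ u ≡ r u
        r′u = kept h
        by-fixed : Dec (r u ≡ u) → small′ u ≡ small u
        by-fixed (yes ru) = cong₂ (λ a t → (a == u) ∧ (not (big u) ∧ does (2 * t ≤? k))) r′u (count-cong same-label)
          where
          same-label : ∀ y → (r′ y == u) ≡ (r y == u)
          same-label y = by-side y
            (λ q → trans (≢⇒== (λ p → h (trans (cong r (≡-sym p)) (trans (r-r′ y) (S⊆c q)))))
                         (≡-sym (≢⇒== λ p → h (trans ru (trans (≡-sym p) (S⊆c q))))))
            (λ q _ → trans (≢⇒== (λ p → h (trans (cong r (≡-sym p)) (trans (r-r′ y) q))))
                           (≡-sym (≢⇒== λ p → h (trans ru (trans (≡-sym p) q)))))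
            (λ q → cong (_== u) (kept q))
        by-fixed (no ru) = trans (¬true⇒false λ q → ru (trans (≡-sym r′u) (small-fixed′ q))) (≡-sym (¬true⇒false λ q → ru (small-fixed q)))

      small-c : ∀ {u} → small u ≡ true → r u ≢ c
      small-c su h = true≢false su (trans (cong small (trans (≡-sym (small-fixed su)) h)) large)

      #small-parted : #small′ ≤ #small + (⟦ small′ t₁ ⟧ + ⟦ small′ t₂ ⟧)
      #small-parted = begin
        #small′ ≡⟨ count≡∑ small′ ⟩
        ∑ (λ u → ⟦ small′ u ⟧) ≤⟨ ∑-mono pointwise ⟩
        ∑ (λ u → ⟦ small u ⟧ + (⟦ u == t₁ ⟧ * ⟦ small′ u ⟧ + ⟦ u == t₂ ⟧ * ⟦ small′ u ⟧))
          ≡⟨ trans (∑-+ (λ u → ⟦ small u ⟧) (λ u → ⟦ u == t₁ ⟧ * ⟦ small′ u ⟧ + ⟦ u == t₂ ⟧ * ⟦ small′ u ⟧))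
               (cong₂ _+_ (≡-sym (count≡∑ small)) (trans (∑-+ (λ u → ⟦ u == t₁ ⟧ * ⟦ small′ u ⟧) (λ u → ⟦ u == t₂ ⟧ * ⟦ small′ u ⟧))
                 (cong₂ _+_ (∑-point′ t₁ (λ u → ⟦ small′ u ⟧)) (∑-point′ t₂ (λ u → ⟦ small′ u ⟧))))) ⟩
        #small + (⟦ small′ t₁ ⟧ + ⟦ small′ t₂ ⟧) ∎
        where
        open ≤-Reasoning
        pointwise : ∀ u → ⟦ small′ u ⟧ ≤ ⟦ small u ⟧ + (⟦ u == t₁ ⟧ * ⟦ small′ u ⟧ + ⟦ u == t₂ ⟧ * ⟦ small′ u ⟧)
        pointwise u = ⟦⟧≤ λ su → by-side u
          (λ q → ≤-trans (≤⟦⟧* (≡⇒== (trans (≡-sym (small-fixed′ su)) (on-S q))) (≤-reflexive (≡-sym (cong ⟦_⟧ su))))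
                   (≤-trans (m≤m+n _ _) (m≤n+m _ ⟦ small u ⟧)))
          (λ q q′ → ≤-trans (≤⟦⟧* (≡⇒== (trans (≡-sym (small-fixed′ su)) (off-S q q′))) (≤-reflexive (≡-sym (cong ⟦_⟧ su))))
                   (≤-trans (m≤n+m _ _) (m≤n+m _ ⟦ small u ⟧)))
          (λ q → ≤-trans (≤-reflexive (≡-sym (cong ⟦_⟧ (trans (≡-sym (small-elsewhere q)) su)))) (m≤m+n _ _))

      -- Two halves with more than `k/2` vertices each would not fit into a part of at most `k`.
      -- Neither `t₁` nor `t₂` is big, since they share a part, so size alone decides.
      not-both-large : small′ t₁ ≡ false → small′ t₂ ≡ true
      not-both-large l₁ = decide (small′ t₂) refl
        where
        open ≤-Reasoning
        no-big : ∀ {a b} → a ≢ b → r a ≡ r b → big a ≡ false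
        no-big a≢b h = ¬true⇒false λ ba → a≢b (≡-sym (big-alone _ _ ba (≡-sym h)))
        exceeds : ∀ {t} → r′ t ≡ t → big t ≡ false → small′ t ≡ false → k < 2 * size′ t
        exceeds rt bt lt = ≰⇒> λ h → true≢false (small-intro′ rt bt h) lt
        sizes : size′ t₁ + size′ t₂ ≤ size c
        sizes = begin
          size′ t₁ + size′ t₂ ≡⟨ cong₂ _+_ (count≡∑ (λ y → r′ y == t₁)) (count≡∑ (λ y → r′ y == t₂)) ⟩
          ∑ (λ y → ⟦ r′ y == t₁ ⟧) + ∑ (λ y → ⟦ r′ y == t₂ ⟧) ≡⟨ ≡-sym (∑-+ (λ y → ⟦ r′ y == t₁ ⟧) (λ y → ⟦ r′ y == t₂ ⟧)) ⟩
          ∑ (λ y → ⟦ r′ y == t₁ ⟧ + ⟦ r′ y == t₂ ⟧) ≤⟨ ∑-mono pointwise ⟩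
          ∑ (λ y → ⟦ r y == c ⟧) ≡⟨ ≡-sym (count≡∑ (λ y → r y == c)) ⟩
          size c ∎
          where
          pointwise : ∀ y → ⟦ r′ y == t₁ ⟧ + ⟦ r′ y == t₂ ⟧ ≤ ⟦ r y == c ⟧
          pointwise y = by-label (r′ y ≟ t₁) (r′ y ≟ t₂)
            where
            by-label : Dec (r′ y ≡ t₁) → Dec (r′ y ≡ t₂) → ⟦ r′ y == t₁ ⟧ + ⟦ r′ y == t₂ ⟧ ≤ ⟦ r y == c ⟧
            by-label (yes p) _ rewrite ≡⇒== p | ≢⇒== (t₁≢t₂ ∘ trans (≡-sym p)) =
              ≤-reflexive (≡-sym (cong ⟦_⟧ (≡⇒== (trans (≡-sym (r-r′ y)) (cong r p)))))
            by-label (no p) (yes q) rewrite ≢⇒== p | ≡⇒== q =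
              ≤-reflexive (≡-sym (cong ⟦_⟧ (≡⇒== (trans (≡-sym (r-r′ y)) (trans (cong r q) (≡-sym same))))))
            by-label (no p) (no q) rewrite ≢⇒== p | ≢⇒== q = z≤n
        decide : ∀ b → small′ t₂ ≡ b → small′ t₂ ≡ true
        decide true h = h
        decide false l₂ = ⊥-elim (<-irrefl refl (begin-strict
          2 * k ≡⟨ cong (k +_) (+-identityʳ k) ⟩
          k + k <⟨ +-mono-< (exceeds r′-t₁ (no-big t₁≢t₂ same) l₁) (exceeds r′-t₂ (no-big (t₁≢t₂ ∘ ≡-sym) (≡-sym same)) l₂) ⟩
          2 * size′ t₁ + 2 * size′ t₂ ≡⟨ ≡-sym (*-distribˡ-+ 2 (size′ t₁) (size′ t₂)) ⟩
          2 * (size′ t₁ + size′ t₂) ≤⟨ *-monoʳ-≤ 2 (≤-trans sizes (size≤k c)) ⟩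
          2 * k ∎))

      richness-parted : ∀ t → richness t ≤ richness′ t
      richness-parted t = count-mono {q = λ u → small′ u ∧ touches′ t u} λ u h →
        let su , tu = ∧-elim {small u} h
            y , ry , a = touches-elim tu
            u∉c = small-c su
        in ∧-intro (trans (small-elsewhere u∉c) su)
             (touches-intro′ y (trans (kept (λ q → u∉c (trans (small-fixed su) (trans (≡-sym ry) q)))) ry) a)

  -- Stuck partitions

  module Trichotomy (G : Graph) (k e Δ : ℕ) (1≤e : 1 ≤ e) (2≤k : 2 ≤ k) where

    open Contraction G k e Δ

    private
      V = Fin (n G)

    -- The rate `4 * e` per vanished small part is dictated by `separate`, where two merges, each
    -- costing `2 * e` ordered pairs, are needed for a net decrease of one. A plain merge costs only
    -- half of this.
    record Better (P : Partition) : Set where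
      open Parts P
      field
        P′ : Partition
        j : ℕ
        1≤j : 1 ≤ j
        loss : total ≤ Parts.total P′ + j * (4 * e)
        fewer : j + Parts.#small P′ ≤ #small

    -- Each of the at most four merges in `separate` costs a vertex at most two of its small neighbouring parts.
    rich : (P : Partition) → V → Bool
    rich P t = does (e + 8 ≤? Parts.richness P t)

    -- Every small half adds one small part and then absorbs until two vanish, a net decrease of one
    -- per small half. If both are small, `t₁` goes first; its merges leave the half of `t₂`
    -- untouched, so that half is still small when its turn comes.
    separate : ∀ P t₁ t₂ → let open Parts P in
      t₁ ≢ t₂ → r t₁ ≡ r t₂ → small (r t₁) ≡ false → rich P t₁ ≡ true → rich P t₂ ≡ true → Dense ⊎ Better P
    separate P t₁ t₂ t₁≢t₂ same large rich₁ rich₂ = by-size (Parts.small parted t₁) refl (Parts.small parted t₂) refl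
      where
      open Parts P
      open SplitPart P t₁ t₂ t₁≢t₂ same large
      open Parts parted using () renaming (r to r₁; small to small₁; #small to #small₁; total to total₁; richness to richness₁)
      enough : ∀ {t} → rich P t ≡ true → e + 8 ≤ richness₁ t
      enough {t} h = ≤-trans (does-true (e + 8 ≤? richness t) h) (richness-parted t)
      apart : r₁ t₁ ≢ r₁ t₂
      apart h = t₁≢t₂ (trans (≡-sym r′-t₁) (trans h r′-t₂))
      e+4≤ : e + 4 ≤ e + 8
      e+4≤ = +-monoʳ-≤ e (s≤s (s≤s (s≤s (s≤s z≤n))))
      double : ∀ i e → i * 2 * (2 * e) ≡ i * (4 * e)
      double = solve-∀
      one-side : ∀ {t t′} → Absorbed parted t t′ 2 2 → #small₁ ≤ #small + 1 → Better P
      one-side a s₁ = record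
        { P′ = A.P′ ; j = 1 ; 1≤j = ≤-refl
        ; loss = ≤-trans total-parted (≤-trans A.total-loss (≤-reflexive (cong (Parts.total A.P′ +_) (double 1 e))))
        ; fewer = +-cancelʳ-≤ 1 _ _ (≤-trans (≤-reflexive (+-comm _ 1)) (≤-trans A.fewer-small s₁)) }
        where module A = Absorbed a
      both-sides : Absorbed parted t₁ t₂ 2 2 → small₁ t₂ ≡ true → Dense ⊎ Better P
      both-sides a s₂ = map₂ combine (absorb₂ A.P′ t₂ t₁
          (trans (cong (Parts.small A.P′) A.fixed-t′) (trans A.small-t′ (trans (cong small₁ r′-t₂) s₂)))
          (λ h → apart (trans (≡-sym A.fixed-t) (trans (≡-sym h) A.fixed-t′)))
          (+-cancelˡ-≤ 4 (e + 4) (Parts.richness A.P′ t₂) (≤-trans (≤-reflexive (rearr e)) (≤-trans (enough rich₂) (A.richness-loss t₂)))))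
        where
        module A = Absorbed a
        rearr : ∀ e → 4 + (e + 4) ≡ e + 8
        rearr = solve-∀
        losses : ∀ t e → t + 2 * (2 * e) + 2 * (2 * e) ≡ t + 2 * (4 * e)
        losses = solve-∀
        combine : Absorbed A.P′ t₂ t₁ 2 2 → Better P
        combine b = record
          { P′ = B.P′ ; j = 2 ; 1≤j = s≤s z≤n
          ; loss = ≤-trans total-parted (≤-trans A.total-loss (≤-trans (+-monoˡ-≤ (2 * (2 * e)) B.total-loss)
                     (≤-reflexive (losses (Parts.total B.P′) e))))
          ; fewer = +-cancelˡ-≤ 2 (2 + Parts.#small B.P′) #small (≤-trans (s≤s (s≤s B.fewer-small)) (≤-trans A.fewer-small
                      (≤-trans #small-parted (≤-trans (+-monoʳ-≤ #small (+-mono-≤ (⟦⟧≤1 (small₁ t₁)) (⟦⟧≤1 (small₁ t₂))))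
                        (≤-reflexive (+-comm #small 2)))))) }
          where module B = Absorbed b
      by-size : ∀ b₁ → small₁ t₁ ≡ b₁ → ∀ b₂ → small₁ t₂ ≡ b₂ → Dense ⊎ Better P
      by-size false s₁ _ _ = map₂
        (λ a → one-side a (≤-trans #small-parted (+-monoʳ-≤ #small
          (≤-trans (≤-reflexive (cong (λ b → ⟦ b ⟧ + ⟦ small₁ t₂ ⟧) s₁)) (⟦⟧≤1 (small₁ t₂))))))
        (absorb₂ parted t₂ t₁ (trans (cong small₁ r′-t₂) (not-both-large s₁)) (apart ∘ ≡-sym) (≤-trans e+4≤ (enough rich₂)))
      by-size true s₁ b₂ s₂ = [ inj₁ , first b₂ s₂ ]′
        (absorb₂ parted t₁ t₂ (trans (cong small₁ r′-t₁) s₁) apart (≤-trans e+4≤ (enough rich₁)))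
        where
        first : ∀ b₂ → small₁ t₂ ≡ b₂ → Absorbed parted t₁ t₂ 2 2 → Dense ⊎ Better P
        first true s₂ a = both-sides a s₂
        first false s₂ a = inj₂ (one-side a (≤-trans #small-parted
          (≤-reflexive (cong (#small +_) (cong₂ _+_ (cong ⟦_⟧ s₁) (cong ⟦_⟧ s₂))))))

    record Stuck (P : Partition) : Set where
      open Parts P
      field
        few-small : ∀ c → small c ≡ true → count (λ w → small w ∧ padj c w) < e
        one-rich : ∀ t₁ t₂ → r t₁ ≡ r t₂ → small (r t₁) ≡ false → rich P t₁ ≡ true → rich P t₂ ≡ true → t₁ ≡ t₂

    improve : ∀ P → Dense ⊎ (Better P ⊎ Stuck P)
    improve P = by-merge (any? λ c → (small c ≟ᵇ true) ×-dec (e ≤? count (near c)))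
      where
      open Parts P
      near : V → V → Bool
      near c w = small w ∧ padj c w
      Mergeable : Set
      Mergeable = ∃[ c ] (small c ≡ true × e ≤ count (near c))
      Separable : Set
      Separable = ∃[ t₁ ] ∃[ t₂ ] (t₁ ≢ t₂ × r t₁ ≡ r t₂ × small (r t₁) ≡ false × rich P t₁ ≡ true × rich P t₂ ≡ true)
      merge : ∀ c → small c ≡ true → ∃[ w ] (near c w ≡ true × common c w < e) → Better P
      merge c sc (w , h , few) = record
        { P′ = M.merged ; j = 1 ; 1≤j = ≤-refl
        ; loss = ≤-trans M.total-merged (+-monoʳ-≤ (Parts.total M.merged)
            (≤-trans (*-monoˡ-≤ e {2} {4} (s≤s (s≤s z≤n))) (≤-reflexive (≡-sym (*-identityˡ (4 * e))))))
        ; fewer = M.#small-merged }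
        where
        module M = Merge P c w sc (proj₁ (∧-elim {small w} h)) (proj₂ (∧-elim {small w} h)) few
      by-separation : ¬ Mergeable → Dec Separable → Dense ⊎ (Better P ⊎ Stuck P)
      by-separation _ (yes (t₁ , t₂ , t₁≢t₂ , same , large , rich₁ , rich₂)) =
        map₂ inj₁ (separate P t₁ t₂ t₁≢t₂ same large rich₁ rich₂)
      by-separation none (no none′) = inj₂ (inj₂ record
        { few-small = λ c sc → ≰⇒> λ h → none (c , sc , h)
        ; one-rich = λ t₁ t₂ same large rich₁ rich₂ → decidable-stable (t₁ ≟ t₂)
            λ h → none′ (t₁ , t₂ , h , same , large , rich₁ , rich₂) })
      by-merge : Dec Mergeable → Dense ⊎ (Better P ⊎ Stuck P)
      by-merge (yes (c , sc , many)) =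
        map₂ (inj₁ ∘ merge c sc) (mergeable P c (near c) sc (λ w h → proj₂ (∧-elim {small w} h)) many)
      by-merge (no none) = by-separation none (any? λ t₁ → any? λ t₂ → ¬? (t₁ ≟ t₂) ×-dec ((r t₁ ≟ r t₂) ×-dec
        ((small (r t₁) ≟ᵇ false) ×-dec ((rich P t₁ ≟ᵇ true) ×-dec (rich P t₂ ≟ᵇ true)))))

    -- The number of small parts is at most `n G` for singletons and falls in each round, so it
    -- bounds both the number of rounds and the total loss.
    stuck-partition : Dense ⊎ (∃[ P ] Stuck P × degSum G ≤ Parts.total P + n G * (4 * e))
    stuck-partition = go (suc (n G)) P₀ 0 (s≤s (count≤ (Parts.small P₀))) (count≤ (Parts.small P₀))
        (≤-trans start (≤-reflexive (≡-sym (+-identityʳ _))))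
      where
      P₀ = discrete (≤-trans (s≤s z≤n) 2≤k)
      start : degSum G ≤ Parts.total P₀
      start = ∑-mono λ x → ∑-mono λ y → ⟦⟧-mono λ a →
        Parts.padj-intro P₀ x y (λ p → true≢false a (trans (cong (adj G x) (≡-sym p)) (irrefl G x))) refl refl a
      go : ∀ fuel P a → Parts.#small P < fuel → a + Parts.#small P ≤ n G → degSum G ≤ Parts.total P + a * (4 * e) →
           Dense ⊎ (∃[ P ] Stuck P × degSum G ≤ Parts.total P + n G * (4 * e))
      go (suc fuel) P a (s≤s bound) spent loss with improve P
      ... | inj₁ dense = inj₁ dense
      ... | inj₂ (inj₂ stuck) = inj₂ (P , stuck , ≤-trans loss (+-monoʳ-≤ (Parts.total P)
              (*-monoˡ-≤ (4 * e) (≤-trans (m≤m+n a _) spent))))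
      ... | inj₂ (inj₁ better) = go fuel B.P′ (a + B.j)
              (≤-trans (≤-trans (+-monoˡ-≤ _ B.1≤j) B.fewer) bound)
              (≤-trans (≤-reflexive (+-assoc a B.j _)) (≤-trans (+-monoʳ-≤ a B.fewer) spent))
              (≤-trans loss (≤-trans (+-monoˡ-≤ (a * (4 * e)) B.loss) (≤-reflexive (rearr (Parts.total B.P′) B.j a (4 * e)))))
        where
        module B = Better better
        rearr : ∀ t j a w → t + j * w + a * w ≡ t + (a + j) * w
        rearr = solve-∀

    -- Reading off the outcome from a stuck partition

    module Conclusion (P : Partition) (stuck : Stuck P) (ℓ δ : ℕ) (2≤ℓ : 2 ≤ ℓ)
                      (min-degree : ∀ v → δ ≤ deg G v) (few-big : count big * k ≤ n G) where

      open Parts P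
      open Stuck stuck
      open ≤-Reasoning

      isRep : V → Bool
      isRep c = r c == c

      contracted : Graph
      contracted = quotient isRep

      contracted-model : contracted ≼[ k ] G
      contracted-model = quotient-model k isRep (λ u h → ==⇒≡ h) (λ x _ → conn x) (λ u _ → size≤k u)

      contracted-nonempty : 1 ≤ n G → 1 ≤ n contracted
      contracted-nonempty 1≤n = pos-count isRep (r x) (≡⇒== (idem x))
        where
        x : V
        x = fromℕ< 1≤n

      contracted-degSum : total ≤ degSum contracted
      contracted-degSum = ≤-trans (∑-mono λ u → ∑-mono λ v → ⟦⟧-mono (both u v))
          (≤-reflexive (≡-sym (degSum-restrict isRep padj padj-sym padj-irrefl)))
        where
        both : ∀ u v → padj u v ≡ true → isRep u ∧ (isRep v ∧ padj u v) ≡ true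
        both u v h with padj-elim h
        ... | _ , x , y , rx , ry , _ = ∧-intro (≡⇒== (label x rx)) (∧-intro (≡⇒== (label y ry)) h)
          where
          label : ∀ x {w} → r x ≡ w → r w ≡ w
          label x refl = idem x

      large : V → Bool
      large c = isRep c ∧ (not (big c) ∧ not (small c))

      -- B holds the big vertices and the unique rich vertex of each large part; A holds one vertex of each
      -- small part, provided that it has few neighbours among the other vertices of large parts.
      B : V → Bool
      B x = big x ∨ (not (small (r x)) ∧ rich P x)

      stray : V → V → Bool
      stray c t = adj G c t ∧ (not (B t) ∧ not (small (r t)))

      w : V → ℕ
      w c = ∑ (λ t → ⟦ stray c t ⟧)

      -- The threshold `3ke/2`, together with the at most `ke/2` neighbours found in `near-small`,
      -- adds up to the loss `2 * k * e` in `degree-to-B`.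
      good : V → Bool
      good c = does (2 * w c <? 3 * k * e)

      A : V → Bool
      A c = small c ∧ good c

      reps≤ : count isRep ≤ #small + count large + count big
      reps≤ = begin
        count isRep ≡⟨ count≡∑ isRep ⟩
        ∑ (λ c → ⟦ isRep c ⟧) ≤⟨ ∑-mono pointwise ⟩
        ∑ (λ c → ⟦ small c ⟧ + ⟦ large c ⟧ + ⟦ big c ⟧)
          ≡⟨ trans (∑-+ (λ c → ⟦ small c ⟧ + ⟦ large c ⟧) (λ c → ⟦ big c ⟧))
               (cong₂ _+_ (∑-+ (λ c → ⟦ small c ⟧) (λ c → ⟦ large c ⟧)) refl) ⟩
        ∑ (λ c → ⟦ small c ⟧) + ∑ (λ c → ⟦ large c ⟧) + ∑ (λ c → ⟦ big c ⟧)
          ≡⟨ ≡-sym (cong₂ _+_ (cong₂ _+_ (count≡∑ small) (count≡∑ large)) (count≡∑ big)) ⟩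
        #small + count large + count big ∎
        where
        pointwise : ∀ c → ⟦ isRep c ⟧ ≤ ⟦ small c ⟧ + ⟦ large c ⟧ + ⟦ big c ⟧
        pointwise c = go (isRep c) (small c) (big c)
          where
          go : ∀ i s b → ⟦ i ⟧ ≤ ⟦ s ⟧ + ⟦ i ∧ (not b ∧ not s) ⟧ + ⟦ b ⟧
          go false _ _ = z≤n
          go true true _ = s≤s z≤n
          go true false true = s≤s z≤n
          go true false false = s≤s z≤n

      large-exceeds : ∀ c → large c ≡ true → k < 2 * size c
      large-exceeds c h = ≰⇒> λ s → let rc , h′ = ∧-elim {isRep c} h ; bc , sc = ∧-elim {not (big c)} h′ in
        true≢false (small-intro (==⇒≡ rc) (not-true bc) s) (not-true sc)

      ∑size : ∑ size ≡ n G
      ∑size = trans (∑-cong λ c → trans (count≡∑ (λ y → r y == c)) (∑-cong λ y → ≡-sym (*-identityʳ ⟦ r y == c ⟧)))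
        (trans (∑-fibre r (λ _ _ → 1)) (trans (∑-const (n G) 1) (*-identityʳ (n G))))

      few-large : count large * k ≤ 2 * n G
      few-large = begin
        count large * k ≡⟨ count-* large k ⟩
        ∑ (λ c → ⟦ large c ⟧ * k) ≤⟨ ∑-mono (λ c → ⟦⟧*≤ {large c} λ h → <⇒≤ (large-exceeds c h)) ⟩
        ∑ (λ c → 2 * size c) ≡⟨ trans (∑-*ˡ 2 size) (cong (2 *_) ∑size) ⟩
        2 * n G ∎

      -- Apart from the big vertices, members of `B` are rich vertices of large parts, and
      -- `one-rich` allows one in each.
      B≤ : count B ≤ count big + count large
      B≤ = begin
        count B ≡⟨ count≡∑ B ⟩
        ∑ (λ x → ⟦ B x ⟧) ≤⟨ ∑-mono (λ x → either (big x) (not (small (r x)) ∧ rich P x)) ⟩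
        ∑ (λ x → ⟦ big x ⟧ + ⟦ centre x ⟧) ≡⟨ ∑-+ (λ x → ⟦ big x ⟧) (λ x → ⟦ centre x ⟧) ⟩
        ∑ (λ x → ⟦ big x ⟧) + ∑ (λ x → ⟦ centre x ⟧)
          ≡⟨ cong₂ _+_ (≡-sym (count≡∑ big)) (≡-sym (∑-fibre r (λ _ x → ⟦ centre x ⟧))) ⟩
        count big + ∑ (λ c → ∑ (λ x → ⟦ r x == c ⟧ * ⟦ centre x ⟧)) ≤⟨ +-monoʳ-≤ (count big) (∑-mono per-part) ⟩
        count big + ∑ (λ c → ⟦ large c ⟧) ≡⟨ cong (count big +_) (≡-sym (count≡∑ large)) ⟩
        count big + count large ∎
        where
        centre : V → Bool
        centre x = not (big x) ∧ (not (small (r x)) ∧ rich P x)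
        either : ∀ a b → ⟦ a ∨ b ⟧ ≤ ⟦ a ⟧ + ⟦ not a ∧ b ⟧
        either true b = s≤s z≤n
        either false b = ≤-refl
        per-part : ∀ c → ∑ (λ x → ⟦ r x == c ⟧ * ⟦ centre x ⟧) ≤ ⟦ large c ⟧
        per-part c = begin
          ∑ (λ x → ⟦ r x == c ⟧ * ⟦ centre x ⟧) ≡⟨ ∑-cong (λ x → ≡-sym (⟦∧⟧ (r x == c) (centre x))) ⟩
          ∑ (λ x → ⟦ q x ⟧) ≤⟨ ∑-unique q unique ⟩
          ⟦ any q ⟧ ≤⟨ ⟦⟧-mono is-large ⟩
          ⟦ large c ⟧ ∎
          where
          q : V → Bool
          q x = (r x == c) ∧ centre x
          q-elim : ∀ {x} → q x ≡ true → r x ≡ c × big x ≡ false × small (r x) ≡ false × rich P x ≡ true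
          q-elim {x} h = let rx , h₁ = ∧-elim {r x == c} h ; bx , h₂ = ∧-elim {not (big x)} h₁ ; sx , ρ = ∧-elim {not (small (r x))} h₂
            in ==⇒≡ rx , not-true bx , not-true sx , ρ
          unique : ∀ x y → q x ≡ true → q y ≡ true → x ≡ y
          unique x y hx hy = let rx , _ , sx , ρx = q-elim hx ; ry , _ , _ , ρy = q-elim hy in
            one-rich x y (trans rx (≡-sym ry)) sx ρx ρy
          is-large : any q ≡ true → large c ≡ true
          is-large h with any-elim q h
          ... | x , qx with q-elim qx
          ...   | refl , bx , sx , _ = ∧-intro (≡⇒== (idem x)) (∧-intro
                    (cong not (¬true⇒false λ bc → true≢false (trans (cong big (big-alone (r x) x bc (≡-sym (idem x)))) bc) bx))
                    (cong not sx))

      8e≥ : e + 7 ≤ 8 * e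
      8e≥ = ≤-trans (+-monoʳ-≤ e (≤-trans (≤-reflexive (≡-sym (*-identityʳ 7))) (*-monoʳ-≤ 7 1≤e))) (≤-reflexive (rearr e))
        where
        rearr : ∀ e → e + 7 * e ≡ 8 * e
        rearr = solve-∀

      -- Counted from the other end: a vertex `t` outside `B` in a part that is not small is not
      -- rich, so it sees at most `e + 7` small parts, and `e + 7 ≤ 8 * e` as `e` is positive.
      ∑stray≤ : ∑ (λ c → ⟦ small c ⟧ * w c) ≤ n G * (8 * e)
      ∑stray≤ = begin
        ∑ (λ c → ⟦ small c ⟧ * w c)
          ≡⟨ trans (∑-cong λ c → trans (≡-sym (∑-*ˡ ⟦ small c ⟧ (λ t → ⟦ stray c t ⟧))) (∑-cong λ t → ≡-sym (⟦∧⟧ (small c) (stray c t))))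
               (∑-swap (λ c t → ⟦ small c ∧ stray c t ⟧)) ⟩
        ∑ (λ t → ∑ (λ c → ⟦ small c ∧ stray c t ⟧)) ≤⟨ ∑≤ (λ t → ∑ (λ c → ⟦ small c ∧ stray c t ⟧)) (8 * e) column ⟩
        n G * (8 * e) ∎
        where
        column : ∀ t → ∑ (λ c → ⟦ small c ∧ stray c t ⟧) ≤ 8 * e
        column t = by-rich (B t) refl (small (r t)) refl
          where
          empty : (∀ c → stray c t ≡ true → ⊥) → ∑ (λ c → ⟦ small c ∧ stray c t ⟧) ≤ 8 * e
          empty none = ≤-trans (≤-reflexive (trans (∑-cong λ c → cong ⟦_⟧ (¬true⇒false λ h → none c (proj₂ (∧-elim {small c} h)))) (∑-zero (n G)))) z≤n
          by-rich : ∀ b → B t ≡ b → ∀ s → small (r t) ≡ s → ∑ (λ c → ⟦ small c ∧ stray c t ⟧) ≤ 8 * e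
          by-rich true Bt _ _ = empty λ c h → true≢false Bt (not-true (proj₁ (∧-elim {not (B t)} (proj₂ (∧-elim {adj G c t} h)))))
          by-rich false _ true st = empty λ c h → true≢false st (not-true (proj₂ (∧-elim {not (B t)} (proj₂ (∧-elim {adj G c t} h)))))
          by-rich false Bt false st = begin
            ∑ (λ c → ⟦ small c ∧ stray c t ⟧)
              ≤⟨ ∑-mono (λ c → ⟦⟧-mono λ h → let sc , h′ = ∧-elim {small c} h in
                   ∧-intro sc (touches-intro c (small-fixed sc) (trans (sym G t c) (proj₁ (∧-elim {adj G c t} h′))))) ⟩
            ∑ (λ c → ⟦ small c ∧ touches t c ⟧) ≡⟨ ≡-sym (count≡∑ (λ c → small c ∧ touches t c)) ⟩
            richness t ≤⟨ +-cancelˡ-≤ 1 _ _ (≤-trans (≰⇒> poor) (≤-reflexive (+-suc e 7))) ⟩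
            e + 7 ≤⟨ 8e≥ ⟩
            8 * e ∎
            where
            poor : ¬ e + 8 ≤ richness t
            poor h = true≢false (in-B (big t) (small (r t)) st (true-does (e + 8 ≤? richness t) h)) Bt
              where
              in-B : ∀ b s {ρ} → s ≡ false → ρ ≡ true → b ∨ (not s ∧ ρ) ≡ true
              in-B true _ _ _ = refl
              in-B false _ refl refl = refl

      bad : V → Bool
      bad c = small c ∧ not (good c)

      -- Markov's inequality: a bad label accounts for at least `3ke/2` of the at most `8e |V|`
      -- stray pairs.
      few-bad : count bad * (3 * k) ≤ 16 * n G
      few-bad = *-cancelʳ-≤ (count bad * (3 * k)) (16 * n G) e {{>-nonZero 1≤e}} (begin
        count bad * (3 * k) * e ≡⟨ trans (*-assoc (count bad) (3 * k) e) (count-* bad (3 * k * e)) ⟩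
        ∑ (λ c → ⟦ bad c ⟧ * (3 * k * e)) ≤⟨ ∑-mono pointwise ⟩
        ∑ (λ c → 2 * (⟦ small c ⟧ * w c)) ≡⟨ ∑-*ˡ 2 (λ c → ⟦ small c ⟧ * w c) ⟩
        2 * ∑ (λ c → ⟦ small c ⟧ * w c) ≤⟨ *-monoʳ-≤ 2 ∑stray≤ ⟩
        2 * (n G * (8 * e)) ≡⟨ rearr (n G) e ⟩
        16 * n G * e ∎)
        where
        rearr : ∀ m e → 2 * (m * (8 * e)) ≡ 16 * m * e
        rearr = solve-∀
        pointwise : ∀ c → ⟦ bad c ⟧ * (3 * k * e) ≤ 2 * (⟦ small c ⟧ * w c)
        pointwise c = ⟦⟧*≤ {bad c} λ h → let sc , gc = ∧-elim {small c} h in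
          ≤-trans (≮⇒≥ λ lt → true≢false (true-does (2 * w c <? 3 * k * e) lt) (not-true gc))
                  (*-monoʳ-≤ 2 (≤⟦⟧* sc ≤-refl))

      #small≤ : #small ≤ count A + count bad
      #small≤ = begin
        #small ≡⟨ count≡∑ small ⟩
        ∑ (λ c → ⟦ small c ⟧) ≤⟨ ∑-mono (λ c → go (small c) (good c)) ⟩
        ∑ (λ c → ⟦ A c ⟧ + ⟦ bad c ⟧) ≡⟨ ∑-+ (λ c → ⟦ A c ⟧) (λ c → ⟦ bad c ⟧) ⟩
        ∑ (λ c → ⟦ A c ⟧) + ∑ (λ c → ⟦ bad c ⟧) ≡⟨ ≡-sym (cong₂ _+_ (count≡∑ A) (count≡∑ bad)) ⟩
        count A + count bad ∎
        where
        go : ∀ s g → ⟦ s ⟧ ≤ ⟦ s ∧ g ⟧ + ⟦ s ∧ not g ⟧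
        go false _ = z≤n
        go true true = s≤s z≤n
        go true false = s≤s z≤n

      disjoint : ∀ {x} → A x ≡ true → B x ≡ true → ⊥
      disjoint {x} Ax Bx = go (big x) (small (r x)) (small-not-big sx) (trans (cong small (small-fixed sx)) sx) Bx
        where
        sx : small x ≡ true
        sx = proj₁ (∧-elim {small x} Ax)
        go : ∀ b s {ρ} → b ≡ false → s ≡ true → b ∨ (not s ∧ ρ) ≡ true → ⊥
        go false true refl refl ()

      -- These neighbours lie in the part of `a` or in one of the fewer than `e` small parts
      -- adjacent to it. That makes at most `e` parts, each with at most `k/2` vertices.
      near-small : ∀ a → small a ≡ true → 2 * ∑ (λ t → ⟦ adj G a t ∧ small (r t) ⟧) ≤ e * k
      near-small a sa = begin
        2 * ∑ (λ t → ⟦ adj G a t ∧ small (r t) ⟧) ≤⟨ *-monoʳ-≤ 2 (∑-mono λ t → ⟦⟧-mono (near t)) ⟩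
        2 * ∑ (λ t → ⟦ Z (r t) ⟧) ≡⟨ cong (2 *_) (≡-sym (∑-fibre r (λ c _ → ⟦ Z c ⟧))) ⟩
        2 * ∑ (λ c → ∑ (λ t → ⟦ r t == c ⟧ * ⟦ Z c ⟧))
          ≡⟨ trans (≡-sym (∑-*ˡ 2 (λ c → ∑ (λ t → ⟦ r t == c ⟧ * ⟦ Z c ⟧))))
               (∑-cong λ c → trans (cong (2 *_) (≡-sym (count-* (λ t → r t == c) ⟦ Z c ⟧)))
                               (rearr (size c) ⟦ Z c ⟧)) ⟩
        ∑ (λ c → ⟦ Z c ⟧ * (2 * size c)) ≤⟨ ∑-mono (λ c → ⟦⟧*≤ {Z c} λ h → ≤⟦⟧* h (small-size (proj₁ (∧-elim {small c} h)))) ⟩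
        ∑ (λ c → ⟦ Z c ⟧ * k) ≡⟨ ∑-*ʳ k (λ c → ⟦ Z c ⟧) ⟩
        ∑ (λ c → ⟦ Z c ⟧) * k ≤⟨ *-monoˡ-≤ k few-Z ⟩
        e * k ∎
        where
        rearr : ∀ s z → 2 * (s * z) ≡ z * (2 * s)
        rearr = solve-∀
        Z : V → Bool
        Z c = small c ∧ insert a (λ c → padj a c) c
        near : ∀ t → adj G a t ∧ small (r t) ≡ true → Z (r t) ≡ true
        near t h = let at , st = ∧-elim {adj G a t} h in ∧-intro st (by-cases at (r t ≟ a))
          where
          by-cases : adj G a t ≡ true → Dec (r t ≡ a) → insert a (λ c → padj a c) (r t) ≡ true
          by-cases at (yes p) = subst (λ z → insert a (λ c → padj a c) z ≡ true) (≡-sym p) (insert-new a (λ c → padj a c))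
          by-cases at (no p) = insert-old a (λ c → padj a c) (padj-intro a t (p ∘ ≡-sym) (small-fixed sa) refl at)
        few-Z : ∑ (λ c → ⟦ Z c ⟧) ≤ e
        few-Z = ≤-trans (≤-reflexive (≡-sym (count≡∑ Z))) (≤-trans (count-mono sub)
          (≤-trans (count-insert≤ a (λ c → small c ∧ padj a c)) (few-small a sa)))
          where
          sub : ∀ c → Z c ≡ true → insert a (λ c → small c ∧ padj a c) c ≡ true
          sub c h = let sc , h′ = ∧-elim {small c} h in insert-elim {S = λ c → padj a c} h′
            (λ p → insert-old a (λ c → small c ∧ padj a c) (∧-intro sc p))
            λ { refl → insert-new a (λ c → small c ∧ padj a c) }

      degree-to-B : ∀ a → A a ≡ true → δ ∸ 2 * k * e ≤ ∑ (λ z → ⟦ B z ∧ adj G a z ⟧)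
      degree-to-B a Aa = m≤n+o⇒m∸n≤o δ (2 * k * e) (*-cancelˡ-≤ 2 (begin
        2 * δ ≤⟨ *-monoʳ-≤ 2 (≤-trans (min-degree a) (∑-mono pointwise)) ⟩
        2 * ∑ (λ t → ⟦ B t ∧ adj G a t ⟧ + (⟦ stray a t ⟧ + ⟦ adj G a t ∧ small (r t) ⟧))
          ≡⟨ cong (2 *_) (trans (∑-+ (λ t → ⟦ B t ∧ adj G a t ⟧) (λ t → ⟦ stray a t ⟧ + ⟦ adj G a t ∧ small (r t) ⟧))
                               (cong (N +_) (∑-+ (λ t → ⟦ stray a t ⟧) (λ t → ⟦ adj G a t ∧ small (r t) ⟧)))) ⟩
        2 * (N + (w a + X)) ≡⟨ rearr₁ N (w a) X ⟩
        2 * N + (2 * w a + 2 * X) ≤⟨ +-monoʳ-≤ (2 * N) (+-mono-≤ (<⇒≤ (does-true (2 * w a <? 3 * k * e) (proj₂ (∧-elim {small a} Aa))))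
                                                        (near-small a (proj₁ (∧-elim {small a} Aa)))) ⟩
        2 * N + (3 * k * e + e * k) ≡⟨ rearr₂ N k e ⟩
        2 * (2 * k * e + N) ∎))
        where
        N = ∑ (λ t → ⟦ B t ∧ adj G a t ⟧)
        X = ∑ (λ t → ⟦ adj G a t ∧ small (r t) ⟧)
        rearr₁ : ∀ N w X → 2 * (N + (w + X)) ≡ 2 * N + (2 * w + 2 * X)
        rearr₁ = solve-∀
        rearr₂ : ∀ N k e → 2 * N + (3 * k * e + e * k) ≡ 2 * (2 * k * e + N)
        rearr₂ = solve-∀
        pointwise : ∀ t → ⟦ adj G a t ⟧ ≤ ⟦ B t ∧ adj G a t ⟧ + (⟦ stray a t ⟧ + ⟦ adj G a t ∧ small (r t) ⟧)
        pointwise t = go (adj G a t) (B t) (small (r t))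
          where
          go : ∀ x b s → ⟦ x ⟧ ≤ ⟦ b ∧ x ⟧ + (⟦ x ∧ (not b ∧ not s) ⟧ + ⟦ x ∧ s ⟧)
          go false _ _ = z≤n
          go true true _ = s≤s z≤n
          go true false true = s≤s z≤n
          go true false false = s≤s z≤n

      -- In units of `|V| / k` there are at most 1 big vertex, 2 large parts and 16/3 bad labels, so
      -- `B` has size at most 3. If `A` had at most `ℓ |B|` elements, the number of parts would be
      -- at most `3ℓ + 16/3 + 3`, which is below `8ℓ` because `ℓ ≥ 2`.
      A-large : 8 * ℓ * n G < count isRep * k → ℓ * count B < count A
      A-large many = ≰⇒> λ few → <-irrefl refl (begin-strict
        3 * (8 * ℓ * n G) <⟨ *-monoʳ-< 3 many ⟩
        3 * (count isRep * k) ≤⟨ *-monoʳ-≤ 3 (*-monoˡ-≤ k (≤-trans reps≤ (+-monoˡ-≤ (count big) (+-monoˡ-≤ (count large)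
                                  (≤-trans #small≤ (+-monoˡ-≤ (count bad) (≤-trans few (*-monoʳ-≤ ℓ B≤)))))))) ⟩
        3 * ((ℓ * (count big + count large) + count bad + count large + count big) * k)
          ≡⟨ rearr ℓ k (count big) (count large) (count bad) ⟩
        3 * (ℓ * (count big * k + count large * k)) + count bad * (3 * k) + 3 * (count large * k + count big * k)
          ≤⟨ +-mono-≤ (+-mono-≤ (*-monoʳ-≤ 3 (*-monoʳ-≤ ℓ (+-mono-≤ few-big few-large))) few-bad) (*-monoʳ-≤ 3 (+-mono-≤ few-large few-big)) ⟩
        3 * (ℓ * (n G + 2 * n G)) + 16 * n G + 3 * (2 * n G + n G)
          ≡⟨ rearr′ ℓ (n G) ⟩
        9 * (ℓ * n G) + 25 * n G
          ≤⟨ +-monoʳ-≤ (9 * (ℓ * n G)) (≤-trans (m≤m+n (25 * n G) (5 * n G)) (≤-trans (≤-reflexive (rearr″ (n G))) (*-monoʳ-≤ 15 (*-monoˡ-≤ (n G) 2≤ℓ)))) ⟩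
        9 * (ℓ * n G) + 15 * (ℓ * n G)
          ≡⟨ rearr‴ ℓ (n G) ⟩
        3 * (8 * ℓ * n G) ∎)
        where
        rearr : ∀ ℓ k b l d → 3 * ((ℓ * (b + l) + d + l + b) * k) ≡ 3 * (ℓ * (b * k + l * k)) + d * (3 * k) + 3 * (l * k + b * k)
        rearr = solve-∀
        rearr′ : ∀ ℓ m → 3 * (ℓ * (m + 2 * m)) + 16 * m + 3 * (2 * m + m) ≡ 9 * (ℓ * m) + 25 * m
        rearr′ = solve-∀
        rearr″ : ∀ m → 25 * m + 5 * m ≡ 15 * (2 * m)
        rearr″ = solve-∀
        rearr‴ : ∀ ℓ m → 9 * (ℓ * m) + 15 * (ℓ * m) ≡ 3 * (8 * ℓ * m)
        rearr‴ = solve-∀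

    TreeMinor : ℕ → Set
    TreeMinor ℓ = Σ Graph λ G′ →
      G′ ≼[ k ] G × 1 ≤ n G′ × n G′ * k ≤ 8 * ℓ * n G × degSum G ≤ degSum G′ + n G * (4 * e)

    dense-or-minor : ∀ ℓ δ → 2 ≤ ℓ → 1 ≤ n G → (∀ v → δ ≤ deg G v) → count big * k ≤ n G → e ≤ Δ → 3 * k * e ≤ δ →
      Dense ⊎ (StarMinor G ℓ (δ ∸ 2 * k * e) e ⊎ TreeMinor ℓ)
    dense-or-minor ℓ δ 2≤ℓ 1≤n min-degree few-big e≤Δ 3ke≤δ = [ inj₁ , conclude ]′ stuck-partition
      where
      e≤D : e ≤ δ ∸ 2 * k * e
      e≤D = m+n≤o⇒m≤o∸n e (begin
        e + 2 * k * e ≡⟨ cong (_+ 2 * k * e) (≡-sym (*-identityˡ e)) ⟩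
        1 * e + 2 * k * e ≤⟨ +-monoˡ-≤ (2 * k * e) (*-monoˡ-≤ e (≤-trans (s≤s z≤n) 2≤k)) ⟩
        k * e + 2 * k * e ≡⟨ rearr k e ⟩
        3 * k * e ≤⟨ 3ke≤δ ⟩
        δ ∎)
        where
        open ≤-Reasoning
        rearr : ∀ k e → k * e + 2 * k * e ≡ 3 * k * e
        rearr = solve-∀
      -- The subgraph found around a vertex with many mates is no larger than the one from
      -- `mergeable`: `2 * (Δ + e)` is at most `4 * Δ`, and `4 ≤ k * k`.
      weaken : DenseSubgraph G (2 * (Δ + e)) (e * e) → Dense
      weaken (H , H⊆G , size , edges) = H , H⊆G , ≤-trans size (begin
        2 * (Δ + e) ≤⟨ *-monoʳ-≤ 2 (+-monoʳ-≤ Δ e≤Δ) ⟩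
        2 * (Δ + Δ) ≡⟨ rearr Δ ⟩
        2 * 2 * Δ ≤⟨ *-monoˡ-≤ Δ (*-mono-≤ 2≤k 2≤k) ⟩
        k * k * Δ ≤⟨ m≤n+m _ (2 * k) ⟩
        2 * k + k * k * Δ ∎) , edges
        where
        open ≤-Reasoning
        rearr : ∀ d → 2 * (d + d) ≡ 2 * 2 * d
        rearr = solve-∀
      conclude : (∃[ P ] Stuck P × degSum G ≤ Parts.total P + n G * (4 * e)) → Dense ⊎ (StarMinor G ℓ (δ ∸ 2 * k * e) e ⊎ TreeMinor ℓ)
      conclude (P , stuck , loss) = by-size (count isRep * k ≤? 8 * ℓ * n G)
        where
        open Conclusion P stuck ℓ δ 2≤ℓ min-degree few-big
        by-size : Dec (count isRep * k ≤ 8 * ℓ * n G) → Dense ⊎ (StarMinor G ℓ (δ ∸ 2 * k * e) e ⊎ TreeMinor ℓ)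
        by-size (yes few) = inj₂ (inj₂ (contracted , contracted-model , contracted-nonempty 1≤n , few ,
          ≤-trans loss (+-monoˡ-≤ (n G * (4 * e)) contracted-degSum)))
        by-size (no many) = Sum.map weaken inj₁
          (Assignment.dense-or-star-minor G A B disjoint ℓ e (δ ∸ 2 * k * e) (≤-trans (s≤s z≤n) 2≤ℓ) e≤D
            degree-to-B (A-large (≰⇒> many)) Δ
            (λ a Aa → not-big (Parts.small-not-big P (proj₁ (∧-elim {Parts.small P a} Aa)))))

-- Moving inequalities between natural and rational numbers

module Rationals where

  open import Defs using (frac; ℕtoℚ)
  open import Data.Nat as ℕ using (suc; s≤s; z≤n)
  import Data.Nat.Properties as ℕ
  import Data.Nat.DivMod as ℕ
  open import Data.Integer as ℤ using (+_; +≤+)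
  import Data.Integer.Properties as ℤ
  open import Data.Rational using (mkℚ; 0ℚ; 1ℚ; _+_; _*_; _-_; -_; _≤_; _<_; *≤*; toℚᵘ; nonNegative; positive)
  open import Data.Rational.Properties
  open import Data.Rational.Solver using (module +-*-Solver)
  import Data.Rational.Unnormalised as ℚᵘ
  import Data.Rational.Unnormalised.Properties as ℚᵘ
  open import Data.Product using (_×_; _,_; ∃-syntax)
  open import Relation.Binary.PropositionalEquality

  -- `frac` reduces to lowest terms, which blocks computation on variables. On the unnormalised side
  -- the identities below become integer equations.
  toℚᵘ-frac : ∀ a b → toℚᵘ (frac a (suc b)) ℚᵘ.≃ ℚᵘ.mkℚᵘ (+ a) b
  toℚᵘ-frac a b = toℚᵘ-fromℚᵘ (ℚᵘ.mkℚᵘ (+ a) b)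

  ι-mono : ∀ {a b} → a ℕ.≤ b → ℕtoℚ a ≤ ℕtoℚ b
  ι-mono {a} {b} h = toℚᵘ-cancel-≤ (ℚᵘ.≤-respˡ-≃ (ℚᵘ.≃-sym (toℚᵘ-frac a 0)) (ℚᵘ.≤-respʳ-≃ (ℚᵘ.≃-sym (toℚᵘ-frac b 0))
    (ℚᵘ.*≤* (subst₂ ℤ._≤_ (sym (ℤ.*-identityʳ (+ a))) (sym (ℤ.*-identityʳ (+ b))) (+≤+ h)))))

  ι-cancel : ∀ {a b} → ℕtoℚ a ≤ ℕtoℚ b → a ℕ.≤ b
  ι-cancel {a} {b} h with ℚᵘ.≤-respˡ-≃ (toℚᵘ-frac a 0) (ℚᵘ.≤-respʳ-≃ (toℚᵘ-frac b 0) (toℚᵘ-mono-≤ h))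
  ... | ℚᵘ.*≤* h′ = ℤ.drop‿+≤+ (subst₂ ℤ._≤_ (ℤ.*-identityʳ (+ a)) (ℤ.*-identityʳ (+ b)) h′)

  ι-+ : ∀ a b → ℕtoℚ (a ℕ.+ b) ≡ ℕtoℚ a + ℕtoℚ b
  ι-+ a b = toℚᵘ-injective (ℚᵘ.≃-trans (toℚᵘ-frac (a ℕ.+ b) 0) (ℚᵘ.≃-trans
    (ℚᵘ.*≡* (cong (ℤ._* + 1) (cong₂ ℤ._+_ (sym (ℤ.*-identityʳ (+ a))) (sym (ℤ.*-identityʳ (+ b))))))
    (ℚᵘ.≃-sym (ℚᵘ.≃-trans (toℚᵘ-homo-+ (ℕtoℚ a) (ℕtoℚ b)) (ℚᵘ.+-cong (toℚᵘ-frac a 0) (toℚᵘ-frac b 0))))))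

  ι-* : ∀ a b → ℕtoℚ (a ℕ.* b) ≡ ℕtoℚ a * ℕtoℚ b
  ι-* a b = toℚᵘ-injective (ℚᵘ.≃-trans (toℚᵘ-frac (a ℕ.* b) 0) (ℚᵘ.≃-trans
    (ℚᵘ.*≡* (cong (ℤ._* + 1) (ℤ.pos-* a b)))
    (ℚᵘ.≃-sym (ℚᵘ.≃-trans (toℚᵘ-homo-* (ℕtoℚ a) (ℕtoℚ b)) (ℚᵘ.*-cong (toℚᵘ-frac a 0) (toℚᵘ-frac b 0))))))

  frac-* : ∀ a {b} → 1 ℕ.≤ b → frac a b * ℕtoℚ b ≡ ℕtoℚ a
  frac-* a {suc b} _ = toℚᵘ-injective (ℚᵘ.≃-trans (toℚᵘ-homo-* (frac a (suc b)) (ℕtoℚ (suc b)))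
    (ℚᵘ.≃-trans (ℚᵘ.*-cong (toℚᵘ-frac a b) (toℚᵘ-frac (suc b) 0)) (ℚᵘ.≃-trans
      (ℚᵘ.*≡* (trans (ℤ.*-identityʳ (+ a ℤ.* + suc b)) (cong (λ t → + a ℤ.* + suc t) (sym (ℕ.*-identityʳ b)))))
      (ℚᵘ.≃-sym (toℚᵘ-frac a 0)))))

  0≤ι : ∀ a → 0ℚ ≤ ℕtoℚ a
  0≤ι a = ι-mono {0} {a} z≤n

  ι-pos : ∀ {a} → 1 ℕ.≤ a → 0ℚ < ℕtoℚ a
  ι-pos h = <-≤-trans (positive⁻¹ 1ℚ) (ι-mono h)

  *-monoˡ : ∀ {p q r} → 0ℚ ≤ r → p ≤ q → r * p ≤ r * q
  *-monoˡ {r = r} 0≤r = *-monoˡ-≤-nonNeg r {{nonNegative 0≤r}}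

  *-monoʳ : ∀ {p q r} → 0ℚ ≤ r → p ≤ q → p * r ≤ q * r
  *-monoʳ {r = r} 0≤r = *-monoʳ-≤-nonNeg r {{nonNegative 0≤r}}

  *-nonNeg : ∀ {p q} → 0ℚ ≤ p → 0ℚ ≤ q → 0ℚ ≤ p * q
  *-nonNeg {p} {q} 0≤p 0≤q = ≤-trans (≤-reflexive (sym (*-zeroʳ p))) (*-monoˡ 0≤p 0≤q)

  *-cancelʳ : ∀ {p q r} → 0ℚ < r → p * r ≤ q * r → p ≤ q
  *-cancelʳ {r = r} 0<r = *-cancelʳ-≤-pos r {{positive 0<r}}

  ≤+⇒-≤ : ∀ {p q r} → p ≤ q + r → p - r ≤ q
  ≤+⇒-≤ {p} {q} {r} h = ≤-trans (+-monoˡ-≤ (- r) h) (≤-reflexive (trans (+-assoc q r (- r)) (trans (cong (λ t → q + t) (+-inverseʳ r)) (+-identityʳ q))))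

  ≤⇒0≤- : ∀ {p q} → p ≤ q → 0ℚ ≤ q - p
  ≤⇒0≤- {p} {q} h = ≤-trans (≤-reflexive (sym (+-inverseʳ p))) (+-monoˡ-≤ (- p) h)

  frac-*-≤-frac : ∀ p q E N x → 1 ℕ.≤ q → 1 ℕ.≤ N → ℕtoℚ p * ℕtoℚ N * x ≤ ℕtoℚ q * ℕtoℚ E → frac p q * x ≤ frac E N
  frac-*-≤-frac p q E N x 1≤q 1≤N h = *-cancelʳ (ι-pos (ℕ.*-mono-≤ 1≤q 1≤N)) (begin
    frac p q * x * ℕtoℚ (q ℕ.* N)
      ≡⟨ cong (frac p q * x *_) (ι-* q N) ⟩
    frac p q * x * (ℕtoℚ q * ℕtoℚ N)
      ≡⟨ solve 4 (λ f x q N → f :* x :* (q :* N) := f :* q :* N :* x) refl (frac p q) x (ℕtoℚ q) (ℕtoℚ N) ⟩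
    frac p q * ℕtoℚ q * ℕtoℚ N * x
      ≡⟨ cong (λ t → t * ℕtoℚ N * x) (frac-* p 1≤q) ⟩
    ℕtoℚ p * ℕtoℚ N * x
      ≤⟨ h ⟩
    ℕtoℚ q * ℕtoℚ E
      ≡⟨ cong (ℕtoℚ q *_) (sym (frac-* E 1≤N)) ⟩
    ℕtoℚ q * (frac E N * ℕtoℚ N)
      ≡⟨ solve 3 (λ q f N → q :* (f :* N) := f :* (q :* N)) refl (ℕtoℚ q) (frac E N) (ℕtoℚ N) ⟩
    frac E N * (ℕtoℚ q * ℕtoℚ N)
      ≡⟨ cong (frac E N *_) (sym (ι-* q N)) ⟩
    frac E N * ℕtoℚ (q ℕ.* N) ∎)
    where
    open ≤-Reasoning
    open +-*-Solver

  ℕ-floor : ∀ a b → 1 ℕ.≤ b → ∃[ f ] (f ℕ.* b ℕ.≤ a × a ℕ.< suc f ℕ.* b)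
  ℕ-floor a (suc b) _ = a ℕ./ suc b , ℕ.m/n*n≤m a (suc b) ,
    subst (ℕ._< suc (a ℕ./ suc b) ℕ.* suc b) (sym (ℕ.m≡m%n+[m/n]*n a (suc b)))
      (ℕ.+-monoˡ-< (a ℕ./ suc b ℕ.* suc b) (ℕ.m%n<n a (suc b)))

  ℕ-ceiling : ∀ a b → 1 ℕ.≤ b → ∃[ c ] (a ℕ.≤ c ℕ.* b × c ℕ.* b ℕ.< a ℕ.+ b)
  -- With divisor `suc b`, the ceiling of `a` is the floor of `a + b`.
  ℕ-ceiling a (suc b) 1≤b with ℕ-floor (a ℕ.+ b) (suc b) 1≤b
  ... | f , lower , upper = f ,
    ℕ.+-cancelʳ-≤ b a (f ℕ.* suc b) (ℕ.+-cancelˡ-≤ 1 _ _ (ℕ.≤-trans upper (ℕ.≤-reflexive (trans (ℕ.+-comm (suc b) (f ℕ.* suc b)) (ℕ.+-suc _ b))))) ,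
    ℕ.≤-trans (s≤s lower) (ℕ.≤-reflexive (sym (ℕ.+-suc a b)))

  as-frac : ∀ q → 0ℚ ≤ q → ∃[ a ] ∃[ b ] (1 ℕ.≤ b × q * ℕtoℚ b ≡ ℕtoℚ a)
  as-frac (mkℚ (+ a) b c) _ = a , suc b , s≤s z≤n , trans (cong (_* ℕtoℚ (suc b)) (sym (↥p/↧p≡p (mkℚ (+ a) b c)))) (frac-* a (s≤s z≤n))
  as-frac (mkℚ ℤ.-[1+ a ] b c) (*≤* ())

  ceiling : ∀ q → 1ℚ ≤ q → ∃[ e ] (q ≤ ℕtoℚ e × ℕtoℚ e ≤ ℕtoℚ 2 * q)
  ceiling q 1≤q with as-frac q (≤-trans (nonNegative⁻¹ 1ℚ) 1≤q)
  ... | a , b , 1≤b , qb≡a with ℕ-ceiling a b 1≤b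
  ...   | e , lower , upper = e ,
    *-cancelʳ (ι-pos 1≤b) (begin
      q * ℕtoℚ b ≡⟨ qb≡a ⟩
      ℕtoℚ a ≤⟨ ι-mono lower ⟩
      ℕtoℚ (e ℕ.* b) ≡⟨ ι-* e b ⟩
      ℕtoℚ e * ℕtoℚ b ∎) ,
    *-cancelʳ (ι-pos 1≤b) (begin
      ℕtoℚ e * ℕtoℚ b ≡⟨ sym (ι-* e b) ⟩
      ℕtoℚ (e ℕ.* b) ≤⟨ ι-mono (ℕ.≤-trans (ℕ.<⇒≤ upper) (ℕ.+-monoʳ-≤ a (ℕ.≤-trans b≤a (ℕ.≤-reflexive (sym (ℕ.+-identityʳ a)))))) ⟩
      ℕtoℚ (2 ℕ.* a) ≡⟨ ι-* 2 a ⟩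
      ℕtoℚ 2 * ℕtoℚ a ≡⟨ cong (ℕtoℚ 2 *_) (sym qb≡a) ⟩
      ℕtoℚ 2 * (q * ℕtoℚ b) ≡⟨ sym (*-assoc (ℕtoℚ 2) q (ℕtoℚ b)) ⟩
      ℕtoℚ 2 * q * ℕtoℚ b ∎)
    where
    open ≤-Reasoning
    b≤a : b ℕ.≤ a
    b≤a = ι-cancel (begin
      ℕtoℚ b ≡⟨ sym (*-identityˡ (ℕtoℚ b)) ⟩
      1ℚ * ℕtoℚ b ≤⟨ *-monoʳ (0≤ι b) 1≤q ⟩
      q * ℕtoℚ b ≡⟨ qb≡a ⟩
      ℕtoℚ a ∎)

-- Choice of the integer parameters and the three outcomes in rational form

module Translation where

  open import Defs hiding (sym)
  open Combinatorics using (∑; ⟦_⟧; ∑-mono; count-*; ⟦⟧*≤; does-true; degSum; deg; degSum≡2E;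
    Peeled; peel; minor-of-subgraph; ⊆ᵍ-trans; StarMinor; module Contraction; module Trichotomy)
  open Rationals
  open import Data.Nat as ℕ using (ℕ; zero; suc; s≤s; z≤n)
  import Data.Nat.Properties as ℕ
  open import Data.Nat.Tactic.RingSolver using (solve-∀)
  open import Data.Rational using (ℚ; 0ℚ; 1ℚ; _+_; _*_; _-_; -_) renaming (_≤_ to _≤ℚ_; _<_ to _<ℚ_)
  open import Data.Rational.Properties
  open import Data.Rational.Solver using (module +-*-Solver)
  open import Data.Product using (Σ; _×_; _,_; proj₁; proj₂)
  open import Data.Sum using (_⊎_)
  open import Relation.Binary.PropositionalEquality using (_≡_; refl; sym; trans; cong; cong₂)

  module Parameters (k ℓ : ℕ) (2≤ℓ : 2 ℕ.≤ ℓ) (ℓ≤k : ℓ ℕ.≤ k) (ε : ℚ) (0<ε : 0ℚ <ℚ ε)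
                    (6kε<1 : ε * ℕtoℚ (6 ℕ.* k) <ℚ 1ℚ) (G : Graph) (1≤εd : 1ℚ ≤ℚ ε * density G) where

    private
      ι = ℕtoℚ
      N = n G
      m = ∣E∣ G
      d = density G
      q = ε * d

    2≤k : 2 ℕ.≤ k
    2≤k = ℕ.≤-trans 2≤ℓ ℓ≤k

    1≤k : 1 ℕ.≤ k
    1≤k = ℕ.≤-trans (s≤s z≤n) 2≤k

    -- The empty graph has density 0 by convention, so it fails the assumption `1 ≤ ε d`.
    1≤N : 1 ℕ.≤ N
    1≤N = positive-size N 1≤εd
      where
      positive-size : ∀ N → 1ℚ ≤ℚ ε * frac m N → 1 ℕ.≤ N
      positive-size (suc _) _ = s≤s z≤n
      positive-size zero h = ι-cancel {1} {0} (≤-trans h (≤-reflexive (*-zeroʳ ε)))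

    dN≡m : d * ι N ≡ ι m
    dN≡m = frac-* m 1≤N

    0≤d : 0ℚ ≤ℚ d
    0≤d = *-cancelʳ (ι-pos 1≤N) (≤-trans (≤-reflexive (*-zeroˡ (ι N))) (≤-trans (0≤ι m) (≤-reflexive (sym dN≡m))))

    0≤q : 0ℚ ≤ℚ q
    0≤q = *-nonNeg (<⇒≤ 0<ε) 0≤d

    6kq≤d : ι (6 ℕ.* k) * q ≤ℚ d
    6kq≤d = begin
      ι (6 ℕ.* k) * (ε * d) ≡⟨ solve 3 (λ a b c → a :* (b :* c) := b :* a :* c) refl (ι (6 ℕ.* k)) ε d ⟩
      ε * ι (6 ℕ.* k) * d ≤⟨ *-monoʳ 0≤d (<⇒≤ 6kε<1) ⟩
      1ℚ * d ≡⟨ *-identityˡ d ⟩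
      d ∎
      where
      open ≤-Reasoning
      open +-*-Solver

    q≤d : q ≤ℚ d
    q≤d = begin
      q ≡⟨ sym (*-identityˡ q) ⟩
      ι 1 * q ≤⟨ *-monoʳ 0≤q (ι-mono (ℕ.*-mono-≤ {1} {6} (s≤s z≤n) 1≤k)) ⟩
      ι (6 ℕ.* k) * q ≤⟨ 6kq≤d ⟩
      d ∎
      where open ≤-Reasoning

    N≤m : N ℕ.≤ m
    N≤m = ι-cancel (begin
      ι N ≡⟨ sym (*-identityˡ (ι N)) ⟩
      1ℚ * ι N ≤⟨ *-monoʳ (0≤ι N) (≤-trans 1≤εd q≤d) ⟩
      d * ι N ≡⟨ dN≡m ⟩
      ι m ∎)
      where open ≤-Reasoning

    -- e = ⌈ε d⌉, δ = ⌈d⌉ and Δ = ⌊4 k d⌋; the bound e ≤ 2 ε d uses ε d ≥ 1.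
    e : ℕ
    e = proj₁ (ceiling q 1≤εd)

    q≤e : q ≤ℚ ι e
    q≤e = proj₁ (proj₂ (ceiling q 1≤εd))

    e≤2q : ι e ≤ℚ ι 2 * q
    e≤2q = proj₂ (proj₂ (ceiling q 1≤εd))

    δ : ℕ
    δ = proj₁ (ℕ-ceiling m N 1≤N)

    m≤δN : m ℕ.≤ δ ℕ.* N
    m≤δN = proj₁ (proj₂ (ℕ-ceiling m N 1≤N))

    δN<m+N : δ ℕ.* N ℕ.< m ℕ.+ N
    δN<m+N = proj₂ (proj₂ (ℕ-ceiling m N 1≤N))

    Δ : ℕ
    Δ = proj₁ (ℕ-floor (4 ℕ.* k ℕ.* m) N 1≤N)

    ΔN≤4km : Δ ℕ.* N ℕ.≤ 4 ℕ.* k ℕ.* m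
    ΔN≤4km = proj₁ (proj₂ (ℕ-floor (4 ℕ.* k ℕ.* m) N 1≤N))

    4km<ΔN : 4 ℕ.* k ℕ.* m ℕ.< suc Δ ℕ.* N
    4km<ΔN = proj₂ (proj₂ (ℕ-floor (4 ℕ.* k ℕ.* m) N 1≤N))

    1≤e : 1 ℕ.≤ e
    1≤e = ι-cancel {1} (≤-trans 1≤εd q≤e)

    d≤δ : d ≤ℚ ι δ
    d≤δ = *-cancelʳ (ι-pos 1≤N) (≤-trans (≤-reflexive dN≡m) (≤-trans (ι-mono m≤δN) (≤-reflexive (ι-* δ N))))

    3ke≤6kq : ι (3 ℕ.* k ℕ.* e) ≤ℚ ι (6 ℕ.* k) * q
    3ke≤6kq = begin
      ι (3 ℕ.* k ℕ.* e) ≡⟨ ι-* (3 ℕ.* k) e ⟩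
      ι (3 ℕ.* k) * ι e ≤⟨ *-monoˡ (0≤ι (3 ℕ.* k)) e≤2q ⟩
      ι (3 ℕ.* k) * (ι 2 * q) ≡⟨ sym (*-assoc (ι (3 ℕ.* k)) (ι 2) q) ⟩
      ι (3 ℕ.* k) * ι 2 * q ≡⟨ cong (_* q) (trans (sym (ι-* (3 ℕ.* k) 2)) (cong ι (rearr k))) ⟩
      ι (6 ℕ.* k) * q ∎
      where
      open ≤-Reasoning
      rearr : ∀ k → 3 ℕ.* k ℕ.* 2 ≡ 6 ℕ.* k
      rearr = solve-∀

    3ke≤δ : 3 ℕ.* k ℕ.* e ℕ.≤ δ
    3ke≤δ = ι-cancel (≤-trans 3ke≤6kq (≤-trans 6kq≤d d≤δ))

    -- The chain is `e ≤ 3ke ≤ δ < d + 1 ≤ 2d ≤ 4kd < Δ + 1`, multiplied by `N`; it uses `d ≥ 1` in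
    -- the form `N≤m`.
    e≤Δ : e ℕ.≤ Δ
    e≤Δ = ℕ.≤-pred (ℕ.*-cancelʳ-< N e (suc Δ) (begin-strict
      e ℕ.* N ≡⟨ cong (ℕ._* N) (sym (ℕ.*-identityˡ e)) ⟩
      1 ℕ.* e ℕ.* N ≤⟨ ℕ.*-monoˡ-≤ N (ℕ.*-monoˡ-≤ e (ℕ.*-mono-≤ {1} {3} (s≤s z≤n) 1≤k)) ⟩
      3 ℕ.* k ℕ.* e ℕ.* N ≤⟨ ℕ.*-monoˡ-≤ N 3ke≤δ ⟩
      δ ℕ.* N <⟨ δN<m+N ⟩
      m ℕ.+ N ≤⟨ ℕ.+-monoʳ-≤ m N≤m ⟩
      m ℕ.+ m ≡⟨ rearr m ⟩
      2 ℕ.* 1 ℕ.* m ≤⟨ ℕ.*-monoˡ-≤ m (ℕ.*-mono-≤ {2} {4} (s≤s (s≤s z≤n)) 1≤k) ⟩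
      4 ℕ.* k ℕ.* m <⟨ 4km<ΔN ⟩
      suc Δ ℕ.* N ∎))
      where
      open ℕ.≤-Reasoning
      rearr : ∀ m → m ℕ.+ m ≡ 2 ℕ.* 1 ℕ.* m
      rearr = solve-∀

    peeled : Peeled (2 ℕ.* m) N G
    peeled = peel (2 ℕ.* m) N G 1≤N 1≤N
      (ℕ.≤-reflexive (cong (ℕ._* N) (trans (cong (m ℕ.+_) (ℕ.+-identityʳ m)) (sym (degSum≡2E G)))))

    open Peeled peeled renaming (core to F; core⊆ to F⊆G; nonempty to 1≤nF)

    -- Degrees are integers, so the bound `d` from peeling improves to its ceiling `δ`.
    min-deg : ∀ v → δ ℕ.≤ deg F v
    min-deg v = ℕ.≮⇒≥ λ lt → ℕ.<-irrefl refl (begin-strict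
      m ℕ.+ N ≤⟨ ℕ.+-monoˡ-≤ N (ℕ.*-cancelˡ-≤ 2 (min-degree v)) ⟩
      deg F v ℕ.* N ℕ.+ N ≡⟨ ℕ.+-comm (deg F v ℕ.* N) N ⟩
      suc (deg F v) ℕ.* N ≤⟨ ℕ.*-monoˡ-≤ N lt ⟩
      δ ℕ.* N <⟨ δN<m+N ⟩
      m ℕ.+ N ∎)
      where open ℕ.≤-Reasoning

    open Contraction F k e Δ using (big; Dense)
    open Trichotomy F k e Δ 1≤e 2≤k using (TreeMinor; dense-or-minor)

    -- By `tight` the degree sum of `F` is below `2d |V(F)| + 2`, hence at most `4d |V(F)|`, while
    -- each big vertex contributes more than `4kd`.
    few-big : count big ℕ.* k ℕ.≤ n F
    few-big = ℕ.*-cancelʳ-≤ (count big ℕ.* k) (n F) (4 ℕ.* m) {{ℕ.>-nonZero (ℕ.*-mono-≤ {1} {4} (s≤s z≤n) (ℕ.≤-trans 1≤N N≤m))}} (begin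
      count big ℕ.* k ℕ.* (4 ℕ.* m) ≡⟨ rearr₁ (count big) k m ⟩
      count big ℕ.* (4 ℕ.* k ℕ.* m) ≤⟨ ℕ.*-monoʳ-≤ (count big) (ℕ.<⇒≤ 4km<ΔN) ⟩
      count big ℕ.* (suc Δ ℕ.* N) ≡⟨ sym (ℕ.*-assoc (count big) (suc Δ) N) ⟩
      count big ℕ.* suc Δ ℕ.* N ≤⟨ ℕ.*-monoˡ-≤ N high-degrees ⟩
      degSum F ℕ.* N ≤⟨ ℕ.<⇒≤ tight ⟩
      2 ℕ.* m ℕ.* n F ℕ.+ 2 ℕ.* N ≤⟨ ℕ.+-monoʳ-≤ (2 ℕ.* m ℕ.* n F) (ℕ.*-monoʳ-≤ 2 N≤m) ⟩
      2 ℕ.* m ℕ.* n F ℕ.+ 2 ℕ.* m ≡⟨ cong (2 ℕ.* m ℕ.* n F ℕ.+_) (sym (ℕ.*-identityʳ (2 ℕ.* m))) ⟩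
      2 ℕ.* m ℕ.* n F ℕ.+ 2 ℕ.* m ℕ.* 1 ≤⟨ ℕ.+-monoʳ-≤ (2 ℕ.* m ℕ.* n F) (ℕ.*-monoʳ-≤ (2 ℕ.* m) 1≤nF) ⟩
      2 ℕ.* m ℕ.* n F ℕ.+ 2 ℕ.* m ℕ.* n F ≡⟨ rearr₂ m (n F) ⟩
      n F ℕ.* (4 ℕ.* m) ∎)
      where
      open ℕ.≤-Reasoning
      rearr₁ : ∀ b k m → b ℕ.* k ℕ.* (4 ℕ.* m) ≡ b ℕ.* (4 ℕ.* k ℕ.* m)
      rearr₁ = solve-∀
      rearr₂ : ∀ m v → 2 ℕ.* m ℕ.* v ℕ.+ 2 ℕ.* m ℕ.* v ≡ v ℕ.* (4 ℕ.* m)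
      rearr₂ = solve-∀
      high-degrees : count big ℕ.* suc Δ ℕ.≤ degSum F
      high-degrees = begin
        count big ℕ.* suc Δ ≡⟨ count-* big (suc Δ) ⟩
        ∑ (λ x → ⟦ big x ⟧ ℕ.* suc Δ) ≤⟨ ∑-mono (λ x → ⟦⟧*≤ {big x} (does-true (suc Δ ℕ.≤? deg F x))) ⟩
        degSum F ∎

    dense-case : Dense → Σ Graph λ H → H ⊆ᵍ G ×
      (ι (∣V∣ H) ≤ℚ ι (3 ℕ.* (k ℕ.^ 3)) * d) × (frac 1 2 * (ε * ε) * (d * d) ≤ℚ ι (∣E∣ H))
    dense-case (H , H⊆F , size , edges) = H , ⊆ᵍ-trans {H} {F} {G} H⊆F F⊆G , size′ , edges′
      where
      -- Twice the vertex bound is `2k + k²Δ`, at most `2k³d + 4k³d` by `d ≥ 1` and `Δ ≤ 4kd`; half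
      -- of this is `3k³d`.
      size-ℕ : n H ℕ.* N ℕ.≤ 3 ℕ.* (k ℕ.^ 3) ℕ.* m
      size-ℕ = ℕ.*-cancelˡ-≤ 2 (begin
        2 ℕ.* (n H ℕ.* N) ≡⟨ sym (ℕ.*-assoc 2 (n H) N) ⟩
        2 ℕ.* n H ℕ.* N ≤⟨ ℕ.*-monoˡ-≤ N size ⟩
        (2 ℕ.* k ℕ.+ k ℕ.* k ℕ.* Δ) ℕ.* N ≡⟨ rearr₁ k Δ N ⟩
        2 ℕ.* k ℕ.* N ℕ.* (1 ℕ.* 1) ℕ.+ k ℕ.* k ℕ.* (Δ ℕ.* N)
          ≤⟨ ℕ.+-mono-≤ (ℕ.*-mono-≤ (ℕ.*-monoʳ-≤ (2 ℕ.* k) N≤m) (ℕ.*-mono-≤ 1≤k 1≤k)) (ℕ.*-monoʳ-≤ (k ℕ.* k) ΔN≤4km) ⟩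
        2 ℕ.* k ℕ.* m ℕ.* (k ℕ.* k) ℕ.+ k ℕ.* k ℕ.* (4 ℕ.* k ℕ.* m) ≡⟨ rearr₂ k m ⟩
        2 ℕ.* (3 ℕ.* (k ℕ.^ 3) ℕ.* m) ∎)
        where
        open ℕ.≤-Reasoning
        rearr₁ : ∀ k Δ N → (2 ℕ.* k ℕ.+ k ℕ.* k ℕ.* Δ) ℕ.* N ≡ 2 ℕ.* k ℕ.* N ℕ.* (1 ℕ.* 1) ℕ.+ k ℕ.* k ℕ.* (Δ ℕ.* N)
        rearr₁ = solve-∀
        rearr₂ : ∀ k m → 2 ℕ.* k ℕ.* m ℕ.* (k ℕ.* k) ℕ.+ k ℕ.* k ℕ.* (4 ℕ.* k ℕ.* m) ≡ 2 ℕ.* (3 ℕ.* (k ℕ.* (k ℕ.* (k ℕ.* 1))) ℕ.* m)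
        rearr₂ = solve-∀
      size′ : ι (n H) ≤ℚ ι (3 ℕ.* (k ℕ.^ 3)) * d
      size′ = *-cancelʳ (ι-pos 1≤N) (begin
        ι (n H) * ι N ≡⟨ sym (ι-* (n H) N) ⟩
        ι (n H ℕ.* N) ≤⟨ ι-mono size-ℕ ⟩
        ι (3 ℕ.* (k ℕ.^ 3) ℕ.* m) ≡⟨ ι-* (3 ℕ.* (k ℕ.^ 3)) m ⟩
        ι (3 ℕ.* (k ℕ.^ 3)) * ι m ≡⟨ cong (ι (3 ℕ.* (k ℕ.^ 3)) *_) (sym dN≡m) ⟩
        ι (3 ℕ.* (k ℕ.^ 3)) * (d * ι N) ≡⟨ sym (*-assoc (ι (3 ℕ.* (k ℕ.^ 3))) d (ι N)) ⟩
        ι (3 ℕ.* (k ℕ.^ 3)) * d * ι N ∎)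
        where open ≤-Reasoning
      edges′ : frac 1 2 * (ε * ε) * (d * d) ≤ℚ ι (∣E∣ H)
      edges′ = begin
        frac 1 2 * (ε * ε) * (d * d) ≡⟨ solve 3 (λ h a b → h :* (a :* a) :* (b :* b) := h :* ((a :* b) :* (a :* b))) refl (frac 1 2) ε d ⟩
        frac 1 2 * (q * q) ≤⟨ *-monoˡ (nonNegative⁻¹ (frac 1 2)) (≤-trans (*-monoʳ 0≤q q≤e) (*-monoˡ (0≤ι e) q≤e)) ⟩
        frac 1 2 * (ι e * ι e) ≡⟨ cong (frac 1 2 *_) (sym (ι-* e e)) ⟩
        frac 1 2 * ι (e ℕ.* e) ≤⟨ *-monoˡ (nonNegative⁻¹ (frac 1 2)) (ι-mono (ℕ.≤-trans edges (ℕ.≤-reflexive (degSum≡2E H)))) ⟩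
        frac 1 2 * ι (∣E∣ H ℕ.+ ∣E∣ H) ≡⟨ cong (frac 1 2 *_) (ι-+ (∣E∣ H) (∣E∣ H)) ⟩
        frac 1 2 * (ι (∣E∣ H) + ι (∣E∣ H)) ≡⟨ solve 2 (λ h x → h :* (x :+ x) := (h :+ h) :* x) refl (frac 1 2) (ι (∣E∣ H)) ⟩
        1ℚ * ι (∣E∣ H) ≡⟨ *-identityˡ (ι (∣E∣ H)) ⟩
        ι (∣E∣ H) ∎
        where
        open ≤-Reasoning
        open +-*-Solver

    star-case : StarMinor F ℓ (δ ℕ.∸ 2 ℕ.* k ℕ.* e) e → Σ Graph λ G′ → G′ ≼[ ℓ ℕ.+ 1 ] G ×
      (frac ℓ 2 * (1ℚ - ι (6 ℕ.* k) * ε) * d ≤ℚ density G′)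
    star-case (G′ , model , 1≤n′ , bound) = G′ , minor-of-subgraph {ℓ ℕ.+ 1} {G′} {F} {G} model F⊆G ,
        ≤-trans (≤-reflexive (*-assoc (frac ℓ 2) (1ℚ - ι (6 ℕ.* k) * ε) d))
          (frac-*-≤-frac ℓ 2 E′ n′ ((1ℚ - ι (6 ℕ.* k) * ε) * d) (s≤s z≤n) 1≤n′ rational)
      where
      n′ = n G′
      E′ = ∣E∣ G′
      X = n′ ℕ.* ℓ
      -- Per leaf, `2ke` is lost because only neighbours in `B` count, and `ℓ e ≤ ke` through
      -- overlaps within a star. The sum `3ke` is at most `6kεd`.
      natural : X ℕ.* δ ℕ.≤ 2 ℕ.* E′ ℕ.+ X ℕ.* (3 ℕ.* k ℕ.* e)
      natural = begin
        X ℕ.* δ ≤⟨ ℕ.*-monoʳ-≤ X (ℕ.m≤n+m∸n δ (2 ℕ.* k ℕ.* e)) ⟩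
        X ℕ.* (2 ℕ.* k ℕ.* e ℕ.+ (δ ℕ.∸ 2 ℕ.* k ℕ.* e)) ≡⟨ rearr₁ n′ ℓ (2 ℕ.* k ℕ.* e) (δ ℕ.∸ 2 ℕ.* k ℕ.* e) ⟩
        n′ ℕ.* (ℓ ℕ.* (δ ℕ.∸ 2 ℕ.* k ℕ.* e)) ℕ.+ X ℕ.* (2 ℕ.* k ℕ.* e) ≤⟨ ℕ.+-monoˡ-≤ (X ℕ.* (2 ℕ.* k ℕ.* e)) bound ⟩
        degSum G′ ℕ.+ n′ ℕ.* (ℓ ℕ.* ℓ ℕ.* e) ℕ.+ X ℕ.* (2 ℕ.* k ℕ.* e)
          ≤⟨ ℕ.+-monoˡ-≤ (X ℕ.* (2 ℕ.* k ℕ.* e)) (ℕ.+-mono-≤ (ℕ.≤-reflexive (degSum≡2E G′)) (ℕ.*-monoʳ-≤ n′ (ℕ.*-monoˡ-≤ e (ℕ.*-monoʳ-≤ ℓ ℓ≤k)))) ⟩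
        E′ ℕ.+ E′ ℕ.+ n′ ℕ.* (ℓ ℕ.* k ℕ.* e) ℕ.+ X ℕ.* (2 ℕ.* k ℕ.* e) ≡⟨ rearr₂ E′ n′ ℓ k e ⟩
        2 ℕ.* E′ ℕ.+ X ℕ.* (3 ℕ.* k ℕ.* e) ∎
        where
        open ℕ.≤-Reasoning
        rearr₁ : ∀ v l a b → v ℕ.* l ℕ.* (a ℕ.+ b) ≡ v ℕ.* (l ℕ.* b) ℕ.+ v ℕ.* l ℕ.* a
        rearr₁ = solve-∀
        rearr₂ : ∀ E v l k e → E ℕ.+ E ℕ.+ v ℕ.* (l ℕ.* k ℕ.* e) ℕ.+ v ℕ.* l ℕ.* (2 ℕ.* k ℕ.* e) ≡ 2 ℕ.* E ℕ.+ v ℕ.* l ℕ.* (3 ℕ.* k ℕ.* e)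
        rearr₂ = solve-∀
      rational : ι ℓ * ι n′ * ((1ℚ - ι (6 ℕ.* k) * ε) * d) ≤ℚ ι 2 * ι E′
      rational = begin
        ι ℓ * ι n′ * ((1ℚ - ι (6 ℕ.* k) * ε) * d)
          ≡⟨ solve 5 (λ l v s a b → l :* v :* ((con 1ℚ :- s :* a) :* b) := v :* l :* b :- v :* l :* (s :* (a :* b))) refl (ι ℓ) (ι n′) (ι (6 ℕ.* k)) ε d ⟩
        ι n′ * ι ℓ * d - ι n′ * ι ℓ * (ι (6 ℕ.* k) * q) ≡⟨ cong (λ t → t * d - t * (ι (6 ℕ.* k) * q)) (sym (ι-* n′ ℓ)) ⟩
        ι X * d - ι X * (ι (6 ℕ.* k) * q) ≤⟨ ≤+⇒-≤ (begin
          ι X * d ≤⟨ *-monoˡ (0≤ι X) d≤δ ⟩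
          ι X * ι δ ≡⟨ sym (ι-* X δ) ⟩
          ι (X ℕ.* δ) ≤⟨ ι-mono natural ⟩
          ι (2 ℕ.* E′ ℕ.+ X ℕ.* (3 ℕ.* k ℕ.* e)) ≡⟨ trans (ι-+ (2 ℕ.* E′) (X ℕ.* (3 ℕ.* k ℕ.* e))) (cong₂ _+_ (ι-* 2 E′) (ι-* X (3 ℕ.* k ℕ.* e))) ⟩
          ι 2 * ι E′ + ι X * ι (3 ℕ.* k ℕ.* e) ≤⟨ +-monoʳ-≤ (ι 2 * ι E′) (*-monoˡ (0≤ι X) 3ke≤6kq) ⟩
          ι 2 * ι E′ + ι X * (ι (6 ℕ.* k) * q) ∎) ⟩
        ι 2 * ι E′ ∎
        where
        open ≤-Reasoning
        open +-*-Solver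

    tree-case : TreeMinor ℓ → Σ Graph λ G′ → G′ ≼[ k ] G ×
      (frac k (8 ℕ.* ℓ) * (1ℚ - ι (2 ℕ.* k) * ε) * d ≤ℚ density G′)
    tree-case (G′ , model , 1≤n′ , few , loss) = G′ , minor-of-subgraph {k} {G′} {F} {G} model F⊆G ,
        ≤-trans (≤-reflexive (*-assoc (frac k (8 ℕ.* ℓ)) (1ℚ - ι (2 ℕ.* k) * ε) d))
          (frac-*-≤-frac k (8 ℕ.* ℓ) E′ n′ y (ℕ.*-mono-≤ {1} {8} (s≤s z≤n) (ℕ.≤-trans (s≤s z≤n) 2≤ℓ)) 1≤n′ rational)
      where
      n′ = n G′
      E′ = ∣E∣ G′
      v = n F
      y = (1ℚ - ι (2 ℕ.* k) * ε) * d
      y≡ : y ≡ d - ι (2 ℕ.* k) * q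
      y≡ = solve 3 (λ s a b → (con 1ℚ :- s :* a) :* b := b :- s :* (a :* b)) refl (ι (2 ℕ.* k)) ε d
        where open +-*-Solver
      -- The upper bound `few` on the order of the minor gets multiplied by `y`, which therefore
      -- must not be negative.
      0≤y : 0ℚ ≤ℚ y
      0≤y = ≤-trans (≤⇒0≤- (≤-trans (*-monoʳ 0≤q (ι-mono (ℕ.*-monoˡ-≤ k {2} {6} (s≤s (s≤s z≤n))))) 6kq≤d)) (≤-reflexive (sym y≡))
      natural : m ℕ.* v ℕ.≤ (E′ ℕ.+ v ℕ.* (2 ℕ.* e)) ℕ.* N
      natural = ℕ.*-cancelˡ-≤ 2 (begin
        2 ℕ.* (m ℕ.* v) ≡⟨ sym (ℕ.*-assoc 2 m v) ⟩
        2 ℕ.* m ℕ.* v ≤⟨ dense ⟩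
        degSum F ℕ.* N ≤⟨ ℕ.*-monoˡ-≤ N (ℕ.≤-trans loss (ℕ.+-monoˡ-≤ (v ℕ.* (4 ℕ.* e)) (ℕ.≤-reflexive (degSum≡2E G′)))) ⟩
        (E′ ℕ.+ E′ ℕ.+ v ℕ.* (4 ℕ.* e)) ℕ.* N ≡⟨ rearr E′ v e N ⟩
        2 ℕ.* ((E′ ℕ.+ v ℕ.* (2 ℕ.* e)) ℕ.* N) ∎)
        where
        open ℕ.≤-Reasoning
        rearr : ∀ E v e N → (E ℕ.+ E ℕ.+ v ℕ.* (4 ℕ.* e)) ℕ.* N ≡ 2 ℕ.* ((E ℕ.+ v ℕ.* (2 ℕ.* e)) ℕ.* N)
        rearr = solve-∀
      open ≤-Reasoning
      open +-*-Solver
      dv≤ : d * ι v ≤ℚ ι E′ + ι v * (ι 2 * ι e)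
      dv≤ = *-cancelʳ (ι-pos 1≤N) (begin
        d * ι v * ι N ≡⟨ solve 3 (λ a b c → a :* b :* c := a :* c :* b) refl d (ι v) (ι N) ⟩
        d * ι N * ι v ≡⟨ trans (cong (_* ι v) dN≡m) (sym (ι-* m v)) ⟩
        ι (m ℕ.* v) ≤⟨ ι-mono natural ⟩
        ι ((E′ ℕ.+ v ℕ.* (2 ℕ.* e)) ℕ.* N) ≡⟨ trans (ι-* (E′ ℕ.+ v ℕ.* (2 ℕ.* e)) N) (cong (_* ι N) (trans (ι-+ E′ (v ℕ.* (2 ℕ.* e)))
             (cong (λ t → ι E′ + t) (trans (ι-* v (2 ℕ.* e)) (cong (ι v *_) (ι-* 2 e)))))) ⟩
        (ι E′ + ι v * (ι 2 * ι e)) * ι N ∎)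
      -- The loss of `4e` ordered pairs per vertex is `2e ≤ 4εd` edges, and `k ≥ 2` turns this into
      -- `2kεd`.
      2e≤2kq : ι 2 * ι e ≤ℚ ι (2 ℕ.* k) * q
      2e≤2kq = begin
        ι 2 * ι e ≤⟨ *-monoˡ (0≤ι 2) e≤2q ⟩
        ι 2 * (ι 2 * q) ≤⟨ *-monoˡ (0≤ι 2) (*-monoʳ 0≤q (ι-mono 2≤k)) ⟩
        ι 2 * (ι k * q) ≡⟨ trans (sym (*-assoc (ι 2) (ι k) q)) (cong (_* q) (sym (ι-* 2 k))) ⟩
        ι (2 ℕ.* k) * q ∎
      vy≤E′ : ι v * y ≤ℚ ι E′
      vy≤E′ = begin
        ι v * y ≡⟨ trans (cong (ι v *_) y≡) (solve 3 (λ v b s → v :* (b :- s) := b :* v :- v :* s) refl (ι v) d (ι (2 ℕ.* k) * q)) ⟩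
        d * ι v - ι v * (ι (2 ℕ.* k) * q) ≤⟨ ≤+⇒-≤ (≤-trans dv≤ (+-monoʳ-≤ (ι E′) (*-monoˡ (0≤ι v) 2e≤2kq))) ⟩
        ι E′ ∎
      rational : ι k * ι n′ * y ≤ℚ ι (8 ℕ.* ℓ) * ι E′
      rational = begin
        ι k * ι n′ * y ≡⟨ cong (_* y) (trans (*-comm (ι k) (ι n′)) (sym (ι-* n′ k))) ⟩
        ι (n′ ℕ.* k) * y ≤⟨ *-monoʳ 0≤y (ι-mono few) ⟩
        ι (8 ℕ.* ℓ ℕ.* v) * y ≡⟨ trans (cong (_* y) (ι-* (8 ℕ.* ℓ) v)) (*-assoc (ι (8 ℕ.* ℓ)) (ι v) y) ⟩
        ι (8 ℕ.* ℓ) * (ι v * y) ≤⟨ *-monoˡ (0≤ι (8 ℕ.* ℓ)) vy≤E′ ⟩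
        ι (8 ℕ.* ℓ) * ι E′ ∎

    trichotomy : Dense ⊎ (StarMinor F ℓ (δ ℕ.∸ 2 ℕ.* k ℕ.* e) e ⊎ TreeMinor ℓ)
    trichotomy = dense-or-minor ℓ δ 2≤ℓ 1≤nF min-deg few-big e≤Δ 3ke≤δ

open import Defs
open import Data.Nat using (ℕ; _≤_)
open import Data.Rational using (ℚ; 0ℚ; 1ℚ; _+_; _*_; _-_) renaming (_≤_ to _≤ℚ_; _<_ to _<ℚ_)
open import Data.Product using (Σ; _×_)
open import Data.Sum using (_⊎_)
import Data.Sum as Sum

theorem2p5 : (k ℓ : ℕ) → 2 ≤ ℓ → ℓ ≤ k →
    (ε : ℚ) → 0ℚ <ℚ ε → ε * ℕtoℚ (6 Data.Nat.* k) <ℚ 1ℚ →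
    (G : Graph) → 1ℚ ≤ℚ ε * density G →
    (Σ Graph λ H → H ⊆ᵍ G ×
    (ℕtoℚ (∣V∣ H) ≤ℚ ℕtoℚ (3 Data.Nat.* (k Data.Nat.^ 3)) * density G) ×
    (frac 1 2 * (ε * ε) * (density G * density G) ≤ℚ ℕtoℚ (∣E∣ H)))
    ⊎ (Σ Graph λ G' → G' ≼[ ℓ Data.Nat.+ 1 ] G ×
    (frac ℓ 2 * (1ℚ - ℕtoℚ (6 Data.Nat.* k) * ε) * density G ≤ℚ density G'))
    ⊎ (Σ Graph λ G' → G' ≼[ k ] G ×
    (frac k (8 Data.Nat.* ℓ) * (1ℚ - ℕtoℚ (2 Data.Nat.* k) * ε) * density G ≤ℚ density G'))
theorem2p5 k ℓ 2≤ℓ ℓ≤k ε 0<ε 6kε<1 G 1≤εd = Sum.map dense-case (Sum.map star-case tree-case) trichotomy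
  where open Translation.Parameters k ℓ 2≤ℓ ℓ≤k ε 0<ε 6kε<1 G 1≤εd
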